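{- There is a real constant $c>0$ such that for infinitely many positive integers $n$ there exists a circulant graph of order $n$ whose Weisfeiler-Leman dimension is at least $c\sqrt{\log n}$.
   Context: Graphs may be directed or undirected. For a group $G$ and $X\subseteq G$, the Cayley graph $\mathrm{Cay}(G,X)$ has vertex set $G$ and arcs $(x,y)$ with $yx^{ -1}\in X$. A circulant graph is a Cayley graph of a cyclic group. $m$-dimensional Weisfeiler-Leman ($m$-dim WL) algorithm, $m\ge 2$: for a graph with vertex set $\Omega$ and arc set $E$, the initial color of $x\in\Omega^m$ encodes, for all $1\le i,j\le m$, whether $x_i=x_j$ and whether $(x_i,x_j)\in E$. In each step the color $c(x)$ is replaced by the pair consisting of $c(x)$ and the multiset, over $\alpha\in\Omega$, of the tuples $(c(x_{1\leftarrow\alpha}),\ldots,c(x_{m\leftarrow\alpha}))$, where $x_{i\leftarrow\alpha}$ is $x$ with the $i$-th entry replaced by $\alpha$; this is repeated until the partition of $\Omega^m$ into color classes stabilizes. For $m=1$ the algorithm is the usual (naive) vertex color refinement. Two graphs are $\mathrm{WL}_m$-equivalent if, when the algorithm is run in parallel on both, every color occurs equally often in both. The Weisfeiler-Leman dimension of a graph $\mathcal{G}$ is the smallest positive integer $m$ such that every graph $\mathrm{WL}_m$-equivalent to $\mathcal{G}$ is isomorphic to $\mathcal{G}$. -}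

module Defs where

open import Algebra.Bundles using (Group)
open import Algebra.Structures using (IsGroup)
import Algebra.Definitions.RawMonoid as RawMonoidDefs
open import Data.Bool using (Bool)
open import Data.Fin using (Fin)
import Data.Fin as Fin
open import Data.Fin.Subset using (Subset)
open import Data.Integer using (ℤ; +_; -[1+_])
import Data.Integer as ℤ
open import Data.List using (List; []; _∷_; map; allFin; filterᵇ; cartesianProductWith)
import Data.List.Relation.Binary.Permutation.Setoid as Permutation
open import Data.Nat using (ℕ; zero; suc; NonZero; _*_; _^_; _≤_; _<_)
open import Data.Product using (Σ; ∃; _×_; _,_)
open import Data.Product.Relation.Binary.Pointwise.NonDependent using (_×ₛ_)
open import Data.Rational using (ℚ; ↥_; ↧ₙ_)
open import Data.Sum using (_⊎_; [_,_])
open import Data.Vec using (Vec; []; _∷_; lookup; tabulate; _[_]≔_)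
open import Data.Vec.Relation.Binary.Equality.Setoid using (≋-setoid)
open import Function using (_↔_; Inverse)
open import Level using (0ℓ)
open import Relation.Binary using (Setoid)
open import Relation.Binary.PropositionalEquality using (_≡_; setoid)
open import Relation.Nullary using (¬_; does)

-- Finite directed graphs, loops allowed; undirected graphs are those with a
-- symmetric arc relation.

record Graph (n : ℕ) : Set where
  constructor graph
  field
    arc : Fin n → Fin n → Bool

open Graph public

Isomorphic : ∀ {n n′} → Graph n → Graph n′ → Set
Isomorphic {n} {n′} G H =
  Σ (Fin n ↔ Fin n′) λ f →
    ∀ x y → arc G x y ≡ arc H (Inverse.to f x) (Inverse.to f y)

-- Integer powers; the library's natural multiples are those of an additively
-- written monoid.

power : ∀ {a ℓ} (𝔾 : Group a ℓ) → Group.Carrier 𝔾 → ℤ → Group.Carrier 𝔾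
power 𝔾 g = λ where
    (+ k)    → k times g
    -[1+ k ] → (suc k times g) ⁻¹
  where
  open Group 𝔾 using (_⁻¹; rawMonoid)
  open RawMonoidDefs rawMonoid using () renaming (_×_ to _times_)

IsCyclic : ∀ {a ℓ} → Group a ℓ → Set _
IsCyclic 𝔾 = ∃ λ g → ∀ x → ∃ λ (k : ℤ) → x ≈ power 𝔾 g k
  where open Group 𝔾 using (_≈_)

-- A group of order n, with its elements listed as Fin n.

record FiniteGroup (n : ℕ) : Set where
  infixl 7 _∙_
  infix  8 _⁻¹
  field
    _∙_     : Fin n → Fin n → Fin n
    ε       : Fin n
    _⁻¹     : Fin n → Fin n
    isGroup : IsGroup _≡_ _∙_ ε _⁻¹

  group : Group 0ℓ 0ℓ
  group = record { isGroup = isGroup }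

Cay : ∀ {n} → FiniteGroup n → Subset n → Graph n
Cay 𝔾 X = graph λ x y → lookup X (y ∙ x ⁻¹)
  where open FiniteGroup 𝔾

IsCirculant : ∀ {n} → Graph n → Set
IsCirculant {n} G =
  Σ (FiniteGroup n) λ 𝔾 → IsCyclic (FiniteGroup.group 𝔾) ×
  Σ (Subset n) λ X → ∀ x y → arc G x y ≡ arc (Cay 𝔾 X) x y

-- Multisets are lists up to permutation.

Multiset : Setoid 0ℓ 0ℓ → Setoid 0ℓ 0ℓ
Multiset S = Permutation.↭-setoid S

-- A colour refinement algorithm: the objects coloured on vertex set Fin n
-- (each listed once by `objects`), and the colour of each object after r
-- rounds.  The colours do not depend on the graph, so that colours of objects
-- of different graphs can be compared when running the algorithm in parallel.

record Refinement : Set₁ where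
  field
    Object  : ℕ → Set
    objects : ∀ n → List (Object n)
    Colour  : ℕ → Setoid 0ℓ 0ℓ
    colour  : ∀ {n} → Graph n → ∀ r → Object n → Setoid.Carrier (Colour r)

-- In a parallel run, the partition that has to stabilise is the partition of
-- the objects of both graphs together: two regular graphs of different
-- valencies each have a stable initial vertex colouring, but are distinguished
-- one round later.  Since a new colour contains the old one, no class is ever
-- merged, so stability only says that none is split.

module Parallel (A : Refinement) {n n′ : ℕ} (G : Graph n) (H : Graph n′) where
  open Refinement A

  colour₂ : ∀ r → Object n ⊎ Object n′ → Setoid.Carrier (Colour r)
  colour₂ r = [ colour G r , colour H r ]

  Stable : ℕ → Set
  Stable r = ∀ u v → Setoid._≈_ (Colour r) (colour₂ r u) (colour₂ r v) →
    Setoid._≈_ (Colour (suc r)) (colour₂ (suc r) u) (colour₂ (suc r) v)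

  SameColours : ℕ → Set
  SameColours r = Setoid._≈_ (Multiset (Colour r))
    (map (colour G r) (objects n)) (map (colour H r) (objects n′))

  -- Rounds after the first stable one do not change the classes, so any
  -- stable round gives the same answer.
  Equivalent : Set
  Equivalent = ∃ λ r → Stable r × SameColours r

-- Vertex colour refinement.  The initial colour of x records whether (x , x)
-- is an arc (hence is constant on loopless graphs); each round adds the
-- multisets of colours of the out-neighbours and of the in-neighbours.

module Naive where
  Colour : ℕ → Setoid 0ℓ 0ℓ
  Colour zero    = setoid Bool
  Colour (suc r) = Colour r ×ₛ (Multiset (Colour r) ×ₛ Multiset (Colour r))

  colour : ∀ {n} → Graph n → ∀ r → Fin n → Setoid.Carrier (Colour r)
  colour     G zero    x = arc G x x
  colour {n} G (suc r) x =
    colour G r x ,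
    map (colour G r) (filterᵇ (λ y → arc G x y) (allFin n)) ,
    map (colour G r) (filterᵇ (λ y → arc G y x) (allFin n))

naive : Refinement
naive = record
  { Object = Fin ; objects = allFin ; Colour = Naive.Colour ; colour = Naive.colour }

module Tuples (m : ℕ) where
  tuples : ∀ k n → List (Vec (Fin n) k)
  tuples zero    n = [] ∷ []
  tuples (suc k) n = cartesianProductWith _∷_ (allFin n) (tuples k n)

  Colour : ℕ → Setoid 0ℓ 0ℓ
  Colour zero    = setoid (Vec (Vec (Bool × Bool) m) m)
  Colour (suc r) = Colour r ×ₛ Multiset (≋-setoid (Colour r) m)

  colour : ∀ {n} → Graph n → ∀ r → Vec (Fin n) m → Setoid.Carrier (Colour r)
  colour G zero x = tabulate λ i → tabulate λ j →
    does (lookup x i Fin.≟ lookup x j) , arc G (lookup x i) (lookup x j)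
  colour {n} G (suc r) x =
    colour G r x ,
    map (λ α → tabulate λ i → colour G r (x [ i ]≔ α)) (allFin n)

tupleRefinement : ℕ → Refinement
tupleRefinement m = record
  { Object = λ n → Vec (Fin n) m ; objects = tuples m ; Colour = Colour ; colour = colour }
  where open Tuples m

WL : (m : ℕ) → .{{_ : NonZero m}} → Refinement
WL (suc zero)      = naive
WL m@(suc (suc _)) = tupleRefinement m

WLEquivalent : (m : ℕ) → .{{_ : NonZero m}} → ∀ {n n′} → Graph n → Graph n′ → Set
WLEquivalent m G H = Parallel.Equivalent (WL m) G H

Identifies : (m : ℕ) → .{{_ : NonZero m}} → ∀ {n} → Graph n → Set
Identifies m G = ∀ {n′} (H : Graph n′) → WLEquivalent m G H → Isomorphic G H

record IsWLDimension {n : ℕ} (G : Graph n) (d : ℕ) : Set where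
  field
    .{{nonZero}} : NonZero d
    identifies   : Identifies d G
    minimal      : ∀ m → .{{_ : NonZero m}} → m < d → ¬ Identifies m G

-- c √(log₂ n) ≤ d for a rational c = p / q > 0 and n ≥ 1: squaring and clearing
-- denominators gives p² log₂ n ≤ (q d)², that is, n ^ p² ≤ 2 ^ (q d)².
-- Quantified over all c > 0, this loses nothing against real c and other bases:
-- changing the base rescales c, and a bound for c gives one for any smaller c.

_√log₂_≤_ : ℚ → ℕ → ℕ → Set
c √log₂ n ≤ d = n ^ (p ^ 2) ≤ 2 ^ ((q * d) ^ 2)
  where
  p = ℤ.∣ ↥ c ∣
  q = ↧ₙ c

{-# OPTIONS --safe #-}
module Submission where

-- The vertices are the residues modulo n = q · 3^l · 5^l · 7^l · 11^l, read through the Chinese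
-- remainder theorem as four strings of l digits, least significant first, and a residue modulo q.
-- Translation preserves the first position at which two strings differ (their level) and the cyclic
-- difference of the digits there, of which only a sign (the sense) is used; reflecting digits
-- reverses the senses at any chosen levels, independently in different branches of the tree of
-- prefixes.  The l = k² levels serve as the edges of a k × k grid, and the product of the senses at
-- the four edges of a node is recorded in the graph G: this is the construction of Cai, Fürer and
-- Immerman, with a graph H that records the opposite product at one node.  G and H are not
-- isomorphic, because a product of signs over all nodes of the grid counts every edge twice.  In each
-- of the four coordinates m + 1 points show at most m + 1 levels, so as long as 2 (m + 1) < k some
-- row and some column of the grid are unpinned, and Duplicator can hide the defect where they cross.
-- The residue modulo q serves to encode a coloured digraph in a digraph: the colour of a pair becomes
-- a number of out-neighbours.  Hence the dimension exceeds (k − 3) / 2, while log n = O(k²).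

open import Defs
open import Algebra.Bundles using (Group)
import Algebra.Definitions.RawMonoid as RawMonoidDefs
import Algebra.Properties.Group as GroupProperties
open import Algebra.Structures using (IsGroup)
open import Data.Bool using (Bool; true; false; not; T; _xor_; _∧_; if_then_else_)
import Data.Bool.Properties as Bool
open import Data.Bool.Solver using (module xor-∧-Solver)
open import Data.Empty using (⊥)
open import Data.Fin using (Fin; zero; suc; toℕ; fromℕ; fromℕ<; punchOut; combine; remQuot)
import Data.Fin as Fin
open import Data.Fin.Patterns using (0F; 1F; 2F; 3F)
import Data.Fin.Properties as Fin
open import Data.Fin.Subset using (Subset)
open import Data.Fin.Subset.Properties using (anySubset?)
import Data.Integer as ℤ
open import Data.List using (List; []; _∷_; map; allFin; length; filter; filterᵇ; cartesianProduct; cartesianProductWith; _++_)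
import Data.List as List
open import Data.List.Membership.Propositional using (_∈_; _∉_; lose; find)
open import Data.List.Membership.Propositional.Properties
  using (∈-map⁺; ∈-map⁻; ∈-++⁺ˡ; ∈-++⁺ʳ; ∈-cartesianProduct⁺; ∈-cartesianProductWith⁺; ∈-allFin; ∈-filter⁺)
open import Data.List.Membership.Propositional.Properties.WithK using (unique∧set⇒bag)
import Data.List.Membership.Setoid.Properties as SetoidMembership
open import Data.List.Properties using (map-cong; map-∘; map-id; length-map; length-++; length-tabulate; filter-notAll)
open import Data.List.Relation.Binary.BagAndSetEquality using (∼bag⇒↭)
import Data.List.Relation.Binary.Permutation.Propositional as Perm
import Data.List.Relation.Binary.Permutation.Propositional.Properties as Permₚ
import Data.List.Relation.Binary.Permutation.Setoid as SetoidPerm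
import Data.List.Relation.Binary.Permutation.Setoid.Properties as SetoidPermₚ
import Data.List.Relation.Binary.Pointwise as Pointwise
open import Data.List.Relation.Unary.All using (All; []; _∷_)
import Data.List.Relation.Unary.All as All
import Data.List.Relation.Unary.All.Properties as All
open import Data.List.Relation.Unary.AllPairs using ([]; _∷_)
open import Data.List.Relation.Unary.Any using (Any; here; there; index)
import Data.List.Relation.Unary.Any as Any
import Data.List.Relation.Unary.Any.Properties as Any
open import Data.List.Relation.Unary.Unique.Propositional using (Unique)
import Data.List.Relation.Unary.Unique.Propositional.Properties as Unique
open import Data.Nat using
  ( ℕ; zero; suc; _+_; _*_; _^_; _∸_; _≤_; _<_; z≤n; s≤s; s≤s⁻¹; NonZero; >-nonZero⁻¹
  ; _<ᵇ_; _≡ᵇ_; _≤?_; _<?_)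
open import Data.Nat.Coprimality using (Coprime; coprime?; coprime-Bézout; coprime-divisor)
import Data.Nat.Coprimality as Coprimality
open import Data.Nat.Divisibility using (_∣_; divides; divides-refl; _∣?_; ∣-trans; ∣m+n∣m⇒∣n; ∣1⇒≡1; m∣m*n; n∣m*n)
open import Data.Nat.DivMod using
  ( _/_; _%_; _mod_; m%n<n; m%n%n≡m%n; n%n≡0; m≡m%n+[m/n]*n; [m+kn]%n≡m%n; +-distrib-/-∣ʳ; m*n/n≡m
  ; m<n*o⇒m/o<n; m<n⇒m%n≡m; m<n⇒m/n≡0; %-distribˡ-+)
open import Data.Nat.GCD using (module Bézout)
import Data.Nat.Properties as ℕ
open import Data.Nat.Tactic.RingSolver using (solve-∀)
open import Data.List.Membership.DecPropositional ℕ._≟_ using (_∈?_)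
open import Data.Product using (Σ; ∃; ∃₂; _×_; _,_; proj₁; proj₂; uncurry)
import Data.Product.Properties as Prod
open import Data.Rational using (ℚ; Positive)
import Data.Rational as ℚ
open import Data.Sum using (_⊎_; inj₁; inj₂; [_,_]′)
import Data.Sum as Sum
open import Data.Vec using (Vec; []; _∷_; lookup; tabulate; toList; replicate; _[_]≔_)
import Data.Vec as Vec
open import Data.Vec.Membership.Propositional.Properties using (∈-toList⁺; ∈-lookup)
import Data.Vec.Properties as Vec
open import Data.Vec.Relation.Binary.Equality.Setoid using (≋-setoid)
import Data.Vec.Relation.Binary.Pointwise.Inductive as VecPointwise
open import Function using (_↔_; Inverse; mk↔ₛ′; mk⇔; _∘_; _∘′_; id; case_of_)
open import Function.Properties.Inverse using (↔-sym)
open import Level using (0ℓ)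
open import Relation.Binary using (Setoid; Decidable; tri<; tri≈; tri>)
open import Relation.Binary.PropositionalEquality
open import Relation.Nullary using (¬_; Dec; yes; no; does; contradiction; ¬?)
open import Relation.Nullary.Decidable
  using (_×-dec_; _⊎-dec_; _→-dec_; map′; T?; dec-true; dec-false; decidable-stable; from-yes)

-- Colour refinement

-- A pair of points shows one level in each coordinate, and a node of the grid has four edges: hence
-- four coordinates. The coordinates `0F` and `1F` read horizontal edges, `2F` and `3F` vertical
-- ones, so each edge is read in one coordinate at one of its ends and in another at the other end.
-- Counting every edge twice therefore requires that both coordinates be reversed together; extra
-- bits of the colour, comparing the senses of a pair whose two levels agree, enforce this. It is
-- also the source of the factor 2 in 2 (m + 1) < k: a free row must avoid the levels pinned in two
-- coordinates.
--
-- The obstacle in the game is that Duplicator has to announce a bijection before Spoiler picks a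
-- point, although the map that hides the defect depends on that point. The answer is a bijection
-- because the map preserves levels: the image of the point leads to the same choice of row and
-- column, and the same involution leads back.
--
-- The dimension is asked for as an exact number, so it is found by search; this is why equivalence
-- and isomorphism are shown decidable.

does-true : ∀ {P : Set} (P? : Dec P) → does P? ≡ true → P
does-true (yes p) _ = p

does-cong : ∀ {P Q : Set} (P? : Dec P) (Q? : Dec Q) → (P → Q) → (Q → P) → does P? ≡ does Q?
does-cong (yes p) Q? P⇒Q _ = sym (dec-true Q? (P⇒Q p))
does-cong (no ¬p) Q? _ Q⇒P = sym (dec-false Q? (¬p ∘ Q⇒P))


-- A missed value could be punched out, which would inject `suc n` points into `n`.
injective⇒surjective : ∀ {n} (f : Fin n → Fin n) → (∀ {x y} → f x ≡ f y → x ≡ y) →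
  ∀ y → ∃ λ x → f x ≡ y
injective⇒surjective {suc n} f inj y with Fin.any? (λ x → f x Fin.≟ y)
... | yes hit = hit
... | no miss = contradiction (Fin.injective⇒≤ {f = λ x → punchOut (avoid x)} (λ {x} {x′} eq →
        inj (Fin.punchOut-injective (avoid x) (avoid x′) eq)))
        (ℕ.<⇒≱ (ℕ.n<1+n n))
  where
  avoid : ∀ x → y ≢ f x
  avoid x eq = miss (x , sym eq)

module _ {A : Set} {xs : List A} (unique : Unique xs) (complete : ∀ x → x ∈ xs) where
  open Perm using (_↭_)

  map-bijection-↭ : (f f⁻¹ : A → A) → (∀ x → f⁻¹ (f x) ≡ x) → (∀ x → f (f⁻¹ x) ≡ x) → map f xs ↭ xs
  map-bijection-↭ f f⁻¹ left right = ∼bag⇒↭ (unique∧set⇒bag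
    (Unique.map⁺ (λ {x} {y} eq → trans (sym (left x)) (trans (cong f⁻¹ eq) (left y))) unique) unique
    (mk⇔ (λ _ → complete _) (λ _ → subst (_∈ map f xs) (right _) (∈-map⁺ f (complete (f⁻¹ _))))))

module _ (S : Setoid 0ℓ 0ℓ) where
  open Setoid S using (Carrier; _≈_) renaming (refl to ≈-refl; sym to ≈-sym; trans to ≈-trans)
  open SetoidPerm S using (_↭_; ↭-refl; ↭-sym; ↭-trans; ↭-prep; ↭-reflexive-≋)
  open import Data.List.Relation.Binary.Equality.Setoid S using (_≋_)

  ↭-from-pointwise : ∀ {A : Set} (f g : A → Carrier) → (∀ x → f x ≈ g x) → ∀ xs → map f xs ↭ map g xs
  ↭-from-pointwise f g eq xs = ↭-reflexive-≋ (Pointwise.map⁺ f g (Pointwise.refl (λ {x} → eq x)))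

  map-↭ : ∀ {A : Set} (f : A → Carrier) {xs ys : List A} → xs Perm.↭ ys → map f xs ↭ map f ys
  map-↭ f = SetoidPermₚ.map⁺ (setoid _) S (λ { refl → ≈-refl }) ∘′ Perm.↭⇒↭ₛ

  module _ (_≈?_ : Decidable _≈_) where
    -- It does not matter which occurrence of x is removed from the second list: moved to the front,
    -- it cancels against x.
    _↭?_ : Decidable _↭_
    [] ↭? [] = yes ↭-refl
    [] ↭? (y ∷ ys) = no (λ p → SetoidPermₚ.¬x∷xs↭[] S (↭-sym p))
    (x ∷ xs) ↭? ys with Any.any? (x ≈?_) ys
    ... | no x∉ys = no (λ p → x∉ys (SetoidPermₚ.∈-resp-↭ S p (here ≈-refl)))
    ... | yes x∈ys with SetoidMembership.∈-∃++ S x∈ys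
    ... | as , bs , v , x≈v , eq = map′ grow shrink (xs ↭? (as ++ bs))
      where
      shifted : ys ↭ x ∷ as ++ bs
      shifted = ↭-trans (↭-reflexive-≋ eq) (SetoidPermₚ.shift S (≈-sym x≈v) as bs)
      grow : xs ↭ as ++ bs → x ∷ xs ↭ ys
      grow p = ↭-trans (↭-prep x p) (↭-sym shifted)
      shrink : x ∷ xs ↭ ys → xs ↭ as ++ bs
      shrink p = SetoidPermₚ.drop-∷ S (↭-trans p shifted)

module Run
  (A : Refinement)
  (complete : ∀ {n} (u : Refinement.Object A n) → u ∈ Refinement.objects A n)
  (colour-dec : ∀ r → Decidable (Setoid._≈_ (Refinement.Colour A r)))
  (old : ∀ r → Setoid.Carrier (Refinement.Colour A (suc r)) → Setoid.Carrier (Refinement.Colour A r))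
  (old-cong : ∀ r {c d} → Setoid._≈_ (Refinement.Colour A (suc r)) c d → Setoid._≈_ (Refinement.Colour A r) (old r c) (old r d))
  (old-colour : ∀ {n} (G : Graph n) r u → old r (Refinement.colour A G (suc r) u) ≡ Refinement.colour A G r u)
  {n n′ : ℕ} (G : Graph n) (H : Graph n′)
  where

  open Refinement A
  open Parallel A G H

  private
    Vertex₂ : Set
    Vertex₂ = Object n ⊎ Object n′

    _≈[_]_ : Vertex₂ → ℕ → Vertex₂ → Set
    u ≈[ r ] v = Setoid._≈_ (Colour r) (colour₂ r u) (colour₂ r v)

    old-colour₂ : ∀ r u → old r (colour₂ (suc r) u) ≡ colour₂ r u
    old-colour₂ r (inj₁ u) = old-colour G r u
    old-colour₂ r (inj₂ u) = old-colour H r u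

    coarsen : ∀ r u v → u ≈[ suc r ] v → u ≈[ r ] v
    coarsen r u v eq = subst₂ (Setoid._≈_ (Colour r)) (old-colour₂ r u) (old-colour₂ r v) (old-cong r eq)

    everything : List Vertex₂
    everything = map inj₁ (objects n) ++ map inj₂ (objects n′)

    ∈-everything : ∀ u → u ∈ everything
    ∈-everything (inj₁ u) = ∈-++⁺ˡ (∈-map⁺ inj₁ (complete u))
    ∈-everything (inj₂ u) = ∈-++⁺ʳ _ (∈-map⁺ inj₂ (complete u))

    SameClass? : ∀ r → (p : Vertex₂ × Vertex₂) → Dec (proj₁ p ≈[ r ] proj₂ p)
    SameClass? r (u , v) = colour-dec r (colour₂ r u) (colour₂ r v)

  -- Taken least because `Equivalent` only names some stable round. Any such round is at or after
  -- this one, and equality of colour counts passes down to earlier rounds, so this single round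
  -- decides equivalence.
  FirstStable : Set
  FirstStable = ∃ λ r → Stable r × (∀ r′ → r′ < r → ¬ Stable r′)

  private
    -- Each unstable round shortens the list ps of pairs of equal colour.
    search : ∀ fuel r (ps : List (Vertex₂ × Vertex₂)) → length ps < fuel →
      (∀ u v → u ≈[ r ] v → (u , v) ∈ ps) → All (λ p → proj₁ p ≈[ r ] proj₂ p) ps →
      (∀ r′ → r′ < r → ¬ Stable r′) → FirstStable
    search (suc fuel) r ps short covers sound unstable with All.all? (SameClass? (suc r)) ps
    ... | yes kept = r , (λ u v eq → All.lookup kept (covers u v eq)) , unstable
    ... | no split = search fuel (suc r) (filter (SameClass? (suc r)) ps)
        (ℕ.<-≤-trans (filter-notAll (SameClass? (suc r)) ps (All.¬All⇒Any¬ (SameClass? (suc r)) ps split)) (s≤s⁻¹ short))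
        (λ u v eq → ∈-filter⁺ (SameClass? (suc r)) (covers u v (coarsen r u v eq)) eq)
        (All.all-filter (SameClass? (suc r)) ps)
        unstable′
      where
      unstable′ : ∀ r′ → r′ < suc r → ¬ Stable r′
      unstable′ r′ r′<1+r stable with ℕ.m≤n⇒m<n∨m≡n (s≤s⁻¹ r′<1+r)
      ... | inj₁ r′<r = unstable r′ r′<r stable
      ... | inj₂ refl = split (All.map (λ {p} → stable (proj₁ p) (proj₂ p)) sound)

  firstStable : FirstStable
  firstStable = search _ 0 (filter (SameClass? 0) pairs) (ℕ.n<1+n _)
    (λ u v → ∈-filter⁺ (SameClass? 0) (∈-cartesianProduct⁺ (∈-everything u) (∈-everything v)))
    (All.all-filter (SameClass? 0) pairs) (λ _ ())
    where
    pairs = cartesianProduct everything everything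

  sameColours-old : ∀ r → SameColours (suc r) → SameColours r
  sameColours-old r same = subst₂ _↭_ (forget G _) (forget H _)
    (SetoidPermₚ.map⁺ (Colour (suc r)) (Colour r) (old-cong r) same)
    where
    open SetoidPerm (Colour r) using (_↭_)
    forget : ∀ {k} (K : Graph k) us → map (old r) (map (colour K (suc r)) us) ≡ map (colour K r) us
    forget K us = trans (sym (map-∘ us)) (map-cong (old-colour K r) us)

  sameColours-≤ : ∀ {r r′} → r ≤ r′ → SameColours r′ → SameColours r
  sameColours-≤ {r} {r′} r≤r′ same with ℕ.m≤n⇒m<n∨m≡n r≤r′
  ... | inj₂ refl = same
  sameColours-≤ {r} {suc r′} _ same | inj₁ r<1+r′ = sameColours-≤ (s≤s⁻¹ r<1+r′) (sameColours-old r′ same)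

  equivalent : (∀ r → SameColours r) → Equivalent
  equivalent same = let r , stable , _ = firstStable in r , stable , same r

  equivalent? : Dec Equivalent
  equivalent? with firstStable
  ... | r , stable , first with _↭?_ (Colour r) (colour-dec r) (map (colour G r) (objects n)) (map (colour H r) (objects n′))
  ... | yes same = yes (r , stable , same)
  ... | no differ = no λ { (r′ , stable′ , same′) → differ (sameColours-≤ (ℕ.≮⇒≥ (λ r′<r → first r′ r′<r stable′)) same′) }

naive-dec : ∀ r → Decidable (Setoid._≈_ (Naive.Colour r))
naive-dec zero = Bool._≟_
naive-dec (suc r) (c , outs , ins) (c′ , outs′ , ins′) =
  naive-dec r c c′ ×-dec (_↭?_ (Naive.Colour r) (naive-dec r) outs outs′ ×-dec _↭?_ (Naive.Colour r) (naive-dec r) ins ins′)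

module NaiveRun {n n′} (G : Graph n) (H : Graph n′) =
  Run naive ∈-allFin naive-dec (λ _ → proj₁) (λ _ → proj₁) (λ _ _ _ → refl) G H

module _ (m : ℕ) where
  open Tuples m

  ∈-tuples : ∀ {k n} (x : Vec (Fin n) k) → x ∈ tuples k n
  ∈-tuples [] = here refl
  ∈-tuples (i ∷ x) = ∈-cartesianProductWith⁺ _∷_ (∈-allFin i) (∈-tuples x)

  tuples-unique : ∀ k n → Unique (tuples k n)
  tuples-unique zero n = [] ∷ []
  tuples-unique (suc k) n = Unique.cartesianProductWith⁺ _∷_ Vec.∷-injective (Unique.allFin⁺ n) (tuples-unique k n)

  tuple-dec : ∀ r → Decidable (Setoid._≈_ (Colour r))
  tuple-dec zero = Vec.≡-dec (Vec.≡-dec (Prod.≡-dec Bool._≟_ Bool._≟_))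
  tuple-dec (suc r) (c , cs) (c′ , cs′) =
    tuple-dec r c c′ ×-dec _↭?_ (≋-setoid (Colour r) m) (VecPointwise.decidable (tuple-dec r)) cs cs′

  module TupleRun {n n′} (G : Graph n) (H : Graph n′) =
    Run (tupleRefinement m) ∈-tuples tuple-dec (λ _ → proj₁) (λ _ → proj₁) (λ _ _ _ → refl) G H

-- Existence of the dimension: long tuples identify every graph, and identification is decidable

length-cartesianProductWith : ∀ {A B C : Set} (f : A → B → C) xs ys →
  length (cartesianProductWith f xs ys) ≡ length xs * length ys
length-cartesianProductWith f [] ys = refl
length-cartesianProductWith f (x ∷ xs) ys = trans (length-++ (map (f x) ys))
  (cong₂ _+_ (length-map (f x) ys) (length-cartesianProductWith f xs ys))

length-tuples : ∀ m k n → length (Tuples.tuples m k n) ≡ n ^ k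
length-tuples m zero n = refl
length-tuples m (suc k) n = trans (length-cartesianProductWith _∷_ (allFin n) (Tuples.tuples m k n))
  (cong₂ _*_ (length-tabulate {n = n} id) (length-tuples m k n))

^-injectiveˡ : ∀ k .{{_ : NonZero k}} {a b} → a ^ k ≡ b ^ k → a ≡ b
^-injectiveˡ k {a} {b} eq with ℕ.<-cmp a b
... | tri< a<b _ _ = contradiction eq (ℕ.<⇒≢ (ℕ.^-monoˡ-< k a<b))
... | tri≈ _ a≡b _ = a≡b
... | tri> _ _ b<a = contradiction (sym eq) (ℕ.<⇒≢ (ℕ.^-monoˡ-< k b<a))

module _ (m : ℕ) .{{_ : NonZero m}} where
  open Tuples m

  TupleEquivalent : ∀ {n n′} → Graph n → Graph n′ → Set
  TupleEquivalent = Parallel.Equivalent (tupleRefinement m)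

  equivalent⇒same-order : ∀ {n n′} (G : Graph n) (H : Graph n′) → TupleEquivalent G H → n ≡ n′
  equivalent⇒same-order {n} {n′} G H (r , _ , same) = ^-injectiveˡ m (begin
    n ^ m ≡⟨ length-tuples m m n ⟨
    length (tuples m n) ≡⟨ length-map (colour G r) (tuples m n) ⟨
    length (map (colour G r) (tuples m n)) ≡⟨ SetoidPermₚ.xs↭ys⇒|xs|≡|ys| (Colour r) same ⟩
    length (map (colour H r) (tuples m n′)) ≡⟨ length-map (colour H r) (tuples m n′) ⟩
    length (tuples m n′) ≡⟨ length-tuples m m n′ ⟩
    n′ ^ m ∎)
    where open ≡-Reasoning

  colour-cong : ∀ {n} {G H : Graph n} → (∀ x y → arc G x y ≡ arc H x y) → ∀ r x → colour G r x ≡ colour H r x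
  colour-cong eq zero x = Vec.tabulate-cong λ i → Vec.tabulate-cong λ j → cong (_ ,_) (eq _ _)
  colour-cong {n} eq (suc r) x = cong₂ _,_ (colour-cong eq r x)
    (map-cong (λ α → Vec.tabulate-cong λ i → colour-cong eq r (x [ i ]≔ α)) (allFin n))

  equivalent-cong : ∀ {n n′} (G : Graph n) {H H′ : Graph n′} → (∀ x y → arc H x y ≡ arc H′ x y) →
    TupleEquivalent G H → TupleEquivalent G H′
  equivalent-cong {n} {n′} G {H} {H′} eq (r , stable , same) =
    r , (λ u v eq′ → subst₂ (Setoid._≈_ (Colour (suc r))) (recolour (suc r) u) (recolour (suc r) v)
          (stable u v (subst₂ (Setoid._≈_ (Colour r)) (sym (recolour r u)) (sym (recolour r v)) eq′))) ,
    subst (map (colour G r) (tuples m n) ↭_) (map-cong (colour-cong eq r) _) same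
    where
    open SetoidPerm (Colour r) using (_↭_)
    recolour : ∀ r u → Parallel.colour₂ (tupleRefinement m) G H r u ≡ Parallel.colour₂ (tupleRefinement m) G H′ r u
    recolour r (inj₁ u) = refl
    recolour r (inj₂ u) = colour-cong eq r u

atomic : ∀ {k n} → Graph n → Vec (Fin n) k → Vec (Vec (Bool × Bool) k) k
atomic {k} G = Tuples.colour k G 0

lookup-atomic : ∀ {k n} (G : Graph n) (x : Vec (Fin n) k) i j →
  lookup (lookup (atomic G x) i) j ≡ (does (lookup x i Fin.≟ lookup x j) , arc G (lookup x i) (lookup x j))
lookup-atomic G x i j = trans
  (cong (λ row → lookup row j) (Vec.lookup∘tabulate (λ i → tabulate (entry i)) i))
  (Vec.lookup∘tabulate (entry i) j)
  where
  entry = λ i j → does (lookup x i Fin.≟ lookup x j) , arc G (lookup x i) (lookup x j)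

module _ {k n n′} (G : Graph n) (H : Graph n′) (x : Vec (Fin n) k) (y : Vec (Fin n′) k)
  (eq : atomic G x ≡ atomic H y) where

  private
    entry : ∀ i j → (does (lookup x i Fin.≟ lookup x j) , arc G (lookup x i) (lookup x j)) ≡
      (does (lookup y i Fin.≟ lookup y j) , arc H (lookup y i) (lookup y j))
    entry i j = trans (sym (lookup-atomic G x i j))
      (trans (cong (λ M → lookup (lookup M i) j) eq) (lookup-atomic H y i j))

  atomic-≡ : ∀ i j → lookup y i ≡ lookup y j → lookup x i ≡ lookup x j
  atomic-≡ i j yᵢ≡yⱼ with lookup x i Fin.≟ lookup x j | cong proj₁ (entry i j)
  ... | yes xᵢ≡xⱼ | _ = xᵢ≡xⱼ
  ... | no _ | false≡ with trans false≡ (dec-true (lookup y i Fin.≟ lookup y j) yᵢ≡yⱼ)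
  ... | ()

  atomic-arc : ∀ i j → arc G (lookup x i) (lookup x j) ≡ arc H (lookup y i) (lookup y j)
  atomic-arc i j = cong proj₂ (entry i j)

↔-injective : ∀ {A B : Set} (f : A ↔ B) {x y} → Inverse.to f x ≡ Inverse.to f y → x ≡ y
↔-injective f eq = trans (sym (strictlyInverseʳ _)) (trans (cong from eq) (strictlyInverseʳ _))
  where open Inverse f

module _ {n} (G H : Graph n) where

  private
    everyVertex : Vec (Fin n) n
    everyVertex = tabulate id

    lookup-everyVertex : ∀ i → lookup everyVertex i ≡ i
    lookup-everyVertex = Vec.lookup∘tabulate id

  -- A tuple y with the atomic type of `everyVertex` has n distinct entries, so by finiteness it
  -- lists all vertices of H and is itself the isomorphism.
  copy⇒isomorphic : ∀ y → atomic G everyVertex ≡ atomic H y → Isomorphic G H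
  copy⇒isomorphic y eq = mk↔ₛ′ (lookup y) (proj₁ ∘ surjective) (proj₂ ∘ surjective)
      (λ i → injective (proj₂ (surjective (lookup y i)))) ,
    λ i j → subst₂ (λ a b → arc G a b ≡ arc H (lookup y i) (lookup y j)) (lookup-everyVertex i) (lookup-everyVertex j)
      (atomic-arc G H everyVertex y eq i j)
    where
    injective : ∀ {i j} → lookup y i ≡ lookup y j → i ≡ j
    injective {i} {j} yᵢ≡yⱼ = subst₂ _≡_ (lookup-everyVertex i) (lookup-everyVertex j) (atomic-≡ G H everyVertex y eq i j yᵢ≡yⱼ)
    surjective = injective⇒surjective (lookup y) injective

  isomorphic⇒copy : Isomorphic G H → ∃ λ y → atomic G everyVertex ≡ atomic H y
  isomorphic⇒copy (f , arcs) = tabulate to , Vec.tabulate-cong λ i → Vec.tabulate-cong λ j →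
    subst₂ (λ a b → (does (a Fin.≟ b) , arc G a b) ≡
                    (does (lookup (tabulate to) i Fin.≟ lookup (tabulate to) j) , arc H (lookup (tabulate to) i) (lookup (tabulate to) j)))
      (sym (lookup-everyVertex i)) (sym (lookup-everyVertex j))
      (subst₂ (λ a b → (does (i Fin.≟ j) , arc G i j) ≡ (does (a Fin.≟ b) , arc H a b))
        (sym (Vec.lookup∘tabulate to i)) (sym (Vec.lookup∘tabulate to j))
        (cong₂ _,_ (same-equality i j) (arcs i j)))
    where
    open Inverse f using (to)
    same-equality : ∀ i j → does (i Fin.≟ j) ≡ does (to i Fin.≟ to j)
    same-equality i j with i Fin.≟ j
    ... | yes i≡j = sym (dec-true (to i Fin.≟ to j) (cong to i≡j))
    ... | no i≢j = sym (dec-false (to i Fin.≟ to j) (i≢j ∘ ↔-injective f))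

  isomorphic? : Dec (Isomorphic G H)
  isomorphic? = map′
    (λ hit → let y , _ , eq = find hit in copy⇒isomorphic y eq)
    (λ iso → let y , eq = isomorphic⇒copy iso in lose (∈-tuples n y) eq)
    (Any.any? (λ y → tuple-dec n 0 (atomic G everyVertex) (atomic H y)) (Tuples.tuples n n n))

  -- For tuples as long as the graph the initial colours already suffice: H must have a tuple
  -- coloured like `everyVertex`.
  equivalent⇒isomorphic : Parallel.Equivalent (tupleRefinement n) G H → Isomorphic G H
  equivalent⇒isomorphic (r , _ , same) =
    let y , _ , eq = ∈-map⁻ (atomic H)
          (SetoidPermₚ.∈-resp-↭ (setoid _) (TupleRun.sameColours-≤ n G H {0} {r} z≤n same)
            (∈-map⁺ (atomic G) (∈-tuples n everyVertex)))
    in copy⇒isomorphic y eq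

TupleIdentifies : ℕ → ∀ {n} → Graph n → Set
TupleIdentifies m G = ∀ {n′} (H : Graph n′) → Parallel.Equivalent (tupleRefinement m) G H → Isomorphic G H

identifies-by-all : ∀ {n} .{{_ : NonZero n}} (G : Graph n) → TupleIdentifies n G
identifies-by-all {n} G H equiv with equivalent⇒same-order n G H equiv
... | refl = equivalent⇒isomorphic G H equiv

adjacency : ∀ {n} → Graph n → Subset (n * n)
adjacency {n} G = tabulate (uncurry (arc G) ∘ remQuot n)

fromAdjacency : ∀ {n} → Subset (n * n) → Graph n
fromAdjacency A = graph λ x y → lookup A (combine x y)

fromAdjacency-adjacency : ∀ {n} (G : Graph n) x y → arc G x y ≡ arc (fromAdjacency (adjacency G)) x y
fromAdjacency-adjacency {n} G x y = sym (trans (Vec.lookup∘tabulate (uncurry (arc G) ∘ remQuot n) (combine x y))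
  (cong (uncurry (arc G)) (Fin.remQuot-combine x y)))

-- Equivalence forces equal orders, and the graphs of order n are covered, up to pointwise equal
-- arcs, by the finitely many subsets of an n by n table.
identifies? : ∀ m .{{_ : NonZero m}} {n} (G : Graph n) → Dec (TupleIdentifies m G)
identifies? m {n} G with anySubset? (λ A → TupleRun.equivalent? m G (fromAdjacency A) ×-dec ¬? (isomorphic? G (fromAdjacency A)))
... | yes (A , equiv , ¬iso) = no λ identified → ¬iso (identified (fromAdjacency A) equiv)
... | no none = yes identified
  where
  identified : TupleIdentifies m G
  identified H equiv with equivalent⇒same-order m G H equiv
  ... | refl = decidable-stable (isomorphic? G H) λ ¬iso → none
    (adjacency H , equivalent-cong m G (fromAdjacency-adjacency H) equiv ,
     λ { (f , arcs) → ¬iso (f , λ x y → trans (arcs x y) (sym (fromAdjacency-adjacency H (Inverse.to f x) (Inverse.to f y)))) })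

least : ∀ {P : ℕ → Set} → (∀ j → Dec (P j)) → ∀ k → P k → ∃ λ j → P j × (∀ i → i < j → ¬ P i)
least P? zero p = zero , p , λ _ ()
least P? (suc k) p with P? zero
... | yes p₀ = zero , p₀ , λ _ ()
... | no ¬p₀ with least (P? ∘ suc) k p
... | j , pⱼ , below = suc j , pⱼ , λ { zero _ → ¬p₀ ; (suc i) i<j → below i (s≤s⁻¹ i<j) }

isWLDimension : ∀ {n} (G : Graph n) → ¬ Identifies 1 G → ∀ j → TupleIdentifies (2 + j) G →
  (∀ i → i < j → ¬ TupleIdentifies (2 + i) G) → IsWLDimension G (2 + j)
isWLDimension G fails₁ j identifies below = record { identifies = identifies ; minimal = minimal }
  where
  minimal : ∀ m → .{{_ : NonZero m}} → m < 2 + j → ¬ Identifies m G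
  minimal (suc zero) _ = fails₁
  minimal (suc (suc i)) (s≤s (s≤s i<j)) = below i i<j

-- The order of G is a tuple length that identifies G, and 1 ≤ b disposes of the naive refinement;
-- so the least identifying length is found by deciding the lengths from 2 up to the order.
wlDimension-above : ∀ {n} (G : Graph n) → 2 ≤ n → ∀ b → 1 ≤ b →
  (∀ m .{{_ : NonZero m}} → m ≤ b → ¬ Identifies m G) →
  ∃ λ d → IsWLDimension G d × b < d
wlDimension-above {suc (suc n)} G _ b 1≤b fails =
  let j , identifies , below = least {P = λ j → TupleIdentifies (2 + j) G} (λ j → identifies? (2 + j) G) n (identifies-by-all G)
  in 2 + j , isWLDimension G (fails 1 1≤b) j identifies below , ℕ.≰⇒> (λ d≤b → fails (2 + j) d≤b identifies)
wlDimension-above {suc zero} G (s≤s ())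

-- Back-and-forth systems

-- `answer` is the bijection announced before Spoiler picks α, and `response α` describes the
-- position afterwards. The two are tied only at α, so away from xs and α the map may change
-- completely with α.
record Answer {n} (Good : List (Fin n) → (Fin n → Fin n) → Set) (xs : List (Fin n)) (f : Fin n → Fin n) : Set where
  field
    answer : Fin n → Fin n
    answer-↭ : map answer (allFin n) Perm.↭ allFin n
    response : Fin n → Fin n → Fin n
    response-good : ∀ α → Good (α ∷ xs) (response α)
    response-agrees : ∀ α {x} → x ∈ xs → response α x ≡ f x
    response-answer : ∀ α → response α α ≡ answer α

-- Duplicator's winning positions in the bijective pebble game with `size` pebbles on either graph:
-- the pebbles of G lie on xs and those of H on the images under f.
record BackAndForth {n} (G H : Graph n) (size : ℕ) : Set₁ where
  field
    Good : List (Fin n) → (Fin n → Fin n) → Set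
    good-⊆ : ∀ {xs ys f} → (∀ {x} → x ∈ ys → x ∈ xs) → Good xs f → Good ys f
    good-injective : ∀ {xs f} → Good xs f → ∀ {x y} → f x ≡ f y → x ≡ y
    good-arc : ∀ {xs f x y} → Good xs f → x ∈ xs → y ∈ xs → arc G x y ≡ arc H (f x) (f y)
    respond : ∀ {xs f} → Good xs f → length xs ≤ size → Answer Good xs f
    start : List (Fin n) → Fin n → Fin n
    start-good : ∀ xs → length xs ≤ size → Good xs (start xs)
    start-involutive : ∀ xs → length xs ≤ size → ∀ x → start (map (start xs) xs) (start xs x) ≡ x

filterᵇ-map : ∀ {A B : Set} (p : B → Bool) (g : A → B) {p′ : A → Bool} → (∀ x → p′ x ≡ p (g x)) → ∀ xs →
  filterᵇ p (map g xs) ≡ map g (filterᵇ p′ xs)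
filterᵇ-map p g eq [] = refl
filterᵇ-map p g {p′} eq (x ∷ xs) with p′ x | p (g x) | eq x
... | true | true | refl = cong (g x ∷_) (filterᵇ-map p g eq xs)
... | false | false | refl = filterᵇ-map p g eq xs

matched-↭ : ∀ {n} (S : Setoid 0ℓ 0ℓ) {g : Fin n → Fin n} → map g (allFin n) Perm.↭ allFin n →
  ∀ (c c′ : Fin n → Setoid.Carrier S) → (∀ α → Setoid._≈_ S (c α) (c′ (g α))) →
  ∀ {p p′ : Fin n → Bool} → (∀ α → p α ≡ p′ (g α)) →
  SetoidPerm._↭_ S (map c (filterᵇ p (allFin n))) (map c′ (filterᵇ p′ (allFin n)))
matched-↭ {n} S {g} g-↭ c c′ c≈c′ {p} {p′} p≡p′ = ↭-trans (↭-from-pointwise S c (c′ ∘ g) c≈c′ (filterᵇ p (allFin n)))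
  (subst (_↭ map c′ (filterᵇ p′ (allFin n))) (sym (trans (map-∘ (filterᵇ p (allFin n))) (cong (map c′) (sym (filterᵇ-map p′ g p≡p′ (allFin n))))))
    (map-↭ S c′ (Permₚ.filter-↭ (T? ∘ p′) g-↭)))
  where open SetoidPerm S using (_↭_; ↭-trans)

toList-map : ∀ {m n} (f : Fin n → Fin n) (x : Vec (Fin n) m) → toList (Vec.map f x) ≡ map f (toList x)
toList-map f [] = refl
toList-map f (a ∷ x) = cong (f a ∷_) (toList-map f x)

map-fixing : ∀ {m n} {f g : Fin n → Fin n} (x : Vec (Fin n) m) → (∀ {a} → a ∈ toList x → g a ≡ f a) → Vec.map g x ≡ Vec.map f x
map-fixing [] _ = refl
map-fixing (a ∷ x) eq = cong₂ _∷_ (eq (here refl)) (map-fixing x (eq ∘ there))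

∈-update : ∀ {m n} {a : Fin n} (x : Vec (Fin n) m) i α → a ∈ toList (x [ i ]≔ α) → a ∈ α ∷ toList x
∈-update (b ∷ x) zero α (here refl) = here refl
∈-update (b ∷ x) zero α (there a∈) = there (there a∈)
∈-update (b ∷ x) (suc i) α (here refl) = there (here refl)
∈-update (b ∷ x) (suc i) α (there a∈) with ∈-update x i α a∈
... | here refl = here refl
... | there a∈x = there (there a∈x)

module Play {n} {G H : Graph n} {size : ℕ} (backAndForth : BackAndForth G H size) where
  open BackAndForth backAndForth

  -- One pebble is enough: the two points x and α of the reply show the arcs between them in both
  -- directions, and the pebble on x is then lifted.
  naive-good : 1 ≤ size → ∀ r {x f} → Good (x ∷ []) f →
    Setoid._≈_ (Naive.Colour r) (Naive.colour G r x) (Naive.colour H r (f x))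
  naive-good 1≤size zero good = good-arc good (here refl) (here refl)
  naive-good 1≤size (suc r) {x} {f} good = naive-good 1≤size r good ,
    matched-↭ (Naive.Colour r) answer-↭ (Naive.colour G r) (Naive.colour H r) same-colour (λ α → subst₂ (λ z w → arc G x α ≡ arc H z w)
      (response-agrees α (here refl)) (response-answer α) (good-arc (response-good α) (there (here refl)) (here refl))) ,
    matched-↭ (Naive.Colour r) answer-↭ (Naive.colour G r) (Naive.colour H r) same-colour (λ α → subst₂ (λ z w → arc G α x ≡ arc H w z)
      (response-agrees α (here refl)) (response-answer α) (good-arc (response-good α) (here refl) (there (here refl))))
    where
    open Answer (respond good 1≤size)
    same-colour : ∀ α → Setoid._≈_ (Naive.Colour r) (Naive.colour G r α) (Naive.colour H r (answer α))
    same-colour α = subst (λ z → Setoid._≈_ (Naive.Colour r) (Naive.colour G r α) (Naive.colour H r z)) (response-answer α)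
      (naive-good 1≤size r (good-⊆ (λ { (here refl) → here refl }) (response-good α)))

  naive-equivalent : 1 ≤ size → Parallel.Equivalent naive G H
  naive-equivalent 1≤size = NaiveRun.equivalent G H same
    where
    begin-at : Fin n → Fin n
    begin-at x = start (x ∷ []) x
    begin-↭ : map begin-at (allFin n) Perm.↭ allFin n
    begin-↭ = map-bijection-↭ (Unique.allFin⁺ n) ∈-allFin begin-at begin-at
      (λ x → start-involutive (x ∷ []) 1≤size x) (λ x → start-involutive (x ∷ []) 1≤size x)
    same : ∀ r → Parallel.SameColours naive G H r
    same r = ↭-trans (↭-from-pointwise S (colour G) (colour H ∘ begin-at) (λ x → naive-good 1≤size r (start-good (x ∷ []) 1≤size)) (allFin n))
      (subst (_↭ map (colour H) (allFin n)) (sym (map-∘ (allFin n))) (map-↭ S (colour H) begin-↭))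
      where
      S = Naive.Colour r
      colour = λ K → Naive.colour K r
      open SetoidPerm S using (_↭_; ↭-trans)

  module TupleGame (m : ℕ) (m≤size : m ≤ size) where
    open Tuples m

    length-toList : ∀ (x : Vec (Fin n) m) → length (toList x) ≡ m
    length-toList = Vec.length-toList

    short : ∀ (x : Vec (Fin n) m) → length (toList x) ≤ size
    short x = ℕ.≤-trans (ℕ.≤-reflexive (length-toList x)) m≤size

    tuple-good : ∀ r {x f} → Good (toList x) f →
      Setoid._≈_ (Colour r) (colour G r x) (colour H r (Vec.map f x))
    tuple-good zero {x} {f} good = Vec.tabulate-cong λ i → Vec.tabulate-cong λ j →
      subst₂ (λ a b → (does (lookup x i Fin.≟ lookup x j) , arc G (lookup x i) (lookup x j)) ≡ (does (a Fin.≟ b) , arc H a b))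
        (sym (Vec.lookup-map i f x)) (sym (Vec.lookup-map j f x))
        (cong₂ _,_ (does-cong (lookup x i Fin.≟ lookup x j) (f (lookup x i) Fin.≟ f (lookup x j)) (cong f) (good-injective good))
          (good-arc good (∈-toList⁺ (∈-lookup i x)) (∈-toList⁺ (∈-lookup j x))))
    tuple-good (suc r) {x} {f} good = tuple-good r good ,
      ↭-trans (↭-from-pointwise S (neighbours G x) (neighbours H (Vec.map f x) ∘ answer)
          (λ α → VecPointwise.tabulate⁺ (same-colour α)) (allFin n))
        (subst (_↭ map (neighbours H (Vec.map f x)) (allFin n)) (sym (map-∘ (allFin n))) (map-↭ S (neighbours H (Vec.map f x)) answer-↭))
      where
      S = ≋-setoid (Colour r) m
      open SetoidPerm S using (_↭_; ↭-trans)
      open Answer (respond good (short x))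
      neighbours : Graph n → Vec (Fin n) m → Fin n → Vec (Setoid.Carrier (Colour r)) m
      neighbours K y α = tabulate λ i → colour K r (y [ i ]≔ α)
      same-colour : ∀ α i → Setoid._≈_ (Colour r) (colour G r (x [ i ]≔ α)) (colour H r (Vec.map f x [ i ]≔ answer α))
      same-colour α i = subst (λ y → Setoid._≈_ (Colour r) (colour G r (x [ i ]≔ α)) (colour H r y))
        (trans (Vec.map-[]≔ (response α) x i) (cong₂ (_[ i ]≔_) (map-fixing x (response-agrees α)) (response-answer α)))
        -- The reply covers m + 1 points, of which entry i is overwritten; one and the same reply
        -- serves all i.
        (tuple-good r (good-⊆ (∈-update x i α) (response-good α)))

    tuple-equivalent : Parallel.Equivalent (tupleRefinement m) G H
    tuple-equivalent = TupleRun.equivalent m G H same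
      where
      -- The opening map varies with the tuple, so no permutation of the vertices induces
      -- `begin-at`; that it permutes the tuples rests on `start-involutive`.
      begin-at : Vec (Fin n) m → Vec (Fin n) m
      begin-at x = Vec.map (start (toList x)) x
      begin-involutive : ∀ x → begin-at (begin-at x) ≡ x
      begin-involutive x = begin
        Vec.map (start (toList (begin-at x))) (begin-at x) ≡⟨ cong (λ ys → Vec.map (start ys) (begin-at x)) (toList-map (start (toList x)) x) ⟩
        Vec.map (start (map (start (toList x)) (toList x))) (begin-at x) ≡⟨ Vec.map-∘ _ _ x ⟨
        Vec.map (start (map (start (toList x)) (toList x)) ∘ start (toList x)) x ≡⟨ Vec.map-cong (start-involutive (toList x) (short x)) x ⟩
        Vec.map id x ≡⟨ Vec.map-id x ⟩
        x ∎
        where open ≡-Reasoning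
      same : ∀ r → Parallel.SameColours (tupleRefinement m) G H r
      same r = ↭-trans (↭-from-pointwise (Colour r) (colour G r) (colour H r ∘ begin-at)
          (λ x → tuple-good r (start-good (toList x) (short x))) (tuples m n))
        (subst (_↭ map (colour H r) (tuples m n)) (sym (map-∘ (tuples m n)))
          (map-↭ (Colour r) (colour H r)
            (map-bijection-↭ (tuples-unique m m n) (∈-tuples m) begin-at begin-at begin-involutive begin-involutive)))
        where open SetoidPerm (Colour r) using (_↭_; ↭-trans)

  wl-equivalent : ∀ m .{{_ : NonZero m}} → m ≤ size → WLEquivalent m G H
  wl-equivalent (suc zero) m≤size = naive-equivalent m≤size
  wl-equivalent (suc (suc m)) m≤size = TupleGame.tuple-equivalent (suc (suc m)) m≤size

-- Digit strings

odd : ℕ → Bool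
odd zero = false
odd (suc k) = not (odd k)

module _ {w : ℕ} where

  -- For an odd base p = 2 + w, the parity of b − a as a residue in [1, p), complemented.
  orient : Fin (2 + w) → Fin (2 + w) → Bool
  orient a b = (odd (toℕ a) xor odd (toℕ b)) xor (toℕ a <ᵇ toℕ b)

  next : Fin (2 + w) → Fin (2 + w)
  next a = suc (toℕ a) mod (2 + w)

  reflect : Fin (2 + w) → Fin (2 + w) → Fin (2 + w)
  reflect c a = (2 * toℕ c + (2 + w ∸ toℕ a)) mod (2 + w)

-- The facts on digits are stated in decidable form and checked exhaustively for four bases. Oddness
-- enters in `reflect-orient`: a reflection turns the difference d into p - d, which has the
-- opposite parity because p is odd.
record OddBase (w : ℕ) : Set where
  constructor oddBase
  field
    next-injective : ∀ (a b : Fin (2 + w)) → next a ≡ next b → a ≡ b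
    next-orient : ∀ (a b : Fin (2 + w)) → a ≢ b → orient (next a) (next b) ≡ orient a b
    reflect-fixed : ∀ (c : Fin (2 + w)) → reflect c c ≡ c
    reflect-involutive : ∀ (c a : Fin (2 + w)) → reflect c (reflect c a) ≡ a
    reflect-orient : ∀ (c a b : Fin (2 + w)) → a ≢ b → orient (reflect c a) (reflect c b) ≡ not (orient a b)

oddBase? : ∀ w → Dec (OddBase w)
oddBase? w = map′ (λ (i , o , f , v , r) → oddBase i o f v r)
  (λ b → let open OddBase b in next-injective , next-orient , reflect-fixed , reflect-involutive , reflect-orient)
  (  (Fin.all? λ a → Fin.all? λ b → (next a Fin.≟ next b) →-dec (a Fin.≟ b))
  ×-dec (Fin.all? λ a → Fin.all? λ b → ¬? (a Fin.≟ b) →-dec (orient {w} (next a) (next b) Bool.≟ orient a b))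
  ×-dec (Fin.all? λ c → reflect c c Fin.≟ c)
  ×-dec (Fin.all? λ c → Fin.all? λ a → reflect c (reflect c a) Fin.≟ a)
  ×-dec (Fin.all? λ c → Fin.all? λ a → Fin.all? λ b →
          ¬? (a Fin.≟ b) →-dec (orient {w} (reflect c a) (reflect c b) Bool.≟ not (orient a b))))

module Chain {w : ℕ} (oddBase : OddBase w) where
  open OddBase oddBase

  Digit : Set
  Digit = Fin (2 + w)

  Digits : ℕ → Set
  Digits = Vec Digit

  level : ∀ {l} → Digits l → Digits l → Fin (suc l)
  level [] [] = zero
  level (a ∷ as) (b ∷ bs) with a Fin.≟ b
  ... | yes _ = suc (level as bs)
  ... | no _ = zero

  sense : ∀ {l} → Digits l → Digits l → Bool
  sense [] [] = false
  sense (a ∷ as) (b ∷ bs) with a Fin.≟ b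
  ... | yes _ = sense as bs
  ... | no _ = orient a b

  level-refl : ∀ {l} (x : Digits l) → level x x ≡ fromℕ l
  level-refl [] = refl
  level-refl (a ∷ x) with a Fin.≟ a
  ... | yes _ = cong suc (level-refl x)
  ... | no a≢a = contradiction refl a≢a

  sense-refl : ∀ {l} (x : Digits l) → sense x x ≡ false
  sense-refl [] = refl
  sense-refl (a ∷ x) with a Fin.≟ a
  ... | yes _ = sense-refl x
  ... | no a≢a = contradiction refl a≢a

  level-top⇒≡ : ∀ {l} (x y : Digits l) → level x y ≡ fromℕ l → x ≡ y
  level-top⇒≡ [] [] _ = refl
  level-top⇒≡ (a ∷ x) (b ∷ y) eq with a Fin.≟ b
  ... | yes refl = cong (a ∷_) (level-top⇒≡ x y (Fin.suc-injective eq))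

  level-sym : ∀ {l} (x y : Digits l) → level x y ≡ level y x
  level-sym [] [] = refl
  level-sym (a ∷ x) (b ∷ y) with a Fin.≟ b | b Fin.≟ a
  ... | yes _ | yes _ = cong suc (level-sym x y)
  ... | yes a≡b | no b≢a = contradiction (sym a≡b) b≢a
  ... | no a≢b | yes b≡a = contradiction (sym b≡a) a≢b
  ... | no _ | no _ = refl

  -- The ultrametric law, a high level meaning nearness: z still agrees with x where x and y part,
  -- so z parts from y at that very place.
  level-isosceles : ∀ {l} (x y z : Digits l) → level x y Fin.< level x z → level z y ≡ level x y
  level-isosceles [] [] [] _ = refl
  level-isosceles (a ∷ x) (b ∷ y) (c ∷ z) xy<xz with a Fin.≟ b | a Fin.≟ c | c Fin.≟ b
  ... | yes _ | yes _ | yes _ = cong suc (level-isosceles x y z (s≤s⁻¹ xy<xz))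
  ... | yes refl | yes refl | no b≢b = contradiction refl b≢b
  ... | no a≢b | yes refl | yes refl = contradiction refl a≢b
  ... | no _ | yes _ | no _ = refl

  tailsWith : ∀ {l} → Digit → List (Digits (suc l)) → List (Digits l)
  tailsWith t [] = []
  tailsWith t ((u ∷ x) ∷ xs) with u Fin.≟ t
  ... | yes _ = x ∷ tailsWith t xs
  ... | no _ = tailsWith t xs

  ∈-tailsWith⁺ : ∀ {l t} {x : Digits l} xs → t ∷ x ∈ xs → x ∈ tailsWith t xs
  ∈-tailsWith⁺ {t = t} ((u ∷ y) ∷ xs) t∷x∈ with u Fin.≟ t
  ∈-tailsWith⁺ ((u ∷ y) ∷ xs) (here refl) | yes _ = here refl
  ∈-tailsWith⁺ ((u ∷ y) ∷ xs) (there t∷x∈) | yes _ = there (∈-tailsWith⁺ xs t∷x∈)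
  ∈-tailsWith⁺ ((u ∷ y) ∷ xs) (here refl) | no u≢u = contradiction refl u≢u
  ∈-tailsWith⁺ ((u ∷ y) ∷ xs) (there t∷x∈) | no _ = ∈-tailsWith⁺ xs t∷x∈

  ∈-tailsWith⁻ : ∀ {l t} {x : Digits l} xs → x ∈ tailsWith t xs → t ∷ x ∈ xs
  ∈-tailsWith⁻ {t = t} ((u ∷ y) ∷ xs) x∈ with u Fin.≟ t
  ∈-tailsWith⁻ ((u ∷ y) ∷ xs) (here refl) | yes refl = here refl
  ∈-tailsWith⁻ ((u ∷ y) ∷ xs) (there x∈) | yes _ = there (∈-tailsWith⁻ xs x∈)
  ∈-tailsWith⁻ ((u ∷ y) ∷ xs) x∈ | no _ = there (∈-tailsWith⁻ xs x∈)

  centre : ∀ {l} → List (Digits (suc l)) → Digit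
  -- With no point left in play nothing has to stay fixed, and any digit may serve as centre.
  centre [] = zero
  centre ((t ∷ _) ∷ _) = t

  -- At a marked level the list is dropped off the centre, whatever it contains: a digit and its
  -- reflection must be given the same list, or `twist` would not be an involution for arbitrary
  -- lists.
  branch : ∀ {l} → Bool → Digit → List (Digits (suc l)) → List (Digits l)
  branch false t xs = tailsWith t xs
  branch true t xs with t Fin.≟ centre xs
  ... | yes _ = tailsWith t xs
  ... | no _ = []

  flip : Bool → Digit → Digit → Digit
  flip false c t = t
  flip true c t = reflect c t

  -- Reverses the sense on the levels marked by τ.  At a marked level all of xs that is still
  -- in play is meant to share its digit, and that digit is the centre of the reflection.
  twist : ∀ {l} → (Fin (suc l) → Bool) → List (Digits l) → Digits l → Digits l
  twist τ xs [] = []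
  twist τ xs (t ∷ a) = flip (τ zero) (centre xs) t ∷ twist (τ ∘ suc) (branch (τ zero) t xs) a

  flip-involutive : ∀ s c t → flip s c (flip s c t) ≡ t
  flip-involutive false c t = refl
  flip-involutive true c t = reflect-involutive c t

  branch-flip : ∀ {l} s t (xs : List (Digits (suc l))) → branch s (flip s (centre xs) t) xs ≡ branch s t xs
  branch-flip false t xs = refl
  branch-flip true t xs with t Fin.≟ centre xs | reflect (centre xs) t Fin.≟ centre xs
  ... | yes refl | yes _ = cong (λ u → tailsWith u xs) (reflect-fixed t)
  ... | yes refl | no r≢ = contradiction (reflect-fixed t) r≢
  ... | no t≢ | yes r≡ = contradiction (trans (sym (reflect-involutive (centre xs) t)) (trans (cong (reflect (centre xs)) r≡) (reflect-fixed (centre xs)))) t≢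
  ... | no _ | no _ = refl

  twist-involutive : ∀ {l} τ xs (a : Digits l) → twist τ xs (twist τ xs a) ≡ a
  twist-involutive τ xs [] = refl
  twist-involutive τ xs (t ∷ a) = cong₂ _∷_ (flip-involutive (τ zero) (centre xs) t)
    (trans (cong (λ ys → twist (τ ∘ suc) ys (twist (τ ∘ suc) (branch (τ zero) t xs) a)) (branch-flip (τ zero) t xs))
      (twist-involutive (τ ∘ suc) (branch (τ zero) t xs) a))

  flip-injective : ∀ s c {t u} → flip s c t ≡ flip s c u → t ≡ u
  flip-injective s c {t} {u} eq = trans (sym (flip-involutive s c t)) (trans (cong (flip s c) eq) (flip-involutive s c u))

  -- As long as two strings agree they meet the same lists and centres, so the same injective maps
  -- act on their digits up to and including the first difference.
  level-twist : ∀ {l} τ xs (a b : Digits l) → level (twist τ xs a) (twist τ xs b) ≡ level a b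
  level-twist τ xs [] [] = refl
  level-twist τ xs (t ∷ a) (u ∷ b) with t Fin.≟ u | flip (τ zero) (centre xs) t Fin.≟ flip (τ zero) (centre xs) u
  ... | yes refl | yes _ = cong suc (level-twist (τ ∘ suc) (branch (τ zero) t xs) a b)
  ... | yes refl | no ≢ = contradiction refl ≢
  ... | no t≢u | yes ≡ = contradiction (flip-injective (τ zero) (centre xs) ≡) t≢u
  ... | no _ | no _ = refl

  flip-orient : ∀ s c t u → t ≢ u → orient (flip s c t) (flip s c u) ≡ orient t u xor s
  flip-orient false c t u _ = sym (Bool.xor-identityʳ _)
  flip-orient true c t u t≢u = trans (reflect-orient c t u t≢u) (sym (xor-true (orient t u)))
    where
    xor-true : ∀ b → b xor true ≡ not b
    xor-true false = refl
    xor-true true = refl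

  -- Equal strings keep the sense `false`, whatever the marking; hence the top level has to be
  -- unmarked.
  sense-twist : ∀ {l} τ xs (a b : Digits l) → τ (fromℕ l) ≡ false →
    sense (twist τ xs a) (twist τ xs b) ≡ sense a b xor τ (level a b)
  sense-twist τ xs [] [] τ-top = sym τ-top
  sense-twist τ xs (t ∷ a) (u ∷ b) τ-top with t Fin.≟ u | flip (τ zero) (centre xs) t Fin.≟ flip (τ zero) (centre xs) u
  ... | yes refl | yes _ = sense-twist (τ ∘ suc) (branch (τ zero) t xs) a b τ-top
  ... | yes refl | no ≢ = contradiction refl ≢
  ... | no t≢u | yes ≡ = contradiction (flip-injective (τ zero) (centre xs) ≡) t≢u
  ... | no t≢u | no _ = flip-orient (τ zero) (centre xs) t u t≢u

  centre-∈ : ∀ {l t} {a : Digits l} {xs} → t ∷ a ∈ xs → ∃ λ b → centre xs ∷ b ∈ xs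
  centre-∈ {xs = (u ∷ b) ∷ xs} _ = b , here refl

  level-∷ : ∀ {l} t (a b : Digits l) → level (t ∷ a) (t ∷ b) ≡ suc (level a b)
  level-∷ t a b with t Fin.≟ t
  ... | yes _ = refl
  ... | no t≢t = contradiction refl t≢t

  level-head : ∀ {l t u} (a b : Digits l) → t ≢ u → level (t ∷ a) (u ∷ b) ≡ zero
  level-head {t = t} {u} a b t≢u with t Fin.≟ u
  ... | yes t≡u = contradiction t≡u t≢u
  ... | no _ = refl

  -- If the digit of a listed string differed from the centre at a marked level, that level would be
  -- met between two listed strings, against the assumption. So the digit is the centre, which the
  -- reflection fixes.
  twist-fixes : ∀ {l} τ xs (a : Digits l) → (∀ {x y} → x ∈ xs → y ∈ xs → τ (level x y) ≡ false) →
    a ∈ xs → twist τ xs a ≡ a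
  twist-fixes τ xs [] _ _ = refl
  twist-fixes {suc l} τ xs (t ∷ a) untouched a∈xs with τ zero in τ₀
  ... | false = cong (t ∷_) (twist-fixes (τ ∘ suc) (tailsWith t xs) a
          (λ x∈ y∈ → trans (cong τ (sym (level-∷ t _ _))) (untouched (∈-tailsWith⁻ xs x∈) (∈-tailsWith⁻ xs y∈)))
          (∈-tailsWith⁺ xs a∈xs))
  ... | true with t Fin.≟ centre xs
  ... | yes t≡c = cong₂ _∷_ (trans (cong (λ c → reflect c t) (sym t≡c)) (reflect-fixed t)) (twist-fixes (τ ∘ suc) (tailsWith t xs) a
          (λ x∈ y∈ → trans (cong τ (sym (level-∷ t _ _))) (untouched (∈-tailsWith⁻ xs x∈) (∈-tailsWith⁻ xs y∈)))
          (∈-tailsWith⁺ xs a∈xs))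
  ... | no t≢c with centre-∈ a∈xs
  ... | b , c∈xs = contradiction (trans (sym τ₀) (trans (cong τ (sym (level-head a b t≢c))) (untouched a∈xs c∈xs))) λ ()

  dig : ∀ l → ℕ → Digits l
  dig zero a = []
  dig (suc l) a = a mod (2 + w) ∷ dig l (a / (2 + w))

  value : ∀ {l} → Digits l → ℕ
  value [] = 0
  value (t ∷ a) = toℕ t + value a * (2 + w)

  module _ (t : Digit) (a : ℕ) where
    [t+ap]/p : (toℕ t + a * (2 + w)) / (2 + w) ≡ a
    [t+ap]/p = trans (+-distrib-/-∣ʳ (toℕ t) (divides-refl a))
      (cong₂ _+_ (m<n⇒m/n≡0 (Fin.toℕ<n t)) (m*n/n≡m a (2 + w)))

    [t+ap]-mod : (toℕ t + a * (2 + w)) mod (2 + w) ≡ t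
    [t+ap]-mod = Fin.toℕ-injective (trans (Fin.toℕ-fromℕ< _)
      (trans ([m+kn]%n≡m%n (toℕ t) a (2 + w)) (m<n⇒m%n≡m (Fin.toℕ<n t))))

  dig-value : ∀ {l} (a : Digits l) → dig l (value a) ≡ a
  dig-value [] = refl
  dig-value (t ∷ a) = cong₂ _∷_ ([t+ap]-mod t (value a)) (trans (cong (dig _) ([t+ap]/p t (value a))) (dig-value a))

  mod-shift : ∀ a b → (a + b * (2 + w)) mod (2 + w) ≡ a mod (2 + w)
  mod-shift a b = Fin.toℕ-injective (trans (Fin.toℕ-fromℕ< _)
    (trans ([m+kn]%n≡m%n a b (2 + w)) (sym (Fin.toℕ-fromℕ< _))))

  split-last : ∀ a → a ≡ toℕ (a mod (2 + w)) + a / (2 + w) * (2 + w)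
  split-last a = trans (m≡m%n+[m/n]*n a (2 + w)) (cong (_+ a / (2 + w) * (2 + w)) (sym (Fin.toℕ-fromℕ< (m%n<n a (2 + w)))))

  value-dig : ∀ l a → ∃ λ k → a ≡ value (dig l a) + k * (2 + w) ^ l
  value-dig zero a = a , sym (ℕ.*-identityʳ a)
  value-dig (suc l) a with value-dig l (a / (2 + w))
  ... | k , eq = k , (begin
    a ≡⟨ split-last a ⟩
    d + a / p * p ≡⟨ cong (λ b → d + b * p) eq ⟩
    d + (value (dig l (a / p)) + k * p ^ l) * p ≡⟨ rearrange d (value (dig l (a / p))) k (p ^ l) p ⟩
    d + value (dig l (a / p)) * p + k * (p * p ^ l) ∎)
    where
    open ≡-Reasoning
    p = 2 + w
    d = toℕ (a mod p)
    rearrange : ∀ d v k q p → d + (v + k * q) * p ≡ d + v * p + k * (p * q)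
    rearrange = solve-∀

  dig-period : ∀ l a k → dig l (a + k * (2 + w) ^ l) ≡ dig l a
  dig-period zero a k = refl
  dig-period (suc l) a k = cong₂ _∷_ (trans (cong (_mod p) regroup) (mod-shift a (k * p ^ l)))
    (trans (cong (dig l) (begin
      (a + k * (p * p ^ l)) / p ≡⟨ cong (_/ p) regroup ⟩
      (a + k * p ^ l * p) / p ≡⟨ +-distrib-/-∣ʳ a (divides-refl (k * p ^ l)) ⟩
      a / p + k * p ^ l * p / p ≡⟨ cong (a / p +_) (m*n/n≡m (k * p ^ l) p) ⟩
      a / p + k * p ^ l ∎)) (dig-period l (a / p) k))
    where
    open ≡-Reasoning
    p = 2 + w
    regroup : a + k * (p * p ^ l) ≡ a + k * p ^ l * p
    regroup = cong (a +_) (trans (cong (k *_) (ℕ.*-comm p (p ^ l))) (sym (ℕ.*-assoc k (p ^ l) p)))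

  suc-mod : ∀ a → suc a mod (2 + w) ≡ next (a mod (2 + w))
  suc-mod a = trans (cong (λ b → suc b mod (2 + w)) (split-last a)) (mod-shift (suc (toℕ (a mod (2 + w)))) (a / (2 + w)))

  suc-/ : ∀ a → suc a / (2 + w) ≡ suc (toℕ (a mod (2 + w))) / (2 + w) + a / (2 + w)
  suc-/ a = trans (cong (λ b → suc b / (2 + w)) (split-last a))
    (trans (+-distrib-/-∣ʳ (suc (toℕ (a mod (2 + w)))) (divides-refl (a / (2 + w))))
      (cong (suc (toℕ (a mod (2 + w))) / (2 + w) +_) (m*n/n≡m (a / (2 + w)) (2 + w))))

  carry : ∀ (t : Digit) → suc (toℕ t) / (2 + w) < 2
  carry t = m<n*o⇒m/o<n {suc (toℕ t)} {2} {2 + w} (ℕ.≤-<-trans (Fin.toℕ<n t) (ℕ.m<m+n (2 + w) (s≤s z≤n)))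

  SameComparison : ∀ {l} (x y x′ y′ : Digits l) → Set
  SameComparison x y x′ y′ = level x y ≡ level x′ y′ × sense x y ≡ sense x′ y′

  comparison-next : ∀ {l} t u (x y x′ y′ : Digits l) → (t ≡ u → SameComparison x y x′ y′) →
    SameComparison (next t ∷ x) (next u ∷ y) (t ∷ x′) (u ∷ y′)
  comparison-next t u x y x′ y′ rest with t Fin.≟ u | next t Fin.≟ next u
  ... | yes t≡u | yes _ = cong suc (proj₁ (rest t≡u)) , proj₂ (rest t≡u)
  ... | yes refl | no ≢ = contradiction refl ≢
  ... | no t≢u | yes ≡ = contradiction (next-injective t u ≡) t≢u
  ... | no t≢u | no _ = refl , next-orient t u t≢u

  -- While the digits agree, both strings pass on the same carry. At the first difference both
  -- digits therefore stay or both advance cyclically, which `orient` does not notice; what they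
  -- carry further is irrelevant.
  comparison-carry : ∀ l c → c < 2 → ∀ a b → SameComparison (dig l (c + a)) (dig l (c + b)) (dig l a) (dig l b)
  comparison-carry l zero _ a b = refl , refl
  comparison-carry zero (suc zero) _ a b = refl , refl
  comparison-carry (suc l) (suc zero) _ a b
    rewrite suc-mod a | suc-mod b | suc-/ a | suc-/ b =
    comparison-next (a mod (2 + w)) (b mod (2 + w)) _ _ _ _ λ eq →
      subst (λ t → SameComparison (dig l (suc (toℕ (a mod (2 + w))) / (2 + w) + a / (2 + w))) (dig l (suc (toℕ t) / (2 + w) + b / (2 + w)))
          (dig l (a / (2 + w))) (dig l (b / (2 + w)))) eq
        (comparison-carry l _ (carry (a mod (2 + w))) (a / (2 + w)) (b / (2 + w)))
  comparison-carry l (suc (suc _)) (s≤s (s≤s ())) a b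

  comparison-shift : ∀ l c a b → SameComparison (dig l (c + a)) (dig l (c + b)) (dig l a) (dig l b)
  comparison-shift l zero a b = refl , refl
  comparison-shift l (suc c) a b =
    let level₁ , sense₁ = comparison-carry l 1 (s≤s (s≤s z≤n)) (c + a) (c + b)
        level₂ , sense₂ = comparison-shift l c a b
    in trans level₁ level₂ , trans sense₁ sense₂

  -- At the top level there is no digit left to hold the 1, and the string is zero.
  unit : ∀ {l} → Fin (suc l) → Digits l
  unit {zero} _ = []
  unit {suc l} zero = suc zero ∷ replicate l zero
  unit {suc l} (suc v) = zero ∷ unit v

  zeros : ∀ l → Digits l
  zeros l = replicate l zero

  level-unit : ∀ {l} (v : Fin (suc l)) → level (zeros l) (unit v) ≡ v
  level-unit {zero} zero = refl
  level-unit {suc l} zero = refl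
  level-unit {suc l} (suc v) = cong suc (level-unit v)

  sense-unit : ∀ {l} (v : Fin (suc l)) → sense (zeros l) (unit v) ≡ false
  sense-unit {zero} zero = refl
  -- The digits 0 and 1 differ by an odd number, and `orient` records the complement.
  sense-unit {suc l} zero = refl
  sense-unit {suc l} (suc v) = sense-unit v

-- Congruences and the cyclic group

-- Multiples on both sides replace the difference a - b, so that no case distinction on the order of
-- a and b is built in.
Congruent : ℕ → ℕ → ℕ → Set
Congruent u a b = ∃₂ λ x y → a + x * u ≡ b + y * u

congruent-sym : ∀ {u a b} → Congruent u a b → Congruent u b a
congruent-sym (x , y , eq) = y , x , sym eq

congruent-trans : ∀ {u a b c} → Congruent u a b → Congruent u b c → Congruent u a c
congruent-trans {u} {a} {b} {c} (x , y , eq) (x′ , y′ , eq′) = x + x′ , y + y′ , (begin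
  a + (x + x′) * u ≡⟨ left a x x′ u ⟩
  (a + x * u) + x′ * u ≡⟨ cong (_+ x′ * u) eq ⟩
  (b + y * u) + x′ * u ≡⟨ right b y (x′ * u) u ⟩
  (b + x′ * u) + y * u ≡⟨ cong (_+ y * u) eq′ ⟩
  (c + y′ * u) + y * u ≡⟨ last c y y′ u ⟩
  c + (y + y′) * u ∎)
  where
  open ≡-Reasoning
  left : ∀ a x x′ u → a + (x + x′) * u ≡ (a + x * u) + x′ * u
  left = solve-∀
  right : ∀ b y z u → (b + y * u) + z ≡ (b + z) + y * u
  right = solve-∀
  last : ∀ c y y′ u → (c + y′ * u) + y * u ≡ c + (y + y′) * u
  last = solve-∀

congruent-*ˡ : ∀ {u v a b} → Congruent (u * v) a b → Congruent u a b
congruent-*ˡ {u} {v} {a} {b} (x , y , eq) = x * v , y * v , trans (regroup a x u v) (trans eq (sym (regroup b y u v)))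
  where
  regroup : ∀ a x u v → a + x * v * u ≡ a + x * (u * v)
  regroup = solve-∀

congruent-*ʳ : ∀ {u v a b} → Congruent (u * v) a b → Congruent v a b
congruent-*ʳ {u} {v} {a} {b} (x , y , eq) = x * u , y * u , trans (regroup a x u v) (trans eq (sym (regroup b y u v)))
  where
  regroup : ∀ a x u v → a + x * u * v ≡ a + x * (u * v)
  regroup = solve-∀

congruent-% : ∀ {u a b} .{{_ : NonZero u}} → Congruent u a b → a % u ≡ b % u
congruent-% {u} {a} {b} (x , y , eq) = trans (sym ([m+kn]%n≡m%n a x u)) (trans (cong (_% u) eq) ([m+kn]%n≡m%n b y u))

congruent-%ˡ : ∀ u a .{{_ : NonZero u}} → Congruent u (a % u) a
congruent-%ˡ u a = a / u , 0 , trans (sym (m≡m%n+[m/n]*n a u)) (sym (ℕ.+-identityʳ a))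

congruent⇒∣ : ∀ {u} a d → Congruent u a (a + d) → u ∣ d
congruent⇒∣ {u} a d (x , y , eq) = ∣m+n∣m⇒∣n (divides x (ℕ.+-cancelˡ-≡ a _ _ (trans (regroup a d y u) (sym eq)))) (n∣m*n y)
  where
  regroup : ∀ a d y u → a + (y * u + d) ≡ (a + d) + y * u
  regroup = solve-∀

coprime-* : ∀ {u v w} → Coprime u v → Coprime u w → Coprime u (v * w)
coprime-* {u} {v} {w} u⊥v u⊥w {d} (d∣u , d∣vw) = u⊥w (d∣u , coprime-divisor d⊥v d∣vw)
  where
  d⊥v : Coprime d v
  d⊥v (e∣d , e∣v) = u⊥v (∣-trans e∣d d∣u , e∣v)

coprime-1ʳ : ∀ {u} → Coprime u 1
coprime-1ʳ (_ , d∣1) = ∣1⇒≡1 d∣1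

coprime-^ʳ : ∀ {u v} k → Coprime u v → Coprime u (v ^ k)
coprime-^ʳ zero _ = coprime-1ʳ
coprime-^ʳ (suc k) u⊥v = coprime-* u⊥v (coprime-^ʳ k u⊥v)

coprime-^ : ∀ {u v} j k → Coprime u v → Coprime (u ^ j) (v ^ k)
coprime-^ j k u⊥v = Coprimality.sym (coprime-^ʳ j (Coprimality.sym (coprime-^ʳ k u⊥v)))

coprime-suc-multiple : ∀ {p} m → p ∣ m → Coprime p (suc m)
coprime-suc-multiple m p∣m {d} (d∣p , d∣1+m) = ∣1⇒≡1 (∣m+n∣m⇒∣n (subst (d ∣_) (ℕ.+-comm 1 m) d∣1+m) (∣-trans d∣p p∣m))

congruent-both : ∀ {u v a b} → Coprime u v → Congruent u a b → Congruent v a b → Congruent (u * v) a b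
congruent-both {u} {v} {a} {b} u⊥v eqᵤ eqᵥ = case ℕ.≤-total a b of λ
  { (inj₁ a≤b) → ascending a≤b eqᵤ eqᵥ
  ; (inj₂ b≤a) → congruent-sym (ascending b≤a (congruent-sym eqᵤ) (congruent-sym eqᵥ)) }
  where
  regroup : ∀ a e u v → a + e * (u * v) ≡ a + e * v * u + 0 * (u * v)
  regroup = solve-∀
  ascending : ∀ {a b} → a ≤ b → Congruent u a b → Congruent v a b → Congruent (u * v) a b
  ascending {a} {b} a≤b eqᵤ eqᵥ with ℕ.m≤n⇒∃[o]m+o≡n a≤b
  ... | d , refl with congruent⇒∣ a d eqᵤ | congruent⇒∣ a d eqᵥ
  ... | divides k refl | v∣ku with coprime-divisor (Coprimality.sym u⊥v) (subst (v ∣_) (ℕ.*-comm k u) v∣ku)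
  ... | divides e refl = e , 0 , regroup a e u v

-- The witness is r + x u (s - r), since x u is 0 modulo u and 1 modulo v. As the second modulus is
-- matched as `suc v`, the difference s - r is written s + r * v.
bézout-solution : ∀ u v .{{_ : NonZero v}} x y → 1 + y * v ≡ x * u → ∀ r s → ∃ λ a → Congruent u a r × Congruent v a s
bézout-solution u (suc v) x y eq r s = r + x * u * (s + r * v) ,
  (0 , x * (s + r * v) , ofʳ r (s + r * v) u x) ,
  (0 , r + y * (s + r * v) , trans (cong (λ e → r + e * (s + r * v) + 0 * suc v) (sym eq)) (ofˢ r s y v))
  where
  ofʳ : ∀ r z u x → r + x * u * z + 0 * u ≡ r + x * z * u
  ofʳ = solve-∀
  ofˢ : ∀ r s y v → r + (1 + y * (1 + v)) * (s + r * v) + 0 * (1 + v) ≡ s + (r + y * (s + r * v)) * (1 + v)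
  ofˢ = solve-∀

chinese-remainder₂ : ∀ u v .{{_ : NonZero u}} .{{_ : NonZero v}} → Coprime u v → ∀ r s →
  ∃ λ a → Congruent u a r × Congruent v a s
chinese-remainder₂ u v u⊥v r s with coprime-Bézout u⊥v
... | Bézout.+- x y eq = bézout-solution u v x y eq r s
... | Bézout.-+ x y eq = let a , a≡s , a≡r = bézout-solution v u y x eq s r in a , a≡r , a≡s

product : ∀ {j} → (Fin j → ℕ) → ℕ
product {zero} N = 1
product {suc j} N = N zero * product (N ∘ suc)

PairwiseCoprime : ∀ {j} → (Fin j → ℕ) → Set
PairwiseCoprime N = ∀ {i k} → i ≢ k → Coprime (N i) (N k)

product-nonZero : ∀ {j} {N : Fin j → ℕ} → (∀ i → NonZero (N i)) → NonZero (product N)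
product-nonZero {zero} nz = _
product-nonZero {suc j} {N} nz = ℕ.m*n≢0 (N zero) _ {{nz zero}} {{product-nonZero (nz ∘ suc)}}

coprime-product : ∀ {j u} {N : Fin j → ℕ} → (∀ i → Coprime u (N i)) → Coprime u (product N)
coprime-product {zero} _ = coprime-1ʳ
coprime-product {suc j} u⊥ = coprime-* (u⊥ zero) (coprime-product (u⊥ ∘ suc))

congruent-product : ∀ {j a b} {N : Fin j → ℕ} → PairwiseCoprime N → (∀ i → Congruent (N i) a b) → Congruent (product N) a b
congruent-product {zero} {a} {b} _ _ = b , a , trans (cong (a +_) (ℕ.*-identityʳ b)) (trans (ℕ.+-comm a b) (cong (_+_ b) (sym (ℕ.*-identityʳ a))))
congruent-product {suc j} coprime eqs = congruent-both (coprime-product (λ i → coprime {zero} {suc i} λ ()))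
  (eqs zero) (congruent-product (λ i≢k → coprime (i≢k ∘ Fin.suc-injective)) (eqs ∘ suc))

congruent-factor : ∀ {j a b} {N : Fin j → ℕ} → Congruent (product N) a b → ∀ i → Congruent (N i) a b
congruent-factor {suc j} eq zero = congruent-*ˡ eq
congruent-factor {suc j} {N = N} eq (suc i) = congruent-factor (congruent-*ʳ {N zero} eq) i

chinese-remainder : ∀ {j} {N : Fin j → ℕ} → (∀ i → NonZero (N i)) → PairwiseCoprime N → ∀ (r : Fin j → ℕ) →
  ∃ λ a → ∀ i → Congruent (N i) a (r i)
chinese-remainder {zero} _ _ _ = 0 , λ ()
chinese-remainder {suc j} {N} nz coprime r =
  let b , b≡ = chinese-remainder (nz ∘ suc) (λ i≢k → coprime (i≢k ∘ Fin.suc-injective)) (r ∘ suc)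
      a , a≡r , a≡b = chinese-remainder₂ (N zero) (product (N ∘ suc)) {{nz zero}} {{product-nonZero (nz ∘ suc)}}
        (coprime-product (λ i → coprime {zero} {suc i} λ ())) (r zero) b
  in a , λ { zero → a≡r ; (suc i) → congruent-trans (congruent-factor a≡b i) (b≡ i) }

module Residues (n : ℕ) .{{_ : NonZero n}} where

  toℕ-mod : ∀ a → toℕ (a mod n) ≡ a % n
  toℕ-mod a = Fin.toℕ-fromℕ< (m%n<n a n)

  infixl 7 _∙_
  infix 8 _⁻¹

  _∙_ : Fin n → Fin n → Fin n
  x ∙ y = (toℕ x + toℕ y) mod n

  0# : Fin n
  0# = 0 mod n

  _⁻¹ : Fin n → Fin n
  x ⁻¹ = (n ∸ toℕ x) mod n

  %-absorbˡ : ∀ a b → (a % n + b) % n ≡ (a + b) % n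
  %-absorbˡ a b = trans (%-distribˡ-+ (a % n) b n)
    (trans (cong (λ c → (c + b % n) % n) (m%n%n≡m%n a n)) (sym (%-distribˡ-+ a b n)))

  mod-absorbˡ : ∀ a y → (a mod n) ∙ y ≡ (a + toℕ y) mod n
  mod-absorbˡ a y = Fin.toℕ-injective (begin
    toℕ ((toℕ (a mod n) + toℕ y) mod n) ≡⟨ toℕ-mod _ ⟩
    (toℕ (a mod n) + toℕ y) % n ≡⟨ cong (λ c → (c + toℕ y) % n) (toℕ-mod a) ⟩
    (a % n + toℕ y) % n ≡⟨ %-absorbˡ a (toℕ y) ⟩
    (a + toℕ y) % n ≡⟨ toℕ-mod _ ⟨
    toℕ ((a + toℕ y) mod n) ∎)
    where open ≡-Reasoning

  ∙-comm : ∀ x y → x ∙ y ≡ y ∙ x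
  ∙-comm x y = cong (_mod n) (ℕ.+-comm (toℕ x) (toℕ y))

  mod-absorbʳ : ∀ x b → x ∙ (b mod n) ≡ (toℕ x + b) mod n
  mod-absorbʳ x b = trans (∙-comm x (b mod n)) (trans (mod-absorbˡ b x) (cong (_mod n) (ℕ.+-comm b (toℕ x))))

  toℕ-id : ∀ x → toℕ x mod n ≡ x
  toℕ-id x = Fin.toℕ-injective (trans (toℕ-mod (toℕ x)) (m<n⇒m%n≡m (Fin.toℕ<n x)))

  n-mod : n mod n ≡ 0#
  n-mod = Fin.toℕ-injective (trans (toℕ-mod n) (trans (n%n≡0 n) (sym (trans (toℕ-mod 0) (n%n≡0′)))))
    where
    n%n≡0′ : 0 % n ≡ 0
    n%n≡0′ = trans (sym ([m+kn]%n≡m%n 0 1 n)) (trans (cong (_% n) (ℕ.*-identityˡ n)) (n%n≡0 n))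

  isGroup : IsGroup _≡_ _∙_ 0# _⁻¹
  isGroup = record
    { isMonoid = record
      { isSemigroup = record
        { isMagma = record { isEquivalence = isEquivalence ; ∙-cong = cong₂ _∙_ }
        ; assoc = λ x y z → trans (mod-absorbˡ _ z)
            (trans (cong (_mod n) (ℕ.+-assoc (toℕ x) (toℕ y) (toℕ z))) (sym (mod-absorbʳ x _)))
        }
      ; identity = identityˡ , λ x → trans (∙-comm x 0#) (identityˡ x)
      }
    ; inverse = inverseˡ , λ x → trans (∙-comm x (x ⁻¹)) (inverseˡ x)
    ; ⁻¹-cong = cong _⁻¹
    }
    where
    identityˡ : ∀ x → 0# ∙ x ≡ x
    identityˡ x = trans (mod-absorbˡ 0 x) (toℕ-id x)
    inverseˡ : ∀ x → x ⁻¹ ∙ x ≡ 0#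
    inverseˡ x = trans (mod-absorbˡ (n ∸ toℕ x) x)
      (trans (cong (_mod n) (ℕ.m∸n+n≡m (ℕ.<⇒≤ (Fin.toℕ<n x)))) n-mod)

  cyclicGroup : FiniteGroup n
  cyclicGroup = record { _∙_ = _∙_ ; ε = 0# ; _⁻¹ = _⁻¹ ; isGroup = isGroup }

  open RawMonoidDefs (Group.rawMonoid (FiniteGroup.group cyclicGroup)) using () renaming (_×_ to _times_)

  times-generator : ∀ k → k times (1 mod n) ≡ k mod n
  times-generator zero = refl
  times-generator (suc k) = trans (cong ((1 mod n) ∙_) (times-generator k))
    (trans (mod-absorbˡ 1 (k mod n)) (Fin.toℕ-injective (begin
      toℕ ((1 + toℕ (k mod n)) mod n) ≡⟨ toℕ-mod _ ⟩
      (1 + toℕ (k mod n)) % n ≡⟨ cong (λ c → (1 + c) % n) (toℕ-mod k) ⟩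
      (1 + k % n) % n ≡⟨ cong (_% n) (ℕ.+-comm 1 (k % n)) ⟩
      (k % n + 1) % n ≡⟨ %-absorbˡ k 1 ⟩
      (k + 1) % n ≡⟨ cong (_% n) (ℕ.+-comm k 1) ⟩
      suc k % n ≡⟨ toℕ-mod (suc k) ⟨
      toℕ (suc k mod n) ∎)))
    where open ≡-Reasoning

  isCyclic : IsCyclic (FiniteGroup.group cyclicGroup)
  isCyclic = 1 mod n , λ x → ℤ.+ toℕ x , sym (trans (times-generator (toℕ x)) (toℕ-id x))

  congruent-⁻¹ : ∀ x y → Congruent n (toℕ (y ∙ x ⁻¹) + toℕ x) (toℕ y)
  congruent-⁻¹ x y with congruent-%ˡ n (toℕ y + (n ∸ toℕ x))
  ... | a , b , eq = a , suc b , (begin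
    toℕ (y ∙ x ⁻¹) + toℕ x + a * n ≡⟨ cong (λ c → c + toℕ x + a * n) (trans (cong toℕ (mod-absorbʳ y (n ∸ toℕ x))) (toℕ-mod (toℕ y + (n ∸ toℕ x)))) ⟩
    (toℕ y + (n ∸ toℕ x)) % n + toℕ x + a * n ≡⟨ swap _ (toℕ x) (a * n) ⟩
    (toℕ y + (n ∸ toℕ x)) % n + a * n + toℕ x ≡⟨ cong (_+ toℕ x) eq ⟩
    toℕ y + (n ∸ toℕ x) + b * n + toℕ x ≡⟨ regroup (toℕ y) (n ∸ toℕ x) (b * n) (toℕ x) ⟩
    toℕ y + ((n ∸ toℕ x) + toℕ x + b * n) ≡⟨ cong (λ c → toℕ y + (c + b * n)) (ℕ.m∸n+n≡m (ℕ.<⇒≤ (Fin.toℕ<n x))) ⟩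
    toℕ y + (n + b * n) ∎)
    where
    open ≡-Reasoning
    swap : ∀ a b c → a + b + c ≡ a + c + b
    swap = solve-∀
    regroup : ∀ y m b x → y + m + b + x ≡ y + (m + x + b)
    regroup = solve-∀

congruent-+ʳ : ∀ {u a b} c → Congruent u a b → Congruent u (a + c) (b + c)
congruent-+ʳ {u} {a} {b} c (x , y , eq) = x , y , trans (swap a c (x * u)) (trans (cong (_+ c) eq) (sym (swap b c (y * u))))
  where
  swap : ∀ a c e → a + c + e ≡ a + e + c
  swap = solve-∀

congruent-cancelʳ : ∀ {u a b} c → Congruent u (a + c) (b + c) → Congruent u a b
congruent-cancelʳ {u} {a} {b} c (x , y , eq) = x , y ,
  ℕ.+-cancelʳ-≡ c _ _ (trans (swap a c (x * u)) (trans eq (sym (swap b c (y * u)))))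
  where
  swap : ∀ a c e → a + e + c ≡ a + c + e
  swap = solve-∀

congruent-< : ∀ {u a b} → a < u → b < u → Congruent u a b → a ≡ b
congruent-< {suc u} a<u b<u eq = trans (sym (m<n⇒m%n≡m a<u)) (trans (congruent-% eq) (m<n⇒m%n≡m b<u))

module Gap (q : ℕ) .{{_ : NonZero q}} where
  open Residues q
  open GroupProperties (FiniteGroup.group cyclicGroup) using (∙-cancelʳ)
  open Group (FiniteGroup.group cyclicGroup) using (assoc; identityʳ; inverseˡ; inverseʳ)

  gap : Fin q → Fin q → ℕ
  gap s t = toℕ (t ∙ s ⁻¹)

  gap<q : ∀ s t → gap s t < q
  gap<q s t = Fin.toℕ<n (t ∙ s ⁻¹)

  gap-congruent : ∀ s t → Congruent q (gap s t + toℕ s) (toℕ t)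
  gap-congruent s t = congruent-⁻¹ s t

  gap-injective : ∀ s {t t′} → gap s t ≡ gap s t′ → t ≡ t′
  gap-injective s eq = ∙-cancelʳ (s ⁻¹) _ _ (Fin.toℕ-injective eq)

  advance : Fin q → Fin q → Fin q
  advance s g = g ∙ s

  gap-advance : ∀ s g → gap s (advance s g) ≡ toℕ g
  gap-advance s g = cong toℕ (trans (assoc g s (s ⁻¹)) (trans (cong (g ∙_) (inverseʳ s)) (identityʳ g)))

  -- The sum is a multiple of q that is positive and less than 2 q.
  gap-opposite : ∀ s t → 1 ≤ gap s t → gap s t + gap t s ≡ q
  gap-opposite s t 1≤ = multiple (congruent⇒∣ 0 _ (congruent-sym (congruent-cancelʳ (toℕ s)
    (subst (λ a → Congruent q a (toℕ s)) (regroup (gap s t) (gap t s) (toℕ s))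
      (congruent-trans (congruent-+ʳ (gap t s) (gap-congruent s t))
        (subst (λ a → Congruent q a (toℕ s)) (ℕ.+-comm (gap t s) (toℕ t)) (gap-congruent t s)))))))
    where
    regroup : ∀ a b s → a + s + b ≡ a + b + s
    regroup = solve-∀
    multiple : q ∣ gap s t + gap t s → gap s t + gap t s ≡ q
    multiple (divides zero eq) = contradiction (ℕ.≤-trans 1≤ (ℕ.m≤m+n _ _)) (ℕ.<⇒≱ (subst (_< 1) (sym eq) (s≤s z≤n)))
    multiple (divides (suc zero) eq) = trans eq (ℕ.+-identityʳ q)
    multiple (divides (suc (suc k)) eq) = contradiction (ℕ.+-mono-< (gap<q s t) (gap<q t s))
      (ℕ.≤⇒≯ (subst (q + q ≤_) (sym eq) (ℕ.+-monoʳ-≤ q (ℕ.m≤m+n q (k * q)))))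

-- The bases 3, 5, 7 and 11 less 2: odd, so that reflections reverse senses, and pairwise coprime,
-- so that the product of the chains is cyclic.
baseOffset : Fin 4 → ℕ
baseOffset zero = 1
baseOffset (suc zero) = 3
baseOffset (suc (suc zero)) = 5
baseOffset (suc (suc (suc zero))) = 9

oddBases : ∀ c → OddBase (baseOffset c)
oddBases zero = from-yes (oddBase? 1)
oddBases (suc zero) = from-yes (oddBase? 3)
oddBases (suc (suc zero)) = from-yes (oddBase? 5)
oddBases (suc (suc (suc zero))) = from-yes (oddBase? 9)

module ChainAt (c : Fin 4) = Chain (oddBases c)

-- All that the graphs and the game use of the cyclic group. The two `translate` fields say that
-- comparisons depend on y ∙ x ⁻¹ alone, which turns any graph defined by them into a Cayley graph.
record Coordinates (l q n : ℕ) .{{_ : NonZero q}} : Set where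
  open Gap q
  field
    digits : ∀ c → Fin n → ChainAt.Digits c l
    residue : Fin n → Fin q
    build : (∀ c → ChainAt.Digits c l) → Fin q → Fin n
    digits-build : ∀ ds s c → digits c (build ds s) ≡ ds c
    residue-build : ∀ ds s → residue (build ds s) ≡ s
    unique : ∀ {x y} → (∀ c → digits c x ≡ digits c y) → residue x ≡ residue y → x ≡ y
    cyclic : FiniteGroup n
    isCyclic : IsCyclic (FiniteGroup.group cyclic)
  open FiniteGroup cyclic public using (ε; _∙_; _⁻¹)
  field
    comparison-translate : ∀ c x y →
      ChainAt.SameComparison c (digits c ε) (digits c (y ∙ x ⁻¹)) (digits c x) (digits c y)
    gap-translate : ∀ x y → gap (residue ε) (residue (y ∙ x ⁻¹)) ≡ gap (residue x) (residue y)

module CyclicCoordinates (l M : ℕ) where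

  -- Since 1155 = 3 · 5 · 7 · 11, this is coprime to every base, and M is free to make it large.
  q : ℕ
  q = suc (1155 * M)

  moduli : Fin 5 → ℕ
  moduli zero = q
  moduli (suc c) = (2 + baseOffset c) ^ l

  order : ℕ
  order = product moduli

  private
    bases-coprime : ∀ c c′ → c ≢ c′ → Coprime (2 + baseOffset c) (2 + baseOffset c′)
    bases-coprime = from-yes (Fin.all? λ c → Fin.all? λ c′ →
      ¬? (c Fin.≟ c′) →-dec coprime? (2 + baseOffset c) (2 + baseOffset c′))

    base∣1155 : ∀ c → 2 + baseOffset c ∣ 1155
    base∣1155 = from-yes (Fin.all? λ c → (2 + baseOffset c) ∣? 1155)

    base⊥q : ∀ c → Coprime ((2 + baseOffset c) ^ l) q
    base⊥q c = Coprimality.sym (coprime-^ʳ l (Coprimality.sym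
      (coprime-suc-multiple (1155 * M) (∣-trans (base∣1155 c) (m∣m*n M)))))

    moduli-coprime : PairwiseCoprime moduli
    moduli-coprime {zero} {zero} 0≢0 = contradiction refl 0≢0
    moduli-coprime {zero} {suc c} _ = Coprimality.sym (base⊥q c)
    moduli-coprime {suc c} {zero} _ = base⊥q c
    moduli-coprime {suc c} {suc c′} c≢c′ = coprime-^ l l (bases-coprime c c′ (c≢c′ ∘ cong suc))

  moduli-nonZero : ∀ i → NonZero (moduli i)
  moduli-nonZero zero = _
  moduli-nonZero (suc c) = ℕ.m^n≢0 (2 + baseOffset c) l

  instance
    order-nonZero : NonZero order
    order-nonZero = product-nonZero moduli-nonZero

  open Gap q
  module Mod-q = Residues q
  module Mod-n = Residues order

  dig-congruent : ∀ c {a b} → Congruent ((2 + baseOffset c) ^ l) a b → ChainAt.dig c l a ≡ ChainAt.dig c l b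
  dig-congruent c {a} {b} (x , y , eq) = trans (sym (ChainAt.dig-period c l a x))
    (trans (cong (ChainAt.dig c l) eq) (ChainAt.dig-period c l b y))

  congruent-dig : ∀ c {a b} → ChainAt.dig c l a ≡ ChainAt.dig c l b → Congruent ((2 + baseOffset c) ^ l) a b
  congruent-dig c {a} {b} eq = congruent-trans (reduce a) (congruent-trans
    (subst (λ d → Congruent _ (ChainAt.value c (ChainAt.dig c l a)) (ChainAt.value c d)) eq (0 , 0 , refl)) (congruent-sym (reduce b)))
    where
    reduce : ∀ a → Congruent ((2 + baseOffset c) ^ l) a (ChainAt.value c (ChainAt.dig c l a))
    reduce a = let k , a≡ = ChainAt.value-dig c l a in 0 , k , trans (ℕ.+-identityʳ a) a≡

  mod-congruent : ∀ a → Congruent q (toℕ (a mod q)) a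
  mod-congruent a = subst (λ b → Congruent q b a) (sym (Mod-q.toℕ-mod a)) (congruent-%ˡ q a)

  private
    module _ (ds : ∀ c → ChainAt.Digits c l) (s : Fin q) where
      target : Fin 5 → ℕ
      target zero = toℕ s
      target (suc c) = ChainAt.value c (ds c)

      solution = chinese-remainder moduli-nonZero moduli-coprime target

      built : Fin order
      built = proj₁ solution mod order

      built-congruent : ∀ i → Congruent (moduli i) (toℕ built) (target i)
      built-congruent i = congruent-trans
        (congruent-factor {N = moduli} (subst (λ b → Congruent order b (proj₁ solution)) (sym (Mod-n.toℕ-mod (proj₁ solution))) (congruent-%ˡ order (proj₁ solution))) i)
        (proj₂ solution i)

    digitsAt : ∀ c → Fin order → ChainAt.Digits c l
    digitsAt c x = ChainAt.dig c l (toℕ x)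

    residueOf : Fin order → Fin q
    residueOf x = toℕ x mod q

    unique′ : ∀ {x y} → (∀ c → digitsAt c x ≡ digitsAt c y) → residueOf x ≡ residueOf y → x ≡ y
    unique′ {x} {y} ds s = Fin.toℕ-injective (congruent-< (Fin.toℕ<n x) (Fin.toℕ<n y) (congruent-product moduli-coprime congruences))
      where
      congruences : ∀ i → Congruent (moduli i) (toℕ x) (toℕ y)
      congruences zero = congruent-trans (congruent-sym (mod-congruent (toℕ x)))
        (subst (λ t → Congruent q (toℕ t) (toℕ y)) (sym s) (mod-congruent (toℕ y)))
      congruences (suc c) = congruent-dig c (ds c)

    translate-congruent : ∀ x y i → Congruent (moduli i) (toℕ (y Mod-n.∙ x Mod-n.⁻¹) + toℕ x) (toℕ y)
    translate-congruent x y = congruent-factor {N = moduli} (Mod-n.congruent-⁻¹ x y)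

    toℕ-0# : toℕ Mod-n.0# ≡ 0
    toℕ-0# = trans (Mod-n.toℕ-mod 0) (m<n⇒m%n≡m (>-nonZero⁻¹ order))

    -- With z the difference of y and x, the pair (x , y) is the pair (0 , z) shifted by x; wrapping
    -- around at `order` does not show in l digits, as the modulus of each chain divides it.
    comparison-translate′ : ∀ c x y →
      ChainAt.SameComparison c (digitsAt c Mod-n.0#) (digitsAt c (y Mod-n.∙ x Mod-n.⁻¹)) (digitsAt c x) (digitsAt c y)
    comparison-translate′ c x y =
      subst (λ a → ChainAt.SameComparison c (ChainAt.dig c l a) (digitsAt c z) (digitsAt c x) (digitsAt c y)) (sym toℕ-0#)
        (subst₂ (ChainAt.SameComparison c (ChainAt.dig c l 0) (digitsAt c z))
          (cong (ChainAt.dig c l) (ℕ.+-identityʳ (toℕ x)))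
          (dig-congruent c (subst (λ a → Congruent (moduli (suc c)) a (toℕ y)) (ℕ.+-comm (toℕ z) (toℕ x)) (translate-congruent x y (suc c))))
          (let levels , senses = ChainAt.comparison-shift c l (toℕ x) 0 (toℕ z) in sym levels , sym senses))
      where
      z = y Mod-n.∙ x Mod-n.⁻¹

    gap-translate′ : ∀ x y → gap (residueOf Mod-n.0#) (residueOf (y Mod-n.∙ x Mod-n.⁻¹)) ≡ gap (residueOf x) (residueOf y)
    gap-translate′ x y = congruent-< (gap<q (residueOf Mod-n.0#) (residueOf z)) (gap<q (residueOf x) (residueOf y)) (congruent-cancelʳ (toℕ x) (congruent-trans
        (congruent-+ʳ (toℕ x) (congruent-trans from-0 (mod-congruent (toℕ z))))
        (congruent-trans (translate-congruent x y zero) (congruent-sym to-y))))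
      where
      z = y Mod-n.∙ x Mod-n.⁻¹
      from-0 : Congruent q (gap (residueOf Mod-n.0#) (residueOf z)) (toℕ (residueOf z))
      from-0 = subst (λ a → Congruent q a (toℕ (residueOf z)))
        (trans (cong (_+_ (gap (residueOf Mod-n.0#) (residueOf z))) (cong (λ a → toℕ (a mod q)) toℕ-0#)) (ℕ.+-identityʳ _))
        (gap-congruent (residueOf Mod-n.0#) (residueOf z))
      to-y : Congruent q (gap (residueOf x) (residueOf y) + toℕ x) (toℕ y)
      to-y = congruent-trans
        (subst₂ (Congruent q) (ℕ.+-comm (toℕ x) g) (ℕ.+-comm (toℕ (residueOf x)) g) (congruent-+ʳ g (congruent-sym (mod-congruent (toℕ x)))))
        (congruent-trans (gap-congruent (residueOf x) (residueOf y)) (mod-congruent (toℕ y)))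
        where g = gap (residueOf x) (residueOf y)

  coordinates : Coordinates l q order
  coordinates = record
    { digits = digitsAt
    ; residue = residueOf
    ; build = built
    ; digits-build = λ ds s c → trans (dig-congruent c (built-congruent ds s (suc c))) (ChainAt.dig-value c (ds c))
    ; residue-build = λ ds s → Fin.toℕ-injective (congruent-< (Fin.toℕ<n (residueOf (built ds s))) (Fin.toℕ<n s)
        (congruent-trans (mod-congruent _) (built-congruent ds s zero)))
    ; unique = unique′
    ; cyclic = Mod-n.cyclicGroup
    ; isCyclic = Mod-n.isCyclic
    ; comparison-translate = comparison-translate′
    ; gap-translate = gap-translate′
    }

-- The grid

xorSum : ℕ → (ℕ → Bool) → Bool
xorSum zero f = false
xorSum (suc m) f = f 0 xor xorSum m (f ∘ suc)

xorSum-cong : ∀ m {f g} → (∀ i → i < m → f i ≡ g i) → xorSum m f ≡ xorSum m g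
xorSum-cong zero eq = refl
xorSum-cong (suc m) eq = cong₂ _xor_ (eq 0 (s≤s z≤n)) (xorSum-cong m (λ i i<m → eq (suc i) (s≤s i<m)))

xorSum-false : ∀ m → xorSum m (λ _ → false) ≡ false
xorSum-false zero = refl
xorSum-false (suc m) = xorSum-false m

xor-interchange : ∀ a b c d → (a xor b) xor (c xor d) ≡ (a xor c) xor (b xor d)
xor-interchange = solve 4 (λ a b c d → (a :+ b) :+ (c :+ d) := (a :+ c) :+ (b :+ d)) refl
  where open xor-∧-Solver

xor-cancel : ∀ a b c → (a xor b) xor (b xor c) ≡ a xor c
xor-cancel a false c = cong (_xor c) (Bool.xor-identityʳ a)
xor-cancel false true c = Bool.not-involutive c
xor-cancel true true c = refl

xor-interchange₄ : ∀ a a′ b b′ c c′ d d′ → ((a xor a′) xor (b xor b′)) xor ((c xor c′) xor (d xor d′)) ≡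
  ((a xor b) xor (c xor d)) xor ((a′ xor b′) xor (c′ xor d′))
xor-interchange₄ = solve 8 (λ a a′ b b′ c c′ d d′ → ((a :+ a′) :+ (b :+ b′)) :+ ((c :+ c′) :+ (d :+ d′)) :=
  ((a :+ b) :+ (c :+ d)) :+ ((a′ :+ b′) :+ (c′ :+ d′))) refl
  where open xor-∧-Solver

xorSum-xor : ∀ m f g → xorSum m (λ i → f i xor g i) ≡ xorSum m f xor xorSum m g
xorSum-xor zero f g = refl
xorSum-xor (suc m) f g = trans (cong ((f 0 xor g 0) xor_) (xorSum-xor m (f ∘ suc) (g ∘ suc)))
  (xor-interchange (f 0) (g 0) _ _)

xorSum-swap : ∀ m k (f : ℕ → ℕ → Bool) → xorSum m (λ i → xorSum k (f i)) ≡ xorSum k (λ j → xorSum m (λ i → f i j))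
xorSum-swap zero k f = sym (xorSum-false k)
xorSum-swap (suc m) k f = trans (cong (xorSum k (f 0) xor_) (xorSum-swap m k (f ∘ suc)))
  (sym (xorSum-xor k (f 0) (λ j → xorSum m (λ i → f (suc i) j))))

xorSum-telescope : ∀ m (f : ℕ → Bool) → xorSum m (λ i → f i xor f (suc i)) ≡ f 0 xor f m
xorSum-telescope zero f = sym (Bool.xor-same (f 0))
xorSum-telescope (suc m) f = trans (cong ((f 0 xor f 1) xor_) (xorSum-telescope m (f ∘ suc))) (xor-cancel (f 0) (f 1) (f (suc m)))

at : ℕ → ℕ → ℕ → ℕ → Bool
at i j a b = (a ≡ᵇ i) ∧ (b ≡ᵇ j)

-- An edge of row a of the grid lies between columns t ∸ 1 and t, where 0 < t < k; it is the level
-- a k + t.  The two ends of a row are edges that are missing: they get the top level k k, at which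
-- equal digit strings are compared.
module Grid (k′ : ℕ) where

  k l : ℕ
  k = 2 + k′
  l = k * k

  Level : Set
  Level = Fin (suc l)

  top : Level
  top = fromℕ l

  -- The minimum only makes the function total; on the edges of the grid it does not act, by
  -- `toℕ-edge`.
  numbered : ℕ → Level
  numbered m = fromℕ< (s≤s (ℕ.m⊓n≤n m l))

  edge : ℕ → ℕ → Level
  edge a zero = top
  edge a (suc t) = if does (suc t <? k) then numbered (suc t + a * k) else top

  -- The left, right, upper and lower edge at node (a , b), one for each coordinate. Vertical edges
  -- are those of the transposed grid, with the column as first argument. A horizontal edge is read
  -- in `1F` at its left end and in `0F` at its right end; likewise `3F` and `2F` for a vertical
  -- one.
  scope : ℕ → ℕ → Fin 4 → Level
  scope a b zero = edge a b
  scope a b (suc zero) = edge a (suc b)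
  scope a b (suc (suc zero)) = edge b a
  scope a b (suc (suc (suc zero))) = edge b (suc a)

  row column : Level → ℕ
  row v = toℕ v / k
  column v = toℕ v % k

  edge-end : ∀ a → edge a k ≡ top
  edge-end a rewrite dec-false (k <? k) (ℕ.<-irrefl refl) = refl

  toℕ-edge : ∀ {a t} → a < k → suc t < k → toℕ (edge a (suc t)) ≡ suc t + a * k
  toℕ-edge {a} {t} a<k t<k rewrite dec-true (suc t <? k) t<k =
    trans (Fin.toℕ-fromℕ< (s≤s (ℕ.m⊓n≤n (suc t + a * k) l))) (ℕ.m≤n⇒m⊓n≡m (ℕ.<⇒≤ (ℕ.<-≤-trans (ℕ.+-monoˡ-< (a * k) t<k) (ℕ.*-monoˡ-≤ k a<k))))

  row-edge : ∀ {a t} → a < k → suc t < k → row (edge a (suc t)) ≡ a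
  row-edge {a} {t} a<k t<k = trans (cong (_/ k) (toℕ-edge a<k t<k))
    (trans (+-distrib-/-∣ʳ (suc t) (divides-refl a)) (cong₂ _+_ (m<n⇒m/n≡0 t<k) (m*n/n≡m a k)))

  column-edge : ∀ {a t} → a < k → suc t < k → column (edge a (suc t)) ≡ suc t
  column-edge {a} {t} a<k t<k = trans (cong (_% k) (toℕ-edge a<k t<k))
    (trans ([m+kn]%n≡m%n (suc t) a k) (m<n⇒m%n≡m t<k))

  row-top : row top ≡ k
  row-top = trans (cong (_/ k) (Fin.toℕ-fromℕ l)) (m*n/n≡m k k)

  row≡⇒≢top : ∀ {a v} → a < k → row v ≡ a → v ≢ top
  row≡⇒≢top a<k row≡ refl = ℕ.<-irrefl (trans (sym row≡) row-top) a<k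

  -- As k is at least 2, a node lacks at most one of its two horizontal edges.
  node-in-row : ∀ {a b} → a < k → b < k → row (edge a b) ≡ a ⊎ row (edge a (suc b)) ≡ a
  node-in-row {a} {b} a<k b<k with ℕ.m≤n⇒m<n∨m≡n b<k
  ... | inj₁ 1+b<k = inj₂ (row-edge a<k 1+b<k)
  ... | inj₂ refl = inj₁ (row-edge a<k b<k)

  edge-corner : ∀ {a b} → a < k → b < k → edge a (suc b) ≡ edge 0 1 → a ≡ 0 × b ≡ 0
  edge-corner {a} {b} a<k b<k eq with ℕ.m≤n⇒m<n∨m≡n b<k
  ... | inj₁ 1+b<k = trans (sym (row-edge a<k 1+b<k)) (trans (cong row eq) (row-edge {0} {0} (s≤s z≤n) (s≤s (s≤s z≤n)))) ,
        ℕ.suc-injective (trans (sym (column-edge a<k 1+b<k)) (trans (cong column eq) (column-edge {0} {0} (s≤s z≤n) (s≤s (s≤s z≤n)))))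
  ... | inj₂ refl = contradiction (trans (sym eq) (edge-end a)) (row≡⇒≢top (s≤s z≤n) (row-edge {0} {0} (s≤s z≤n) (s≤s (s≤s z≤n))))

  -- Summed over all nodes, the left sides telescope along each row and each column to the missing
  -- edges at its ends, which contribute `false`; the right sides sum to `true`.
  no-odd-flow : ∀ (h v : Level → Bool) → h top ≡ false → v top ≡ false →
    ¬ (∀ a b → a < k → b < k →
      (h (edge a b) xor h (edge a (suc b))) xor (v (edge b a) xor v (edge b (suc a))) ≡ at 0 0 a b)
  no-odd-flow h v h-top v-top flow = contradiction (trans (sym all-false) all-true) λ ()
    where
    closed : ∀ g → g top ≡ false → ∀ a → xorSum k (λ b → g (edge a b) xor g (edge a (suc b))) ≡ false
    closed g g-top a = trans (xorSum-telescope k (g ∘ edge a))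
      (cong₂ _xor_ g-top (trans (cong g (edge-end a)) g-top))
    total : Bool
    total = xorSum k λ a → xorSum k λ b → (h (edge a b) xor h (edge a (suc b))) xor (v (edge b a) xor v (edge b (suc a)))
    horizontal vertical : ℕ → ℕ → Bool
    horizontal a b = h (edge a b) xor h (edge a (suc b))
    vertical a b = v (edge b a) xor v (edge b (suc a))
    all-false : total ≡ false
    all-false = begin
      total ≡⟨ xorSum-cong k {f = λ a → xorSum k λ b → horizontal a b xor vertical a b} (λ a _ → xorSum-xor k (horizontal a) (vertical a)) ⟩
      xorSum k (λ a → xorSum k (horizontal a) xor xorSum k (vertical a))
        ≡⟨ xorSum-xor k (λ a → xorSum k (horizontal a)) (λ a → xorSum k (vertical a)) ⟩
      xorSum k (λ a → xorSum k (horizontal a)) xor xorSum k (λ a → xorSum k (vertical a))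
        ≡⟨ cong₂ _xor_ (xorSum-cong k {f = λ a → xorSum k (horizontal a)} (λ a _ → closed h h-top a)) (xorSum-swap k k vertical) ⟩
      xorSum k (λ _ → false) xor xorSum k (λ b → xorSum k (λ a → vertical a b))
        ≡⟨ cong₂ _xor_ (xorSum-false k) (xorSum-cong k {f = λ b → xorSum k (λ a → vertical a b)} (λ b _ → closed v v-top b)) ⟩
      xorSum k (λ _ → false) ≡⟨ xorSum-false k ⟩
      false ∎
      where open ≡-Reasoning
    all-true : total ≡ true
    all-true = begin
      total ≡⟨ xorSum-cong k {f = λ a → xorSum k λ b → horizontal a b xor vertical a b} (λ a a<k → xorSum-cong k (λ b b<k → flow a b a<k b<k)) ⟩
      xorSum k (λ a → xorSum k (at 0 0 a))
        ≡⟨ cong₂ _xor_ (cong not (xorSum-false (suc k′)))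
             (trans (xorSum-cong (suc k′) {f = λ a → xorSum k (at 0 0 (suc a))} (λ _ _ → xorSum-false k)) (xorSum-false (suc k′))) ⟩
      true ∎
      where open ≡-Reasoning

  -- The edges of row i between columns j and j′.
  segment : ℕ → ℕ → ℕ → Level → Bool
  segment i j j′ v = (row v ≡ᵇ i) ∧ ((j <ᵇ column v) xor (j′ <ᵇ column v))

  ≡ᵇ-false : ∀ {m n} → m ≢ n → (m ≡ᵇ n) ≡ false
  ≡ᵇ-false {m} {n} m≢n with m ≡ᵇ n in eq
  ... | false = refl
  ... | true = contradiction (ℕ.≡ᵇ⇒≡ m n (subst T (sym eq) _)) m≢n

  <ᵇ-true : ∀ {m n} → m < n → (m <ᵇ n) ≡ true
  <ᵇ-true {m} {n} m<n with m <ᵇ n | ℕ.<⇒<ᵇ m<n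
  ... | true | _ = refl

  segment-off : ∀ i j j′ v → row v ≢ i → segment i j j′ v ≡ false
  segment-off i j j′ v row≢ = cong (_∧ ((j <ᵇ column v) xor (j′ <ᵇ column v))) (≡ᵇ-false row≢)

  segment-top : ∀ {i} j j′ → i < k → segment i j j′ top ≡ false
  segment-top {i} j j′ i<k = segment-off i j j′ top (λ eq → ℕ.<-irrefl (trans (sym eq) row-top) i<k)

  -- The formula holds for the missing edges too: neither comparison is true at t = 0, both are at t
  -- = k, and the top level lies in no row of the grid.
  segment-edge : ∀ {i j j′ a t} → i < k → j < k → j′ < k → a < k → t ≤ k →
    segment i j j′ (edge a t) ≡ (a ≡ᵇ i) ∧ ((j <ᵇ t) xor (j′ <ᵇ t))
  segment-edge {i} {j} {j′} {a} {zero} i<k _ _ _ _ = trans (segment-top j j′ i<k) (sym (Bool.∧-zeroʳ (a ≡ᵇ i)))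
  segment-edge {i} {j} {j′} {a} {suc t} i<k j<k j′<k a<k 1+t≤k with ℕ.m≤n⇒m<n∨m≡n 1+t≤k
  ... | inj₁ 1+t<k = cong₂ (λ r c → (r ≡ᵇ i) ∧ ((j <ᵇ c) xor (j′ <ᵇ c))) (row-edge a<k 1+t<k) (column-edge a<k 1+t<k)
  ... | inj₂ refl = trans (cong (segment i j j′) (edge-end a)) (trans (segment-top j j′ i<k)
        (sym (trans (cong₂ (λ x y → (a ≡ᵇ i) ∧ (x xor y)) (<ᵇ-true j<k) (<ᵇ-true j′<k)) (Bool.∧-zeroʳ (a ≡ᵇ i)))))

  crossing : ∀ j b → (j <ᵇ b) xor (j <ᵇ suc b) ≡ (b ≡ᵇ j)
  crossing zero zero = refl
  crossing zero (suc b) = refl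
  crossing (suc j) zero = refl
  crossing (suc j) (suc b) = crossing j b

  -- The boundary of a path consists of its two ends: passing from edge b to edge b + 1, the
  -- comparison with j changes only at b = j, and that with j′ only at b = j′.
  segment-ends : ∀ {i j j′ a b} → i < k → j < k → j′ < k → a < k → b < k →
    segment i j j′ (edge a b) xor segment i j j′ (edge a (suc b)) ≡ at i j a b xor at i j′ a b
  segment-ends {i} {j} {j′} {a} {b} i<k j<k j′<k a<k b<k = begin
    segment i j j′ (edge a b) xor segment i j j′ (edge a (suc b))
      ≡⟨ cong₂ _xor_ (segment-edge i<k j<k j′<k a<k (ℕ.<⇒≤ b<k)) (segment-edge i<k j<k j′<k a<k b<k) ⟩
    (a ≡ᵇ i) ∧ ((j <ᵇ b) xor (j′ <ᵇ b)) xor (a ≡ᵇ i) ∧ ((j <ᵇ suc b) xor (j′ <ᵇ suc b))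
      ≡⟨ regroup (a ≡ᵇ i) (j <ᵇ b) (j′ <ᵇ b) (j <ᵇ suc b) (j′ <ᵇ suc b) ⟩
    (a ≡ᵇ i) ∧ ((j <ᵇ b) xor (j <ᵇ suc b)) xor (a ≡ᵇ i) ∧ ((j′ <ᵇ b) xor (j′ <ᵇ suc b))
      ≡⟨ cong₂ (λ x y → (a ≡ᵇ i) ∧ x xor (a ≡ᵇ i) ∧ y) (crossing j b) (crossing j′ b) ⟩
    at i j a b xor at i j′ a b ∎
    where
    open ≡-Reasoning
    open xor-∧-Solver
    regroup : ∀ r x y z t → (r ∧ (x xor y)) xor (r ∧ (z xor t)) ≡ (r ∧ (x xor z)) xor (r ∧ (y xor t))
    regroup = solve 5 (λ r x y z t → (r :* (x :+ y)) :+ (r :* (z :+ t)) := (r :* (x :+ z)) :+ (r :* (y :+ t))) refl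

-- The two graphs

toFin : ∀ {g w} → 1 ≤ g → g ≤ w → Fin w
toFin {suc g} _ g<w = fromℕ< g<w

suc-toFin : ∀ {g w} (1≤g : 1 ≤ g) (g≤w : g ≤ w) → suc (toℕ (toFin 1≤g g≤w)) ≡ g
suc-toFin {suc g} _ g<w = cong suc (Fin.toℕ-fromℕ< g<w)

Profile : ℕ → Set
Profile l = Vec (Fin (suc l) × Bool) 4

level : ∀ {l} → Profile l → Fin 4 → Fin (suc l)
level p c = proj₁ (lookup p c)

sense : ∀ {l} → Profile l → Fin 4 → Bool
sense p c = proj₂ (lookup p c)

bit : Bool → Fin 2
bit false = 0F
bit true = 1F

bit-injective : ∀ {a b} → bit a ≡ bit b → a ≡ b
bit-injective {false} {false} _ = refl
bit-injective {true} {true} _ = refl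

kinds : ℕ → ℕ
kinds L = L * (L * (L * (L * 8)))

module _ {L : ℕ} where
  bits : Bool → Bool → Bool → Fin 8
  bits a b c = combine (bit a) (combine (bit b) (bit c))

  encode : (Fin 4 → Fin L) → Bool → Bool → Bool → Fin (kinds L)
  encode v a b c = combine (v 0F) (combine (v 1F) (combine (v 2F) (combine (v 3F) (bits a b c))))

  encode-injective : ∀ {v a b c v′ a′ b′ c′} → encode v a b c ≡ encode v′ a′ b′ c′ →
    (∀ i → v i ≡ v′ i) × a ≡ a′ × b ≡ b′ × c ≡ c′
  encode-injective {v} {a} {b} {c} {v′} {a′} {b′} {c′} eq =
    (λ { 0F → Fin.combine-injectiveˡ (v 0F) _ (v′ 0F) _ eq
       ; 1F → Fin.combine-injectiveˡ (v 1F) _ (v′ 1F) _ eq₁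
       ; 2F → Fin.combine-injectiveˡ (v 2F) _ (v′ 2F) _ eq₂
       ; 3F → Fin.combine-injectiveˡ (v 3F) _ (v′ 3F) _ eq₃ }) ,
    bit-injective (Fin.combine-injectiveˡ (bit a) (combine (bit b) (bit c)) (bit a′) (combine (bit b′) (bit c′)) eq₄) ,
    bit-injective (Fin.combine-injectiveˡ (bit b) (bit c) (bit b′) (bit c′) eq₅) ,
    bit-injective (Fin.combine-injectiveʳ (bit b) (bit c) (bit b′) (bit c′) eq₅)
    where
    eq₁ = Fin.combine-injectiveʳ (v 0F) _ (v′ 0F) _ eq
    eq₂ = Fin.combine-injectiveʳ (v 1F) _ (v′ 1F) _ eq₁
    eq₃ = Fin.combine-injectiveʳ (v 2F) _ (v′ 2F) _ eq₂
    eq₄ = Fin.combine-injectiveʳ (v 3F) _ (v′ 3F) _ eq₃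
    eq₅ = Fin.combine-injectiveʳ (bit a) (combine (bit b) (bit c)) (bit a′) (combine (bit b′) (bit c′)) eq₄

encode-cong : ∀ {L} {v v′ : Fin 4 → Fin L} {a a′ b b′ c c′} → (∀ i → v i ≡ v′ i) → a ≡ a′ → b ≡ b′ → c ≡ c′ →
  encode v a b c ≡ encode v′ a′ b′ c′
encode-cong {a = a} {b = b} {c = c} v≡ refl refl refl = cong₂ combine (v≡ 0F) (cong₂ combine (v≡ 1F) (cong₂ combine (v≡ 2F) (cong₂ combine (v≡ 3F) refl)))

module Blowup (l q n S : ℕ) .{{_ : NonZero q}} (room : S * 2 < q) (coordinates : Coordinates l q n)
  (kind : Bool → Profile l → Fin S) where

  open Coordinates coordinates
  open Gap q

  levelAt : Fin 4 → Fin n → Fin n → Fin (suc l)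
  levelAt c x y = ChainAt.level c (digits c x) (digits c y)

  senseAt : Fin 4 → Fin n → Fin n → Bool
  senseAt c x y = ChainAt.sense c (digits c x) (digits c y)

  compare : Fin n → Fin n → Fin 4 → Fin (suc l) × Bool
  compare x y c = levelAt c x y , senseAt c x y

  profile : Fin n → Fin n → Profile l
  profile x y = tabulate (compare x y)

  level-profile : ∀ x y c → level (profile x y) c ≡ levelAt c x y
  level-profile x y c = cong proj₁ (Vec.lookup∘tabulate (compare x y) c)

  sense-profile : ∀ x y c → sense (profile x y) c ≡ senseAt c x y
  sense-profile x y c = cong proj₂ (Vec.lookup∘tabulate (compare x y) c)

  weight : Bool → Fin n → Fin n → ℕ
  weight χ x y = suc (toℕ (kind χ (profile x y)))

  shift : Fin n → Fin n → ℕ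
  shift x y = gap (residue x) (residue y)

  Together : Fin n → Fin n → Set
  Together x y = ∀ c → level (profile x y) c ≡ fromℕ l

  together? : ∀ x y → Dec (Together x y)
  together? x y = Fin.all? λ c → level (profile x y) c Fin.≟ fromℕ l

  -- Points with equal digits form a class of q points, one for each residue, with all arcs inside
  -- it. From x to another class run exactly `weight` arcs, to the residues next after that of x.
  -- Classes are thus recognisable by arcs in both directions, and colours by counting.
  Arc : Bool → Fin n → Fin n → Set
  Arc χ x y = Together x y ⊎ (1 ≤ shift x y × shift x y ≤ weight χ x y)

  arc? : ∀ χ x y → Dec (Arc χ x y)
  arc? χ x y = together? x y ⊎-dec (1 ≤? shift x y ×-dec shift x y ≤? weight χ x y)

  twisted : Bool → Graph n
  twisted χ = graph λ x y → does (arc? χ x y)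

  arc-cong : ∀ {χ χ′ x y x′ y′} → (∀ c → level (profile x y) c ≡ level (profile x′ y′) c) →
    kind χ (profile x y) ≡ kind χ′ (profile x′ y′) → shift x y ≡ shift x′ y′ → arc (twisted χ) x y ≡ arc (twisted χ′) x′ y′
  arc-cong {χ} {χ′} {x} {y} {x′} {y′} levels kind≡ shifts = does-cong (arc? χ x y) (arc? χ′ x′ y′)
    (λ { (inj₁ t) → inj₁ (λ c → trans (sym (levels c)) (t c))
       ; (inj₂ (a , b)) → inj₂ (subst (1 ≤_) shifts a , subst₂ (λ s t → s ≤ suc (toℕ t)) shifts kind≡ b) })
    (λ { (inj₁ t) → inj₁ (λ c → trans (levels c) (t c))
       ; (inj₂ (a , b)) → inj₂ (subst (1 ≤_) (sym shifts) a , subst₂ (λ s t → s ≤ suc (toℕ t)) (sym shifts) (sym kind≡) b) })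

  profile-translate : ∀ x y → profile ε (y ∙ x ⁻¹) ≡ profile x y
  profile-translate x y = Vec.tabulate-cong λ c → let levels , senses = comparison-translate c x y in cong₂ _,_ levels senses

  twisted-circulant : ∀ χ → IsCirculant (twisted χ)
  twisted-circulant χ = cyclic , isCyclic , tabulate (arc (twisted χ) ε) , λ x y → sym (trans
    (Vec.lookup∘tabulate (arc (twisted χ) ε) (y ∙ x ⁻¹))
    (arc-cong (λ c → cong (λ p → level p c) (profile-translate x y)) (cong (kind χ) (profile-translate x y)) (gap-translate x y)))

  together-digits : ∀ {x y} → Together x y → ∀ c → digits c x ≡ digits c y
  together-digits {x} {y} t c = ChainAt.level-top⇒≡ c _ _ (trans (sym (level-profile x y c)) (t c))

  digits-together : ∀ {x y} → (∀ c → digits c x ≡ digits c y) → Together x y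
  digits-together {x} {y} ds c = trans (level-profile x y c)
    (trans (cong (ChainAt.level c (digits c x)) (sym (ds c))) (ChainAt.level-refl c (digits c x)))

  together-sym : ∀ {x y} → Together x y → Together y x
  together-sym t = digits-together (sym ∘ together-digits t)

  profile-cong : ∀ {x y x′ y′} → (∀ c → digits c x ≡ digits c x′) → (∀ c → digits c y ≡ digits c y′) → profile x y ≡ profile x′ y′
  profile-cong ds ds′ = Vec.tabulate-cong λ c → cong₂ (λ a b → ChainAt.level c a b , ChainAt.sense c a b) (ds c) (ds′ c)

  weight≤S : ∀ χ x y → weight χ x y ≤ S
  weight≤S χ x y = Fin.toℕ<n (kind χ (profile x y))

  -- Points apart are never joined in both directions: the two shifts would add up to q.
  mutual⇒together : ∀ {χ x y} → Arc χ x y → Arc χ y x → Together x y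
  mutual⇒together (inj₁ t) _ = t
  mutual⇒together (inj₂ _) (inj₁ t) = together-sym t
  mutual⇒together {χ} {x} {y} (inj₂ (1≤ , ≤w)) (inj₂ (_ , ≤w′)) = contradiction (begin-strict
    q ≡⟨ gap-opposite (residue x) (residue y) 1≤ ⟨
    shift x y + shift y x ≤⟨ ℕ.+-mono-≤ (ℕ.≤-trans ≤w (weight≤S χ x y)) (ℕ.≤-trans ≤w′ (weight≤S χ y x)) ⟩
    S + S ≡⟨ cong (_+_ (S)) (ℕ.+-identityʳ (S)) ⟨
    2 * S ≡⟨ ℕ.*-comm 2 (S) ⟩
    S * 2 <⟨ room ⟩
    q ∎) (ℕ.<-irrefl refl)
    where open ℕ.≤-Reasoning

  S<q : S < q
  S<q = ℕ.≤-<-trans (ℕ.m≤m*n (S) 2) room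

  module Embedding {χ χ′} (f : Fin n ↔ Fin n)
    (arcs : ∀ x y → arc (twisted χ) x y ≡ arc (twisted χ′) (Inverse.to f x) (Inverse.to f y)) where
    open Inverse f using (to)

    arc⁺ : ∀ {x y} → Arc χ x y → Arc χ′ (to x) (to y)
    arc⁺ {x} {y} a = does-true (arc? χ′ (to x) (to y)) (trans (sym (arcs x y)) (dec-true (arc? χ x y) a))

    arc⁻ : ∀ {x y} → Arc χ′ (to x) (to y) → Arc χ x y
    arc⁻ {x} {y} a = does-true (arc? χ x y) (trans (arcs x y) (dec-true (arc? χ′ (to x) (to y)) a))

    together⁺ : ∀ {x y} → Together x y → Together (to x) (to y)
    together⁺ {x} {y} t = mutual⇒together {χ′} {to x} {to y} (arc⁺ {x} {y} (inj₁ t)) (arc⁺ {y} {x} (inj₁ (together-sym t)))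

    together⁻ : ∀ {x y} → Together (to x) (to y) → Together x y
    together⁻ {x} {y} t = mutual⇒together {χ} {x} {y} (arc⁻ {x} {y} (inj₁ t)) (arc⁻ {y} {x} (inj₁ (together-sym t)))

    -- The weight of (x , y) is the number of out-neighbours of x among the points together with y.
    weight-mono : ∀ {x y} → ¬ Together x y → weight χ x y ≤ weight χ′ (to x) (to y)
    weight-mono {x} {y} apart = Fin.injective⇒≤ {f = image} image-injective
      where
      step : Fin (weight χ x y) → Fin q
      step t = fromℕ< (ℕ.≤-<-trans (ℕ.≤-trans (Fin.toℕ<n t) (weight≤S χ x y)) S<q)

      point : Fin (weight χ x y) → Fin n
      point t = build (λ c → digits c y) (advance (residue x) (step t))

      digits-point : ∀ t c → digits c (point t) ≡ digits c y
      digits-point t c = digits-build _ _ c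

      shift-point : ∀ t → shift x (point t) ≡ suc (toℕ t)
      shift-point t = trans (cong (gap (residue x)) (residue-build _ _))
        (trans (gap-advance (residue x) (step t)) (Fin.toℕ-fromℕ< _))

      digits-image : ∀ t c → digits c (to (point t)) ≡ digits c (to y)
      digits-image t = together-digits (together⁺ (digits-together {point t} {y} (digits-point t)))

      image-arc : ∀ t → 1 ≤ shift (to x) (to (point t)) × shift (to x) (to (point t)) ≤ weight χ′ (to x) (to y)
      image-arc t = narrow (arc⁺ {x} {point t} (inj₂ (subst (1 ≤_) (sym (shift-point t)) (s≤s z≤n) ,
          subst₂ _≤_ (sym (shift-point t)) (cong (λ p → suc (toℕ (kind χ p))) (profile-cong {x} {y} {x} {point t} (λ _ → refl) (sym ∘ digits-point t))) (Fin.toℕ<n t))))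
        where
        narrow : Arc χ′ (to x) (to (point t)) → 1 ≤ shift (to x) (to (point t)) × shift (to x) (to (point t)) ≤ weight χ′ (to x) (to y)
        narrow (inj₁ t′) = contradiction (digits-together (λ c → trans (together-digits (together⁻ {x} {point t} t′) c) (digits-point t c))) apart
        narrow (inj₂ (1≤ , ≤w)) = 1≤ , subst (λ p → shift (to x) (to (point t)) ≤ suc (toℕ (kind χ′ p)))
          (profile-cong {to x} {to (point t)} {to x} {to y} (λ _ → refl) (digits-image t)) ≤w

      image : Fin (weight χ x y) → Fin (weight χ′ (to x) (to y))
      image t = toFin (proj₁ (image-arc t)) (proj₂ (image-arc t))

      image-injective : ∀ {t u} → image t ≡ image u → t ≡ u
      image-injective {t} {u} eq = Fin.toℕ-injective (ℕ.suc-injective (trans (sym (shift-point t))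
        (trans (cong (shift x) (↔-injective f same-image)) (shift-point u))))
        where
        same-shift : shift (to x) (to (point t)) ≡ shift (to x) (to (point u))
        same-shift = trans (sym (suc-toFin (proj₁ (image-arc t)) (proj₂ (image-arc t))))
          (trans (cong (suc ∘ toℕ) eq) (suc-toFin (proj₁ (image-arc u)) (proj₂ (image-arc u))))
        same-image : to (point t) ≡ to (point u)
        same-image = unique (λ c → trans (digits-image t c) (sym (digits-image u c))) (gap-injective (residue (to x)) same-shift)

-- The colour of a pair: levels, product at a node, ties between coordinates

module Gadget (k′ : ℕ) where
  open Grid k′

  AtNode : Profile l → Set
  AtNode p = ∃₂ λ (a b : Fin k) → ∀ c → level p c ≡ scope (toℕ a) (toℕ b) c

  atNode? : ∀ p → Dec (AtNode p)
  atNode? p = Fin.any? λ a → Fin.any? λ b → Fin.all? λ c → level p c Fin.≟ scope (toℕ a) (toℕ b) c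

  turn : Profile l → Bool
  turn p = (sense p 0F xor sense p 1F) xor (sense p 2F xor sense p 3F)

  -- Of all nodes, only (0 , 0) has `edge 0 1` as its right edge.
  corner : Profile l → Bool
  corner p = does (level p 1F Fin.≟ edge 0 1)

  -- The twist χ exchanges, at the node (0 , 0) only, the two values of the product of the four senses.
  nodeBit : Bool → Profile l → Bool
  nodeBit χ p = if does (atNode? p) then turn p xor (χ ∧ corner p) else false

  -- The two ends of an edge are read in different coordinates. Preserving this bit forces an
  -- isomorphism to reverse the sense of a level, as seen from one point, in both coordinates or in
  -- neither, so that the two contributions of an edge cancel.
  tieBit : Fin 4 → Fin 4 → Profile l → Bool
  tieBit c c′ p = if does (level p c Fin.≟ level p c′) then sense p c xor sense p c′ else false

  kind : Bool → Profile l → Fin (kinds (suc l))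
  kind χ p = encode (level p) (nodeBit χ p) (tieBit 0F 1F p) (tieBit 2F 3F p)

  at-corner : ∀ {a b} → at 0 0 a b ≡ does (a ℕ.≟ 0 ×-dec b ℕ.≟ 0)
  at-corner {zero} {zero} = refl
  at-corner {zero} {suc b} = refl
  at-corner {suc a} {b} = refl

  nodeBit-at : ∀ χ p {a b} → a < k → b < k → (∀ c → level p c ≡ scope a b c) → nodeBit χ p ≡ turn p xor (χ ∧ at 0 0 a b)
  nodeBit-at χ p {a} {b} a<k b<k levels = begin
    nodeBit χ p ≡⟨ cong (if_then turn p xor (χ ∧ corner p) else false) (dec-true (atNode? p) node) ⟩
    turn p xor (χ ∧ corner p) ≡⟨ cong (λ x → turn p xor (χ ∧ x)) (trans corner≡ (sym (at-corner {a} {b}))) ⟩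
    turn p xor (χ ∧ at 0 0 a b) ∎
    where
    open ≡-Reasoning
    node : AtNode p
    node = fromℕ< a<k , fromℕ< b<k , λ c → trans (levels c)
      (sym (cong₂ (λ i j → scope i j c) (Fin.toℕ-fromℕ< a<k) (Fin.toℕ-fromℕ< b<k)))
    corner≡ : corner p ≡ does (a ℕ.≟ 0 ×-dec b ℕ.≟ 0)
    corner≡ = does-cong (level p 1F Fin.≟ edge 0 1) (a ℕ.≟ 0 ×-dec b ℕ.≟ 0)
      (λ eq → edge-corner a<k b<k (trans (sym (levels 1F)) eq))
      (λ { (refl , refl) → levels 1F })

  nodeBit-off : ∀ χ p → ¬ AtNode p → nodeBit χ p ≡ false
  nodeBit-off χ p off = cong (if_then turn p xor (χ ∧ corner p) else false) (dec-false (atNode? p) off)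

  tieBit-off : ∀ p {c c′} → level p c ≢ level p c′ → tieBit c c′ p ≡ false
  tieBit-off p {c} {c′} neq = cong (if_then sense p c xor sense p c′ else false) (dec-false (level p c Fin.≟ level p c′) neq)

  tieBit-at : ∀ p {c c′} → level p c ≡ level p c′ → tieBit c c′ p ≡ sense p c xor sense p c′
  tieBit-at p {c} {c′} eq = cong (if_then sense p c xor sense p c′ else false) (dec-true (level p c Fin.≟ level p c′) eq)

  module _ {χ χ′ p p′} (eq : kind χ p ≡ kind χ′ p′) where
    private
      components = encode-injective {suc l} {level p} {nodeBit χ p} {tieBit 0F 1F p} {tieBit 2F 3F p}
        {level p′} {nodeBit χ′ p′} {tieBit 0F 1F p′} {tieBit 2F 3F p′} eq

    kind⇒level : ∀ c → level p c ≡ level p′ c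
    kind⇒level = proj₁ components

    kind⇒nodeBit : nodeBit χ p ≡ nodeBit χ′ p′
    kind⇒nodeBit = proj₁ (proj₂ components)

    kind⇒tieBit₀₁ : tieBit 0F 1F p ≡ tieBit 0F 1F p′
    kind⇒tieBit₀₁ = proj₁ (proj₂ (proj₂ components))

    kind⇒tieBit₂₃ : tieBit 2F 3F p ≡ tieBit 2F 3F p′
    kind⇒tieBit₂₃ = proj₂ (proj₂ (proj₂ components))

module NonIsomorphic (k′ q n : ℕ) .{{_ : NonZero q}}
  (room : kinds (suc (Grid.l k′)) * 2 < q) (coordinates : Coordinates (Grid.l k′) q n) where

  open Grid k′
  open Gadget k′
  open Coordinates coordinates
  open Blowup l q n (kinds (suc l)) room coordinates kind

  point : (Fin 4 → Level) → Fin n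
  point vs = build (λ c → ChainAt.unit c (vs c)) (residue ε)

  digits-point : ∀ vs c → digits c (point vs) ≡ ChainAt.unit c (vs c)
  digits-point vs c = digits-build _ _ c

  base : Fin n
  base = build (λ c → ChainAt.zeros c l) (residue ε)

  level-point : ∀ vs c → level (profile base (point vs)) c ≡ vs c
  level-point vs c = trans (level-profile base (point vs) c)
    (trans (cong₂ (ChainAt.level c) (digits-build _ _ c) (digits-point vs c)) (ChainAt.level-unit c (vs c)))

  sense-point : ∀ vs c → sense (profile base (point vs)) c ≡ false
  sense-point vs c = trans (sense-profile base (point vs) c)
    (trans (cong₂ (ChainAt.sense c) (digits-build _ _ c) (digits-point vs c)) (ChainAt.sense-unit c (vs c)))

  xor-false⇒≡ : ∀ {a b} → a xor b ≡ false → a ≡ b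
  xor-false⇒≡ {false} {false} _ = refl
  xor-false⇒≡ {true} {true} _ = refl

  module _ (f : Fin n ↔ Fin n)
    (arcs : ∀ x y → arc (twisted false) x y ≡ arc (twisted true) (Inverse.to f x) (Inverse.to f y)) where
    open Inverse f using (to; from; strictlyInverseˡ; strictlyInverseʳ)

    private
      arcs⁻¹ : ∀ x y → arc (twisted true) x y ≡ arc (twisted false) (from x) (from y)
      arcs⁻¹ x y = trans (cong₂ (arc (twisted true)) (sym (strictlyInverseˡ x)) (sym (strictlyInverseˡ y))) (sym (arcs (from x) (from y)))

      module Forth = Embedding {false} {true} f arcs
      module Back = Embedding {true} {false} (↔-sym f) arcs⁻¹

      kind-preserved : ∀ {x y} → ¬ Together x y → kind false (profile x y) ≡ kind true (profile (to x) (to y))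
      kind-preserved {x} {y} apart = Fin.toℕ-injective (ℕ.suc-injective (ℕ.≤-antisym (Forth.weight-mono apart)
        (subst₂ (λ a b → weight true (to x) (to y) ≤ weight false a b) (strictlyInverseʳ x) (strictlyInverseʳ y)
          (Back.weight-mono (apart ∘ Forth.together⁻)))))

      level-preserved : ∀ x y c → level (profile (to x) (to y)) c ≡ level (profile x y) c
      level-preserved x y c = by-cases (together? x y)
        where
        by-cases : Dec (Together x y) → level (profile (to x) (to y)) c ≡ level (profile x y) c
        by-cases (yes t) = trans (Forth.together⁺ t c) (sym (t c))
        by-cases (no apart) = sym (kind⇒level {false} {true} {profile x y} {profile (to x) (to y)} (kind-preserved apart) c)

      -- Agreement in a coordinate is the top level there, and levels are preserved coordinate by
      -- coordinate; so each coordinate of an image depends on the same coordinate of the point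
      -- alone.
      digits-preserved : ∀ {x y} c → digits c x ≡ digits c y → digits c (to x) ≡ digits c (to y)
      digits-preserved {x} {y} c eq = ChainAt.level-top⇒≡ c _ _ (trans (sym (level-profile (to x) (to y) c))
        (trans (level-preserved x y c) (trans (level-profile x y c) (trans (cong (ChainAt.level c (digits c x)) (sym eq)) (ChainAt.level-refl c (digits c x))))))

      together-sense : ∀ {x y} → Together x y → ∀ c → sense (profile x y) c ≡ false
      together-sense {x} {y} t c = trans (sense-profile x y c)
        (trans (cong (ChainAt.sense c (digits c x)) (sym (together-digits t c))) (ChainAt.sense-refl c (digits c x)))

      -- Tells whether the isomorphism reverses the sense at level v as seen from `base`: before the
      -- map that sense is `false`, by `sense-point`.
      charge : Fin 4 → Level → Bool
      charge c v = sense (profile (to base) (to (point (λ _ → v)))) c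

      charge-point : ∀ vs c → sense (profile (to base) (to (point vs))) c ≡ charge c (vs c)
      charge-point vs c = trans (sense-profile (to base) (to (point vs)) c) (trans
        (cong (ChainAt.sense c (digits c (to base))) (digits-preserved c (trans (digits-point vs c) (sym (digits-point (λ _ → vs c) c)))))
        (sym (sense-profile (to base) (to (point (λ _ → vs c))) c)))

      point-top-together : Together base (point (λ _ → top))
      point-top-together = level-point (λ _ → top)

      charge-top : ∀ c → charge c top ≡ false
      charge-top = together-sense (Forth.together⁺ point-top-together)

      module _ (c c′ : Fin 4)
        (tied : ∀ {χ χ′ p p′} → kind χ p ≡ kind χ′ p′ → tieBit c c′ p ≡ tieBit c c′ p′) (v : Level) where

        charge-tied : charge c v ≡ charge c′ v
        charge-tied = by-cases (together? base e)
          where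
          e = point (λ _ → v)
          by-cases : Dec (Together base e) → charge c v ≡ charge c′ v
          by-cases (yes t) = trans (together-sense (Forth.together⁺ t) c) (sym (together-sense (Forth.together⁺ t) c′))
          by-cases (no apart) = xor-false⇒≡ (begin
            charge c v xor charge c′ v ≡⟨ tieBit-at (profile (to base) (to e)) {c} {c′} (trans (trans (level-preserved base e c) levels) (sym (level-preserved base e c′))) ⟨
            tieBit c c′ (profile (to base) (to e)) ≡⟨ tied {false} {true} {profile base e} {profile (to base) (to e)} (kind-preserved apart) ⟨
            tieBit c c′ (profile base e) ≡⟨ tieBit-at (profile base e) {c} {c′} levels ⟩
            sense (profile base e) c xor sense (profile base e) c′ ≡⟨ cong₂ _xor_ (sense-point (λ _ → v) c) (sense-point (λ _ → v) c′) ⟩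
            false ∎)
            where
            open ≡-Reasoning
            levels : level (profile base e) c ≡ level (profile base e) c′
            levels = trans (level-point (λ _ → v) c) (sym (level-point (λ _ → v) c′))

      -- The pair of `base` and the point at the four levels of a node has the same node bit in both
      -- graphs, so the four charges sum to the twist of that node. The ties then let `0F` stand for
      -- `1F` and `2F` for `3F`.
      flow : ∀ a b → a < k → b < k →
        (charge 0F (edge a b) xor charge 0F (edge a (suc b))) xor (charge 2F (edge b a) xor charge 2F (edge b (suc a))) ≡ at 0 0 a b
      flow a b a<k b<k = xor-false⇒≡ (begin
        ((charge 0F (edge a b) xor charge 0F (edge a (suc b))) xor (charge 2F (edge b a) xor charge 2F (edge b (suc a)))) xor at 0 0 a b
          ≡⟨ cong₂ (λ x y → ((charge 0F (edge a b) xor x) xor (charge 2F (edge b a) xor y)) xor at 0 0 a b)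
               (charge-tied 0F 1F (λ {χ} {χ′} {p} {p′} → kind⇒tieBit₀₁ {χ} {χ′} {p} {p′}) (edge a (suc b))) (charge-tied 2F 3F (λ {χ} {χ′} {p} {p′} → kind⇒tieBit₂₃ {χ} {χ′} {p} {p′}) (edge b (suc a))) ⟩
        ((charge 0F (edge a b) xor charge 1F (edge a (suc b))) xor (charge 2F (edge b a) xor charge 3F (edge b (suc a)))) xor at 0 0 a b
          ≡⟨ cong (_xor at 0 0 a b) (cong₂ _xor_ (cong₂ _xor_ (charge-point vs 0F) (charge-point vs 1F)) (cong₂ _xor_ (charge-point vs 2F) (charge-point vs 3F))) ⟨
        turn (profile (to base) (to e)) xor at 0 0 a b
          ≡⟨ nodeBit-at true (profile (to base) (to e)) a<k b<k (λ c → trans (level-preserved base e c) (level-point vs c)) ⟨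
        nodeBit true (profile (to base) (to e)) ≡⟨ kind⇒nodeBit {false} {true} {profile base e} {profile (to base) (to e)} (kind-preserved apart) ⟨
        nodeBit false (profile base e) ≡⟨ nodeBit-at false (profile base e) a<k b<k (level-point vs) ⟩
        turn (profile base e) xor false ≡⟨ Bool.xor-identityʳ _ ⟩
        turn (profile base e) ≡⟨ cong₂ _xor_ (cong₂ _xor_ (sense-point vs 0F) (sense-point vs 1F)) (cong₂ _xor_ (sense-point vs 2F) (sense-point vs 3F)) ⟩
        false ∎)
        where
        open ≡-Reasoning
        vs = scope a b
        e = point vs
        apart : ¬ Together base e
        apart t = [ (λ in-row → row≡⇒≢top a<k in-row (trans (sym (level-point vs 0F)) (t 0F)))
                  , (λ in-row → row≡⇒≢top a<k in-row (trans (sym (level-point vs 1F)) (t 1F))) ]′ (node-in-row a<k b<k)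

    isomorphism-absurd : ⊥
    isomorphism-absurd = no-odd-flow (charge 0F) (charge 2F) (charge-top 0F) (charge-top 2F) flow

  not-isomorphic : ¬ Isomorphic (twisted false) (twisted true)
  not-isomorphic (f , arcs) = isomorphism-absurd f arcs

-- Duplicator

module Avoid (k : ℕ) where

  avoid? : ∀ H → Dec (∃ λ (i : Fin k) → toℕ i ∉ H)
  avoid? H = Fin.any? λ i → ¬? (toℕ i ∈? H)

  -- A function of the hits alone, so that equal hits yield the same row or column; the involutions
  -- of Duplicator depend on this. The default 0 is not reached when the list is shorter than k.
  avoid : List ℕ → ℕ
  avoid H with avoid? H
  ... | yes (i , _) = toℕ i
  ... | no _ = 0

  avoids : ∀ H → length H < k → avoid H < k × avoid H ∉ H
  avoids H short with avoid? H
  ... | yes (i , i∉H) = Fin.toℕ<n i , i∉H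
  ... | no all-hit = contradiction (Fin.injective⇒≤ {f = λ i → index (hit i)} position-injective) (ℕ.<⇒≱ short)
    where
    hit : ∀ (i : Fin k) → toℕ i ∈ H
    hit i with toℕ i ∈? H
    ... | yes i∈H = i∈H
    ... | no i∉H = contradiction (i , i∉H) all-hit
    position-injective : ∀ {i j} → index (hit i) ≡ index (hit j) → i ≡ j
    position-injective {i} {j} eq = Fin.toℕ-injective (trans (Any.lookup-index (hit i))
      (trans (cong (List.lookup H) eq) (sym (Any.lookup-index (hit j)))))

maxFin : ∀ {m} → Fin m → Fin m → Fin m
maxFin a b with a Fin.≤? b
... | yes _ = b
... | no _ = a

maxFin-cases : ∀ {m} (a b : Fin m) → (maxFin a b ≡ b × a Fin.≤ b) ⊎ (maxFin a b ≡ a × b Fin.≤ a)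
maxFin-cases a b with a Fin.≤? b
... | yes a≤b = inj₁ (refl , a≤b)
... | no a≰b = inj₂ (refl , ℕ.<⇒≤ (ℕ.≰⇒> a≰b))

-- The levels met among finitely many points: adding a point to an ultrametric space creates at
-- most one new level, its distance to a nearest point.
module Pinned {A : Set} {l : ℕ} (lev : A → A → Fin (suc l))
  (lev-refl : ∀ x → lev x x ≡ fromℕ l)
  (lev-sym : ∀ x y → lev x y ≡ lev y x)
  (isosceles : ∀ x y z → lev x y Fin.< lev x z → lev z y ≡ lev x y) where

  nearest : A → List A → Fin (suc l)
  nearest x [] = zero
  nearest x (y ∷ ys) = maxFin (lev x y) (nearest x ys)

  pinned : List A → List (Fin (suc l))
  pinned [] = []
  pinned (x ∷ xs) = nearest x xs ∷ pinned xs

  length-pinned : ∀ xs → length (pinned xs) ≡ length xs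
  length-pinned [] = refl
  length-pinned (x ∷ xs) = cong suc (length-pinned xs)

  nearest-≥ : ∀ {x y} ys → y ∈ ys → lev x y Fin.≤ nearest x ys
  nearest-≥ {x} (y ∷ ys) (here refl) with maxFin-cases (lev x y) (nearest x ys)
  ... | inj₁ (eq , ≤) = subst (lev x y Fin.≤_) (sym eq) ≤
  ... | inj₂ (eq , _) = ℕ.≤-reflexive (cong toℕ (sym eq))
  nearest-≥ {x} (y ∷ ys) (there z∈) with maxFin-cases (lev x y) (nearest x ys)
  ... | inj₁ (eq , _) = subst (_ Fin.≤_) (sym eq) (nearest-≥ ys z∈)
  ... | inj₂ (eq , ≤) = subst (_ Fin.≤_) (sym eq) (ℕ.≤-trans (nearest-≥ ys z∈) ≤)

  nearest-attained : ∀ {x y} ys → y ∈ ys → ∃ λ z → z ∈ ys × lev x z ≡ nearest x ys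
  nearest-attained {x} (y ∷ []) _ with maxFin-cases (lev x y) zero
  ... | inj₁ (eq , ≤) = y , here refl , trans (Fin.toℕ-injective (ℕ.n≤0⇒n≡0 ≤)) (sym eq)
  ... | inj₂ (eq , _) = y , here refl , sym eq
  nearest-attained {x} (y ∷ ys@(w ∷ _)) _ with maxFin-cases (lev x y) (nearest x ys) | nearest-attained {x} ys (here refl)
  ... | inj₁ (eq , _) | z , z∈ , lev≡ = z , there z∈ , trans lev≡ (sym eq)
  ... | inj₂ (eq , _) | _ = y , here refl , sym eq

  pinned-complete : ∀ {x y} xs → x ∈ xs → y ∈ xs → lev x y ≡ fromℕ l ⊎ lev x y ∈ pinned xs
  -- If y is not nearest to x, let z be nearest: by the isosceles law the level of x and y is that
  -- of z and y, which was already met without x.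
  pinned-head : ∀ {x y} xs → y ∈ xs → lev x y ≡ fromℕ l ⊎ lev x y ∈ nearest x xs ∷ pinned xs
  pinned-complete (x ∷ xs) (here refl) (here refl) = inj₁ (lev-refl x)
  pinned-complete (x ∷ xs) (here refl) (there y∈) = pinned-head xs y∈
  pinned-complete {x} {y} (y ∷ xs) (there x∈) (here refl) =
    subst (λ v → v ≡ fromℕ l ⊎ v ∈ pinned (y ∷ xs)) (lev-sym y x) (pinned-head xs x∈)
  pinned-complete (_ ∷ xs) (there x∈) (there y∈) = Sum.map₂ there (pinned-complete xs x∈ y∈)

  pinned-head {x} {y} xs y∈ with nearest-attained {x} xs y∈
  ... | z , z∈ , xz≡ with ℕ.m≤n⇒m<n∨m≡n (nearest-≥ {x} xs y∈)
  ... | inj₂ eq = inj₂ (here (Fin.toℕ-injective eq))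
  ... | inj₁ xy< = subst (λ v → v ≡ fromℕ l ⊎ v ∈ nearest x xs ∷ pinned xs)
          (isosceles x y z (subst (λ v → lev x y Fin.< v) (sym xz≡) xy<))
          (Sum.map₂ there (pinned-complete xs z∈ y∈))

  nearest-cong : ∀ {x x′} (g : A → A) ys → (∀ {y} → y ∈ ys → lev x′ (g y) ≡ lev x y) → nearest x′ (map g ys) ≡ nearest x ys
  nearest-cong g [] _ = refl
  nearest-cong g (y ∷ ys) eq = cong₂ maxFin (eq (here refl)) (nearest-cong g ys (eq ∘ there))

  pinned-map : ∀ (g : A → A) → (∀ x y → lev (g x) (g y) ≡ lev x y) → ∀ xs → pinned (map g xs) ≡ pinned xs
  pinned-map g eq [] = refl
  pinned-map g eq (x ∷ xs) = cong₂ _∷_ (nearest-cong g xs (λ {y} _ → eq x y)) (pinned-map g eq xs)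

module Strategy (k′ q n : ℕ) .{{_ : NonZero q}}
  (room : kinds (suc (Grid.l k′)) * 2 < q) (coordinates : Coordinates (Grid.l k′) q n) where

  open Grid k′
  open Gadget k′
  open Coordinates coordinates
  open Blowup l q n (kinds (suc l)) room coordinates kind
  open Avoid k

  Marking : Set
  Marking = Fin 4 → Level → Bool

  module PinnedAt (c : Fin 4) = Pinned (levelAt c)
    (λ x → ChainAt.level-refl c (digits c x))
    (λ x y → ChainAt.level-sym c (digits c x) (digits c y))
    (λ x y z → ChainAt.level-isosceles c (digits c x) (digits c y) (digits c z))

  record Twisting (σ : Marking) (f : Fin n → Fin n) : Set where
    field
      inverse : Fin n → Fin n
      inverseˡ : ∀ x → inverse (f x) ≡ x
      inverseʳ : ∀ x → f (inverse x) ≡ x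
      level-f : ∀ c x y → levelAt c (f x) (f y) ≡ levelAt c x y
      sense-f : ∀ c x y → senseAt c (f x) (f y) ≡ senseAt c x y xor σ c (levelAt c x y)
      residue-f : ∀ x → residue (f x) ≡ residue x

  identity : Twisting (λ _ _ → false) id
  identity = record
    { inverse = id ; inverseˡ = λ _ → refl ; inverseʳ = λ _ → refl ; level-f = λ _ _ _ → refl
    ; sense-f = λ c x y → sym (Bool.xor-identityʳ _) ; residue-f = λ _ → refl }

  compose : ∀ {σ τ f g} → Twisting σ f → Twisting τ g → Twisting (λ c v → σ c v xor τ c v) (f ∘ g)
  compose {σ} {τ} {f} {g} F G = record
    { inverse = G.inverse ∘ F.inverse
    ; inverseˡ = λ x → trans (cong G.inverse (F.inverseˡ (g x))) (G.inverseˡ x)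
    ; inverseʳ = λ x → trans (cong f (G.inverseʳ (F.inverse x))) (F.inverseʳ x)
    ; level-f = λ c x y → trans (F.level-f c (g x) (g y)) (G.level-f c x y)
    ; sense-f = λ c x y → begin
        senseAt c (f (g x)) (f (g y)) ≡⟨ F.sense-f c (g x) (g y) ⟩
        senseAt c (g x) (g y) xor σ c (levelAt c (g x) (g y)) ≡⟨ cong₂ (λ s v → s xor σ c v) (G.sense-f c x y) (G.level-f c x y) ⟩
        (senseAt c x y xor τ c (levelAt c x y)) xor σ c (levelAt c x y) ≡⟨ Bool.xor-assoc (senseAt c x y) _ _ ⟩
        senseAt c x y xor (τ c (levelAt c x y) xor σ c (levelAt c x y)) ≡⟨ cong (senseAt c x y xor_) (Bool.xor-comm (τ c (levelAt c x y)) _) ⟩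
        senseAt c x y xor (σ c (levelAt c x y) xor τ c (levelAt c x y)) ∎
    ; residue-f = λ x → trans (F.residue-f (g x)) (G.residue-f x)
    }
    where
    module F = Twisting F
    module G = Twisting G
    open ≡-Reasoning

  twistAt : Marking → List (Fin n) → Fin n → Fin n
  twistAt τ xs x = build (λ c → ChainAt.twist c (τ c) (map (digits c) xs) (digits c x)) (residue x)

  digits-twistAt : ∀ τ xs x c → digits c (twistAt τ xs x) ≡ ChainAt.twist c (τ c) (map (digits c) xs) (digits c x)
  digits-twistAt τ xs x c = digits-build _ _ c

  twistAt-involutive : ∀ τ xs x → twistAt τ xs (twistAt τ xs x) ≡ x
  twistAt-involutive τ xs x = unique
    (λ c → trans (digits-twistAt τ xs (twistAt τ xs x) c)
      (trans (cong (ChainAt.twist c (τ c) (map (digits c) xs)) (digits-twistAt τ xs x c)) (ChainAt.twist-involutive c (τ c) _ (digits c x))))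
    (trans (residue-build _ _) (residue-build _ _))

  twistAt-twisting : ∀ τ xs → (∀ c → τ c top ≡ false) → Twisting τ (twistAt τ xs)
  twistAt-twisting τ xs τ-top = record
    { inverse = twistAt τ xs ; inverseˡ = twistAt-involutive τ xs ; inverseʳ = twistAt-involutive τ xs
    ; level-f = λ c x y → trans (cong₂ (ChainAt.level c) (digits-twistAt τ xs x c) (digits-twistAt τ xs y c))
        (ChainAt.level-twist c (τ c) (map (digits c) xs) (digits c x) (digits c y))
    ; sense-f = λ c x y → trans (cong₂ (ChainAt.sense c) (digits-twistAt τ xs x c) (digits-twistAt τ xs y c))
        (ChainAt.sense-twist c (τ c) (map (digits c) xs) (digits c x) (digits c y) (τ-top c))
    ; residue-f = λ x → residue-build _ _
    }

  twistAt-fixes : ∀ τ xs → (∀ c {x y} → x ∈ xs → y ∈ xs → τ c (levelAt c x y) ≡ false) → ∀ {x} → x ∈ xs → twistAt τ xs x ≡ x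
  twistAt-fixes τ xs untouched {x} x∈ = unique
    (λ c → trans (digits-twistAt τ xs x c) (ChainAt.twist-fixes c (τ c) (map (digits c) xs) (digits c x)
      (λ y∈ z∈ → let y , y∈xs , y≡ = ∈-map⁻ (digits c) y∈ ; z , z∈xs , z≡ = ∈-map⁻ (digits c) z∈
                 in trans (cong₂ (λ a b → τ c (ChainAt.level c a b)) y≡ z≡) (untouched c y∈xs z∈xs))
      (∈-map⁺ (digits c) x∈)))
    (residue-build _ _)

  -- The same levels are reversed in both coordinates of a direction, which keeps the tie bits.
  rowMarking : (Level → Bool) → (Level → Bool) → Marking
  rowMarking h v 0F = h
  rowMarking h v 1F = h
  rowMarking h v 2F = v
  rowMarking h v 3F = v

  net : (Level → Bool) → (Level → Bool) → ℕ → ℕ → Bool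
  net h v a b = (h (edge a b) xor h (edge a (suc b))) xor (v (edge b a) xor v (edge b (suc a)))

  -- The markings h of the horizontal and v of the vertical edges account for the twist of the graph
  -- at every node except (i , j).
  record Balanced (h v : Level → Bool) (i j : ℕ) : Set where
    field
      h-top : h top ≡ false
      v-top : v top ≡ false
      balance : ∀ {a b} → a < k → b < k → net h v a b ≡ at 0 0 a b xor at i j a b

  -- Columns are rows of the transposed grid, so in `2F` and `3F` the `row` of a level is the number
  -- of a column.
  record Free (i j : ℕ) (xs : List (Fin n)) : Set where
    field
      i<k : i < k
      j<k : j < k
      row-free : ∀ {x y} → x ∈ xs → y ∈ xs → row (levelAt 0F x y) ≢ i × row (levelAt 1F x y) ≢ i
      column-free : ∀ {x y} → x ∈ xs → y ∈ xs → row (levelAt 2F x y) ≢ j × row (levelAt 3F x y) ≢ j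

  free-⊆ : ∀ {i j xs ys} → (∀ {x} → x ∈ ys → x ∈ xs) → Free i j xs → Free i j ys
  free-⊆ sub F = record { i<k = i<k ; j<k = j<k ; row-free = λ x∈ y∈ → row-free (sub x∈) (sub y∈)
    ; column-free = λ x∈ y∈ → column-free (sub x∈) (sub y∈) }
    where open Free F

  record Good (xs : List (Fin n)) (f : Fin n → Fin n) : Set where
    field
      {h v} : Level → Bool
      {i j} : ℕ
      twisting : Twisting (rowMarking h v) f
      balanced : Balanced h v i j
      free : Free i j xs

  good-⊆ : ∀ {xs ys f} → (∀ {x} → x ∈ ys → x ∈ xs) → Good xs f → Good ys f
  good-⊆ sub g = record { twisting = twisting ; balanced = balanced ; free = free-⊆ sub free }
    where open Good g

  rowHits columnHits : List (Fin n) → List ℕ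
  rowHits xs = map row (PinnedAt.pinned 0F xs) ++ map row (PinnedAt.pinned 1F xs)
  columnHits xs = map row (PinnedAt.pinned 2F xs) ++ map row (PinnedAt.pinned 3F xs)

  freeRow freeColumn : List (Fin n) → ℕ
  freeRow xs = avoid (rowHits xs)
  freeColumn xs = avoid (columnHits xs)

  length-hits : ∀ c c′ xs → length (map row (PinnedAt.pinned c xs) ++ map row (PinnedAt.pinned c′ xs)) ≡ length xs + length xs
  length-hits c c′ xs = trans (length-++ (map row (PinnedAt.pinned c xs)))
    (cong₂ _+_ (trans (length-map row (PinnedAt.pinned c xs)) (PinnedAt.length-pinned c xs))
      (trans (length-map row (PinnedAt.pinned c′ xs)) (PinnedAt.length-pinned c′ xs)))

  row-avoids : ∀ c {xs H i} → i < k → i ∉ H → (∀ {v} → v ∈ PinnedAt.pinned c xs → row v ∈ H) →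
    ∀ {x y} → x ∈ xs → y ∈ xs → row (levelAt c x y) ≢ i
  row-avoids c {xs} i<k i∉H hit x∈ y∈ eq with PinnedAt.pinned-complete c xs x∈ y∈
  ... | inj₁ is-top = row≡⇒≢top i<k eq is-top
  ... | inj₂ v∈ = i∉H (subst (_∈ _) eq (hit v∈))

  free-choice : ∀ xs → length xs + length xs < k → Free (freeRow xs) (freeColumn xs) xs
  free-choice xs short = record
    { i<k = proj₁ row-choice
    ; j<k = proj₁ column-choice
    ; row-free = λ x∈ y∈ →
        row-avoids 0F (proj₁ row-choice) (proj₂ row-choice) (λ v∈ → ∈-++⁺ˡ (∈-map⁺ row v∈)) x∈ y∈ ,
        row-avoids 1F (proj₁ row-choice) (proj₂ row-choice) (λ v∈ → ∈-++⁺ʳ (map row (PinnedAt.pinned 0F xs)) (∈-map⁺ row v∈)) x∈ y∈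
    ; column-free = λ x∈ y∈ →
        row-avoids 2F (proj₁ column-choice) (proj₂ column-choice) (λ v∈ → ∈-++⁺ˡ (∈-map⁺ row v∈)) x∈ y∈ ,
        row-avoids 3F (proj₁ column-choice) (proj₂ column-choice) (λ v∈ → ∈-++⁺ʳ (map row (PinnedAt.pinned 2F xs)) (∈-map⁺ row v∈)) x∈ y∈
    }
    where
    row-choice = avoids (rowHits xs) (subst (_< k) (sym (length-hits 0F 1F xs)) short)
    column-choice = avoids (columnHits xs) (subst (_< k) (sym (length-hits 2F 3F xs)) short)

  -- The missing node travels along its row to column j′, and then along that column to row i′.
  route : ℕ → ℕ → ℕ → ℕ → Marking
  route i j i′ j′ = rowMarking (segment i j j′) (segment j′ i i′)

  route-top : ∀ {i j i′ j′} → i < k → j′ < k → ∀ c → route i j i′ j′ c top ≡ false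
  route-top i<k j′<k 0F = segment-top _ _ i<k
  route-top i<k j′<k 1F = segment-top _ _ i<k
  route-top i<k j′<k 2F = segment-top _ _ j′<k
  route-top i<k j′<k 3F = segment-top _ _ j′<k

  route-balanced : ∀ {h v i j i′ j′} → i < k → j < k → i′ < k → j′ < k → Balanced h v i j →
    Balanced (λ e → h e xor segment i j j′ e) (λ e → v e xor segment j′ i i′ e) i′ j′
  route-balanced {h} {v} {i} {j} {i′} {j′} i<k j<k i′<k j′<k B = record
    { h-top = cong₂ _xor_ h-top (segment-top j j′ i<k)
    ; v-top = cong₂ _xor_ v-top (segment-top i i′ j′<k)
    ; balance = λ {a} {b} a<k b<k → begin
        net (λ e → h e xor segment i j j′ e) (λ e → v e xor segment j′ i i′ e) a b
          ≡⟨ xor-interchange₄ (h (edge a b)) (segment i j j′ (edge a b)) (h (edge a (suc b))) (segment i j j′ (edge a (suc b)))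
               (v (edge b a)) (segment j′ i i′ (edge b a)) (v (edge b (suc a))) (segment j′ i i′ (edge b (suc a))) ⟩
        net h v a b xor ((segment i j j′ (edge a b) xor segment i j j′ (edge a (suc b))) xor (segment j′ i i′ (edge b a) xor segment j′ i i′ (edge b (suc a))))
          ≡⟨ cong₂ _xor_ (balance a<k b<k) (cong₂ _xor_ (segment-ends i<k j<k j′<k a<k b<k) (segment-ends j′<k i<k i′<k b<k a<k)) ⟩
        (at 0 0 a b xor at i j a b) xor ((at i j a b xor at i j′ a b) xor (at j′ i b a xor at j′ i′ b a))
          ≡⟨ cong₂ (λ p q → (at 0 0 a b xor at i j a b) xor ((at i j a b xor at i j′ a b) xor (p xor q)))
               (Bool.∧-comm (b ≡ᵇ j′) (a ≡ᵇ i)) (Bool.∧-comm (b ≡ᵇ j′) (a ≡ᵇ i′)) ⟩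
        (at 0 0 a b xor at i j a b) xor ((at i j a b xor at i j′ a b) xor (at i j′ a b xor at i′ j′ a b))
          ≡⟨ telescope (at 0 0 a b) (at i j a b) (at i j′ a b) (at i′ j′ a b) ⟩
        at 0 0 a b xor at i′ j′ a b ∎
    }
    where
    open Balanced B
    open ≡-Reasoning
    telescope : ∀ a b c d → (a xor b) xor ((b xor c) xor (c xor d)) ≡ a xor d
    telescope a b c d = trans (cong ((a xor b) xor_) (xor-cancel b c d)) (xor-cancel a b d)

  twisting-cong : ∀ {σ τ f} → (∀ c v → σ c v ≡ τ c v) → Twisting σ f → Twisting τ f
  twisting-cong eq F = record { inverse = inverse ; inverseˡ = inverseˡ ; inverseʳ = inverseʳ ; level-f = level-f
    ; sense-f = λ c x y → trans (sense-f c x y) (cong (senseAt c x y xor_) (eq c (levelAt c x y))) ; residue-f = residue-f }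
    where open Twisting F

  -- The first leg lies in the row of the old missing node and the second in the column of the new
  -- one, and both are free of the levels among xs.
  route-untouched : ∀ {i j i′ j′ xs} → Free i j xs → Free i′ j′ xs → ∀ c {x y} → x ∈ xs → y ∈ xs →
    route i j i′ j′ c (levelAt c x y) ≡ false
  route-untouched {i} {j} {i′} {j′} F F′ 0F {x} {y} x∈ y∈ = segment-off i j j′ (levelAt 0F x y) (proj₁ (Free.row-free F x∈ y∈))
  route-untouched {i} {j} {i′} {j′} F F′ 1F {x} {y} x∈ y∈ = segment-off i j j′ (levelAt 1F x y) (proj₂ (Free.row-free F x∈ y∈))
  route-untouched {i} {j} {i′} {j′} F F′ 2F {x} {y} x∈ y∈ = segment-off j′ i i′ (levelAt 2F x y) (proj₁ (Free.column-free F′ x∈ y∈))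
  route-untouched {i} {j} {i′} {j′} F F′ 3F {x} {y} x∈ y∈ = segment-off j′ i i′ (levelAt 3F x y) (proj₂ (Free.column-free F′ x∈ y∈))

  reposition : ∀ {xs ys f i′ j′} (g : Good xs f) → Free i′ j′ ys →
    Good ys (f ∘ twistAt (route (Good.i g) (Good.j g) i′ j′) xs)
  reposition {xs} {ys} {f} {i′} {j′} g F′ = record
    { twisting = twisting-cong (λ { 0F v → refl ; 1F v → refl ; 2F v → refl ; 3F v → refl })
        (compose (Good.twisting g) (twistAt-twisting (route (Good.i g) (Good.j g) i′ j′) xs (route-top (Free.i<k (Good.free g)) (Free.j<k F′))))
    ; balanced = route-balanced (Free.i<k (Good.free g)) (Free.j<k (Good.free g)) (Free.i<k F′) (Free.j<k F′) (Good.balanced g)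
    ; free = F′
    }

  tieBit-marked : ∀ {p p′ : Profile l} {c c′} (g : Level → Bool) → (∀ d → level p′ d ≡ level p d) →
    sense p′ c ≡ sense p c xor g (level p c) → sense p′ c′ ≡ sense p c′ xor g (level p c′) →
    tieBit c c′ p ≡ tieBit c c′ p′
  tieBit-marked {p} {p′} {c} {c′} g levels s s′ = by-cases (level p c Fin.≟ level p c′)
    where
    cancel : ∀ a b x → (a xor x) xor (b xor x) ≡ a xor b
    cancel a b false = cong₂ _xor_ (Bool.xor-identityʳ a) (Bool.xor-identityʳ b)
    cancel false false true = refl
    cancel false true true = refl
    cancel true false true = refl
    cancel true true true = refl
    by-cases : Dec (level p c ≡ level p c′) → tieBit c c′ p ≡ tieBit c c′ p′
    by-cases (no neq) = trans (tieBit-off p {c} {c′} neq) (sym (tieBit-off p′ {c} {c′} (λ eq → neq (trans (sym (levels c)) (trans eq (levels c′))))))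
    by-cases (yes eq) = begin
      tieBit c c′ p ≡⟨ tieBit-at p {c} {c′} eq ⟩
      sense p c xor sense p c′ ≡⟨ cancel (sense p c) (sense p c′) (g (level p c)) ⟨
      (sense p c xor g (level p c)) xor (sense p c′ xor g (level p c)) ≡⟨ cong (λ v → (sense p c xor g (level p c)) xor (sense p c′ xor g v)) eq ⟩
      (sense p c xor g (level p c)) xor (sense p c′ xor g (level p c′)) ≡⟨ cong₂ _xor_ s s′ ⟨
      sense p′ c xor sense p′ c′ ≡⟨ tieBit-at p′ {c} {c′} (trans (levels c) (trans eq (sym (levels c′)))) ⟨
      tieBit c c′ p′ ∎
      where open ≡-Reasoning

  at-off : ∀ {i j a b} → ¬ (a ≡ i × b ≡ j) → at i j a b ≡ false
  at-off {i} {j} {a} {b} off with a ≡ᵇ i in eqᵢ | b ≡ᵇ j in eqⱼ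
  ... | false | _ = refl
  ... | true | false = refl
  ... | true | true = contradiction (ℕ.≡ᵇ⇒≡ a i (subst T (sym eqᵢ) _) , ℕ.≡ᵇ⇒≡ b j (subst T (sym eqⱼ) _)) off

  module _ {p p′ : Profile l} {h v : Level → Bool} {i j : ℕ} (levels : ∀ c → level p′ c ≡ level p c)
    (senses : ∀ c → sense p′ c ≡ sense p c xor rowMarking h v c (level p c)) where

    -- A pair at the missing node (i , j) would show a level of row i in `0F` or `1F`. At any other
    -- node the net effect of the marking is exactly the twist of the second graph.
    nodeBit-marked : Balanced h v i j → row (level p 0F) ≢ i → row (level p 1F) ≢ i → nodeBit false p ≡ nodeBit true p′
    nodeBit-marked B row₀ row₁ = by-cases (atNode? p)
      where
      by-cases : Dec (AtNode p) → nodeBit false p ≡ nodeBit true p′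
      by-cases (no off) = trans (nodeBit-off false p off)
        (sym (nodeBit-off true p′ (λ { (a , b , eq) → off (a , b , λ c → trans (sym (levels c)) (eq c)) })))
      by-cases (yes (a′ , b′ , eq)) = begin
        nodeBit false p ≡⟨ nodeBit-at false p a<k b<k eq ⟩
        turn p xor false ≡⟨ Bool.xor-identityʳ (turn p) ⟩
        turn p ≡⟨ cancel (turn p) (at 0 0 a b) ⟨
        (turn p xor at 0 0 a b) xor at 0 0 a b ≡⟨ cong (λ x → (turn p xor x) xor at 0 0 a b) net≡ ⟨
        (turn p xor net h v a b) xor at 0 0 a b ≡⟨ cong (_xor at 0 0 a b) turn≡ ⟨
        turn p′ xor at 0 0 a b ≡⟨ nodeBit-at true p′ a<k b<k (λ c → trans (levels c) (eq c)) ⟨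
        nodeBit true p′ ∎
        where
        open ≡-Reasoning
        a = toℕ a′
        b = toℕ b′
        a<k = Fin.toℕ<n a′
        b<k = Fin.toℕ<n b′
        cancel : ∀ x y → (x xor y) xor y ≡ x
        cancel x false = trans (Bool.xor-identityʳ _) (Bool.xor-identityʳ x)
        cancel false true = refl
        cancel true true = refl
        elsewhere : ¬ (a ≡ i × b ≡ j)
        elsewhere (a≡i , _) = [ (λ in-row → row₀ (trans (cong row (eq 0F)) (trans in-row a≡i)))
                              , (λ in-row → row₁ (trans (cong row (eq 1F)) (trans in-row a≡i))) ]′ (node-in-row a<k b<k)
        net≡ : net h v a b ≡ at 0 0 a b
        net≡ = trans (Balanced.balance B a<k b<k) (trans (cong (at 0 0 a b xor_) (at-off elsewhere)) (Bool.xor-identityʳ _))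
        sense-at : ∀ c → sense p′ c ≡ sense p c xor rowMarking h v c (scope a b c)
        sense-at c = trans (senses c) (cong (λ e → sense p c xor rowMarking h v c e) (eq c))
        turn≡ : turn p′ ≡ turn p xor net h v a b
        turn≡ = trans (cong₂ _xor_ (cong₂ _xor_ (sense-at 0F) (sense-at 1F)) (cong₂ _xor_ (sense-at 2F) (sense-at 3F)))
          (xor-interchange₄ (sense p 0F) (h (edge a b)) (sense p 1F) (h (edge a (suc b))) (sense p 2F) (v (edge b a)) (sense p 3F) (v (edge b (suc a))))

    kind-marked : Balanced h v i j → row (level p 0F) ≢ i → row (level p 1F) ≢ i → kind false p ≡ kind true p′
    kind-marked B row₀ row₁ = encode-cong (sym ∘ levels) (nodeBit-marked B row₀ row₁)
      (tieBit-marked {p} {p′} {0F} {1F} h levels (senses 0F) (senses 1F))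
      (tieBit-marked {p} {p′} {2F} {3F} v levels (senses 2F) (senses 3F))

  good-arc : ∀ {xs f x y} → Good xs f → x ∈ xs → y ∈ xs → arc (twisted false) x y ≡ arc (twisted true) (f x) (f y)
  good-arc {xs} {f} {x} {y} g x∈ y∈ = arc-cong (sym ∘ levels)
    (kind-marked {profile x y} {profile (f x) (f y)} levels senses balanced
      (subst (λ e → row e ≢ i) (sym (level-profile x y 0F)) (proj₁ (row-free x∈ y∈)))
      (subst (λ e → row e ≢ i) (sym (level-profile x y 1F)) (proj₂ (row-free x∈ y∈))))
    (cong₂ (Gap.gap q) (sym (residue-f x)) (sym (residue-f y)))
    where
    open Good g
    open Free free
    open Twisting twisting
    levels : ∀ c → level (profile (f x) (f y)) c ≡ level (profile x y) c
    levels c = trans (level-profile (f x) (f y) c) (trans (level-f c x y) (sym (level-profile x y c)))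
    senses : ∀ c → sense (profile (f x) (f y)) c ≡ sense (profile x y) c xor rowMarking h v c (level (profile x y) c)
    senses c = trans (sense-profile (f x) (f y) c) (trans (sense-f c x y)
      (sym (cong₂ (λ s e → s xor rowMarking h v c e) (sense-profile x y c) (level-profile x y c))))

  good-injective : ∀ {xs f} → Good xs f → ∀ {x y} → f x ≡ f y → x ≡ y
  good-injective g {x} {y} eq = trans (sym (inverseˡ x)) (trans (cong inverse eq) (inverseˡ y))
    where open Twisting (Good.twisting g)

  module Response {xs f} (good : Good xs f) (short : suc (length xs) + suc (length xs) < k) where
    open Good good
    open Twisting twisting using (inverse; inverseˡ; inverseʳ)

    i′ j′ : Fin n → ℕ
    i′ α = freeRow (α ∷ xs)
    j′ α = freeColumn (α ∷ xs)

    target : ∀ α → Free (i′ α) (j′ α) (α ∷ xs)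
    target α = free-choice (α ∷ xs) short

    adjust : Fin n → Fin n → Fin n
    adjust α = twistAt (route i j (i′ α) (j′ α)) xs

    adjust-fixes : ∀ α {x} → x ∈ xs → adjust α x ≡ x
    adjust-fixes α = twistAt-fixes (route i j (i′ α) (j′ α)) xs (route-untouched free (free-⊆ there (target α)))

    ι : Fin n → Fin n
    ι α = adjust α α

    pinned-ι : ∀ c α → PinnedAt.pinned c (ι α ∷ xs) ≡ PinnedAt.pinned c (α ∷ xs)
    pinned-ι c α = cong (_∷ PinnedAt.pinned c xs) (trans (cong (PinnedAt.nearest c (ι α)) (sym (map-id xs)))
      (PinnedAt.nearest-cong c id xs λ {y} y∈ → trans (cong (levelAt c (ι α)) (sym (adjust-fixes α y∈)))
        (Twisting.level-f (twistAt-twisting _ xs (route-top (Free.i<k free) (Free.j<k (target α)))) c α y)))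

    -- The twist applied to α depends on α only through the free row and column. It fixes xs and
    -- preserves levels, so `ι α` has the same pinned levels, hence the same row and column, and the
    -- same twist takes it back.
    ι-involutive : ∀ α → ι (ι α) ≡ α
    ι-involutive α = trans
      (cong₂ (λ a b → twistAt (route i j a b) xs (ι α))
        (cong₂ (λ a b → avoid (map row a ++ map row b)) (pinned-ι 0F α) (pinned-ι 1F α))
        (cong₂ (λ a b → avoid (map row a ++ map row b)) (pinned-ι 2F α) (pinned-ι 3F α)))
      (twistAt-involutive (route i j (i′ α) (j′ α)) xs α)

    response : Fin n → Fin n → Fin n
    response α = f ∘ adjust α

    response-good : ∀ α → Good (α ∷ xs) (response α)
    response-good α = reposition good (target α)

    response-agrees : ∀ α {x} → x ∈ xs → response α x ≡ f x
    response-agrees α x∈ = cong f (adjust-fixes α x∈)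

    answer answer⁻¹ : Fin n → Fin n
    answer = f ∘ ι
    answer⁻¹ = ι ∘ inverse

    answer-↭ : map answer (allFin n) Perm.↭ allFin n
    answer-↭ = map-bijection-↭ (Unique.allFin⁺ n) ∈-allFin answer answer⁻¹
      (λ α → trans (cong ι (inverseˡ (ι α))) (ι-involutive α))
      (λ α → trans (cong f (ι-involutive (inverse α))) (inverseʳ α))

  start : List (Fin n) → Fin n → Fin n
  start xs = twistAt (route 0 0 (freeRow xs) (freeColumn xs)) []

  -- The identity fails to match the graphs only at the twisted node (0 , 0), which is therefore the
  -- first missing node.
  initially-good : Good [] id
  initially-good = record
    { h = λ _ → false ; v = λ _ → false ; i = 0 ; j = 0
    ; twisting = twisting-cong (λ { 0F _ → refl ; 1F _ → refl ; 2F _ → refl ; 3F _ → refl }) identity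
    ; balanced = record { h-top = refl ; v-top = refl ; balance = λ {a} {b} _ _ → sym (Bool.xor-same (at 0 0 a b)) }
    ; free = record { i<k = s≤s z≤n ; j<k = s≤s z≤n ; row-free = λ () ; column-free = λ () }
    }

  start-good : ∀ xs → length xs + length xs < k → Good xs (start xs)
  start-good xs short = reposition initially-good (free-choice xs short)

  start-involutive : ∀ xs → length xs + length xs < k → ∀ x → start (map (start xs) xs) (start xs x) ≡ x
  start-involutive xs short x = trans
    (cong₂ (λ a b → twistAt (route 0 0 a b) [] (start xs x))
      (cong₂ (λ a b → avoid (map row a ++ map row b)) (pinned-start 0F) (pinned-start 1F))
      (cong₂ (λ a b → avoid (map row a ++ map row b)) (pinned-start 2F) (pinned-start 3F)))
    (twistAt-involutive _ [] x)
    where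
    pinned-start : ∀ c → PinnedAt.pinned c (map (start xs) xs) ≡ PinnedAt.pinned c xs
    pinned-start c = PinnedAt.pinned-map c (start xs)
      (Twisting.level-f (twistAt-twisting _ [] (route-top (s≤s z≤n) (Free.j<k (free-choice xs short)))) c) xs

  backAndForth : ∀ size → suc size + suc size < k → BackAndForth (twisted false) (twisted true) size
  backAndForth size room-left = record
    { Good = Good
    ; good-⊆ = good-⊆
    ; good-injective = good-injective
    ; good-arc = good-arc
    ; respond = respond
    ; start = start
    ; start-good = λ xs short → start-good xs (fits short)
    ; start-involutive = λ xs short → start-involutive xs (fits short)
    }
    where
    fits : ∀ {a} → a ≤ size → a + a < k
    fits a≤ = ℕ.≤-<-trans (ℕ.+-mono-≤ (ℕ.m≤n⇒m≤1+n a≤) (ℕ.m≤n⇒m≤1+n a≤)) room-left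
    respond : ∀ {xs f} → Good xs f → length xs ≤ size → Answer Good xs f
    respond {xs} {f} good short = record
      { answer = answer ; answer-↭ = answer-↭ ; response = response ; response-good = response-good
      ; response-agrees = response-agrees ; response-answer = λ _ → refl }
      where open Response good (ℕ.≤-<-trans (ℕ.+-mono-≤ (s≤s short) (s≤s short)) room-left)

  not-identified : ∀ m .{{_ : NonZero m}} → suc m + suc m < k → ¬ Identifies m (twisted false)
  not-identified m small identifies = NonIsomorphic.not-isomorphic k′ q n room coordinates
    (identifies (twisted true) (Play.wl-equivalent (backAndForth m small) m ℕ.≤-refl))

-- The circulant graphs of large dimension

n<2^n : ∀ n → n < 2 ^ n
n<2^n zero = s≤s z≤n
n<2^n (suc n) = begin-strict
  suc n <⟨ s≤s (n<2^n n) ⟩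
  suc (2 ^ n) ≤⟨ ℕ.+-monoˡ-≤ (2 ^ n) (ℕ.m^n>0 2 n) ⟩
  2 ^ n + 2 ^ n ≡⟨ cong (2 ^ n +_) (ℕ.+-identityʳ (2 ^ n)) ⟨
  2 ^ suc n ∎
  where open ℕ.≤-Reasoning

^-≤-2^ : ∀ {a} b l → a ≤ 2 ^ b → a ^ l ≤ 2 ^ (b * l)
^-≤-2^ {a} b l a≤2^b = ℕ.≤-trans (ℕ.^-monoˡ-≤ l a≤2^b) (ℕ.≤-reflexive (ℕ.^-*-assoc 2 b l))

fourth : ℕ → ℕ
fourth L = L * (L * (L * L))

kinds-fourth : ∀ L → kinds L * 2 ≡ 16 * fourth L
kinds-fourth = expand
  where
  expand : ∀ L → L * (L * (L * (L * 8))) * 2 ≡ 16 * (L * (L * (L * L)))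
  expand = solve-∀

module Size (l : ℕ) where
  open CyclicCoordinates l (fourth (suc l)) public

  -- There are 8 (l + 1)⁴ kinds, and q exceeds 1155 (l + 1)⁴. Being polynomial in l, q does not
  -- spoil log n = O(l).
  room : kinds (suc l) * 2 < q
  room = s≤s (ℕ.≤-trans (ℕ.≤-reflexive (kinds-fourth (suc l))) (ℕ.*-monoˡ-≤ (fourth (suc l)) (from-yes (16 ≤? 1155))))

  l<order : l < order
  l<order = begin-strict
    l <⟨ ℕ.n<1+n l ⟩
    suc l ≤⟨ ℕ.m≤m*n (suc l) (suc l * (suc l * suc l)) ⟩
    fourth (suc l) ≤⟨ ℕ.m≤n*m (fourth (suc l)) 1155 ⟩
    1155 * fourth (suc l) ≤⟨ ℕ.n≤1+n _ ⟩
    q ≤⟨ ℕ.m≤m*n q (product (moduli ∘ suc)) {{product-nonZero (moduli-nonZero ∘ suc)}} ⟩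
    order ∎
    where open ℕ.≤-Reasoning

  q≤ : q ≤ 2 ^ (11 + 4 * l)
  q≤ = begin
    suc (1155 * fourth (suc l)) ≤⟨ ℕ.+-monoˡ-≤ (1155 * fourth (suc l)) (s≤s z≤n) ⟩
    1156 * fourth (suc l) ≤⟨ ℕ.*-mono-≤ (from-yes (1156 ≤? 2048)) fourth≤ ⟩
    2 ^ 11 * 2 ^ (4 * l) ≡⟨ ℕ.^-distribˡ-+-* 2 11 (4 * l) ⟨
    2 ^ (11 + 4 * l) ∎
    where
    open ℕ.≤-Reasoning
    merge : ∀ x → x * (x * (x * x)) ≡ x ^ 4
    merge x = cong (λ y → x * (x * (x * y))) (sym (ℕ.*-identityʳ x))
    fourth≤ : fourth (suc l) ≤ 2 ^ (4 * l)
    fourth≤ = begin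
      fourth (suc l) ≤⟨ ℕ.*-mono-≤ (n<2^n l) (ℕ.*-mono-≤ (n<2^n l) (ℕ.*-mono-≤ (n<2^n l) (n<2^n l))) ⟩
      fourth (2 ^ l) ≡⟨ merge (2 ^ l) ⟩
      (2 ^ l) ^ 4 ≡⟨ ℕ.^-*-assoc 2 l 4 ⟩
      2 ^ (l * 4) ≡⟨ cong (2 ^_) (ℕ.*-comm l 4) ⟩
      2 ^ (4 * l) ∎

  -- Bounding the bases by 2², 2³, 2³ and 2⁴ gives the exponent 12 l, and q adds 11 + 4 l; with 1 ≤
  -- l the sum is at most 27 l.
  order≤ : 1 ≤ l → order ≤ 2 ^ (27 * l)
  order≤ 1≤l = begin
    q * (3 ^ l * (5 ^ l * (7 ^ l * (11 ^ l * 1))))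
      ≤⟨ ℕ.*-mono-≤ q≤ (ℕ.*-mono-≤ (^-≤-2^ 2 l (from-yes (3 ≤? 2 ^ 2))) (ℕ.*-mono-≤ (^-≤-2^ 3 l (from-yes (5 ≤? 2 ^ 3)))
           (ℕ.*-mono-≤ (^-≤-2^ 3 l (from-yes (7 ≤? 2 ^ 3))) (ℕ.*-monoˡ-≤ 1 (^-≤-2^ 4 l (from-yes (11 ≤? 2 ^ 4))))))) ⟩
    2 ^ (11 + 4 * l) * (2 ^ (2 * l) * (2 ^ (3 * l) * (2 ^ (3 * l) * (2 ^ (4 * l) * 1))))
      ≡⟨ powers (11 + 4 * l) (2 * l) (3 * l) (3 * l) (4 * l) ⟩
    2 ^ (11 + 4 * l + (2 * l + (3 * l + (3 * l + 4 * l)))) ≡⟨ cong (2 ^_) (collect l) ⟩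
    2 ^ (11 + 16 * l) ≤⟨ ℕ.^-monoʳ-≤ 2 (ℕ.+-monoˡ-≤ (16 * l) (ℕ.*-monoʳ-≤ 11 1≤l)) ⟩
    2 ^ (11 * l + 16 * l) ≡⟨ cong (2 ^_) (ℕ.*-distribʳ-+ l 11 16) ⟨
    2 ^ (27 * l) ∎
    where
    open ℕ.≤-Reasoning
    collect : ∀ l → 11 + 4 * l + (2 * l + (3 * l + (3 * l + 4 * l))) ≡ 11 + 16 * l
    collect = solve-∀
    powers : ∀ a b c d e → 2 ^ a * (2 ^ b * (2 ^ c * (2 ^ d * (2 ^ e * 1)))) ≡ 2 ^ (a + (b + (c + (d + e))))
    powers a b c d e = sym (trans (ℕ.^-distribˡ-+-* 2 a _) (cong (2 ^ a *_) (trans (ℕ.^-distribˡ-+-* 2 b _) (cong (2 ^ b *_)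
      (trans (ℕ.^-distribˡ-+-* 2 c _) (cong (2 ^ c *_) (trans (ℕ.^-distribˡ-+-* 2 d e) (cong (2 ^ d *_) (sym (ℕ.*-identityʳ (2 ^ e)))))))))))

module LargeDimension (B : ℕ) (1≤B : 1 ≤ B) where
  -- This makes k = 2 B + 3, the least side with 2 (B + 1) < k.
  k′ : ℕ
  k′ = suc (B + B)

  open Grid k′ using (k; l)
  open Gadget k′ using (kind)
  open Size l public

  G : Graph order
  G = Blowup.twisted l q order (kinds (suc l)) room coordinates kind false

  circulant : IsCirculant G
  circulant = Blowup.twisted-circulant l q order (kinds (suc l)) room coordinates kind false

  not-identified : ∀ m .{{_ : NonZero m}} → m ≤ B → ¬ Identifies m G
  not-identified m m≤B = Strategy.not-identified k′ q order room coordinates m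
    (s≤s (ℕ.≤-trans (s≤s (ℕ.+-mono-≤ m≤B (s≤s m≤B))) (ℕ.≤-reflexive (cong suc (ℕ.+-suc B B)))))

  k≤l : k ≤ l
  k≤l = ℕ.m≤m*n k k

  B<order : B < order
  B<order = ℕ.≤-<-trans (ℕ.≤-trans (ℕ.m≤n+m B (3 + B)) k≤l) l<order

  dimension : ∃ λ d → IsWLDimension G d × B < d
  dimension = wlDimension-above G (ℕ.≤-trans (s≤s 1≤B) B<order) B 1≤B not-identified

  -- From k = 2 B + 3 ≤ 3 (B + 1) ≤ 3 d the exponent 27 k² is at most 243 d², and 256 = 16² is the
  -- least square above 243.
  order-bound : ∀ {d} → B < d → order ≤ 2 ^ ((16 * d) ^ 2)
  order-bound {d} B<d = begin
    order ≤⟨ order≤ (ℕ.≤-trans (s≤s z≤n) k≤l) ⟩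
    2 ^ (27 * (k * k)) ≤⟨ ℕ.^-monoʳ-≤ 2 exponent ⟩
    2 ^ ((16 * d) ^ 2) ∎
    where
    open ℕ.≤-Reasoning
    k≤3d : k ≤ 3 * d
    k≤3d = begin
      3 + (B + B) ≤⟨ ℕ.+-monoʳ-≤ 3 (ℕ.+-monoʳ-≤ B (ℕ.m≤m+n B B)) ⟩
      3 + (B + (B + B)) ≡⟨ triple B ⟩
      3 * suc B ≤⟨ ℕ.*-monoʳ-≤ 3 B<d ⟩
      3 * d ∎
      where
      triple : ∀ B → 3 + (B + (B + B)) ≡ 3 * suc B
      triple = solve-∀
    exponent : 27 * (k * k) ≤ (16 * d) ^ 2
    exponent = begin
      27 * (k * k) ≤⟨ ℕ.*-monoʳ-≤ 27 (ℕ.*-mono-≤ k≤3d k≤3d) ⟩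
      27 * (3 * d * (3 * d)) ≡⟨ squares d ⟩
      243 * (d * d) ≤⟨ ℕ.*-monoˡ-≤ (d * d) (from-yes (243 ≤? 256)) ⟩
      256 * (d * d) ≡⟨ square d ⟩
      (16 * d) ^ 2 ∎
      where
      squares : ∀ d → 27 * (3 * d * (3 * d)) ≡ 243 * (d * d)
      squares = solve-∀
      square : ∀ d → 256 * (d * d) ≡ 16 * d * (16 * d * 1)
      square = solve-∀

corollary1p2 : Σ ℚ λ c → Positive c ×
    (∀ (N : ℕ) → Σ ℕ λ n → N < n ×
    (Σ (Graph n) λ G → IsCirculant G ×
    (Σ ℕ λ d → IsWLDimension G d × (c √log₂ n ≤ d))))
corollary1p2 = ℤ.+ 1 ℚ./ 16 , _ , λ N →
  -- B = N + 1 is positive and puts the order above N. For c = 1 / 16 the required bound reads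
  -- `order ^ 1` ≤ 2 ^ ((16 d) ^ 2).
  let open LargeDimension (suc N) (s≤s z≤n)
      d , isDimension , B<d = dimension
  in order , ℕ.<-trans (ℕ.n<1+n N) B<order , G , circulant , d , isDimension ,
     ℕ.≤-trans (ℕ.≤-reflexive (ℕ.*-identityʳ _)) (order-bound B<d)
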